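{- Let $r\ge s\ge0$ be integers with $r$ even, $n=2(r+s)$, and let $G(r,s)$ be the Cayley graph on $\mathbb{Z}_4^n$ whose connection set is the set of vectors of type $(r,s,r,s)$. Then the smallest adjacency eigenvalue of $G(r,s)$ satisfies $$\lambda_{\min}(G(r,s))=\lambda(0,1,n-2,1)=-\frac{\binom{n}{r,s,r,s}}{n-1}$$ in each of the following regimes: (R1) $s\ge2$ is fixed and $n$ is large enough (i.e., for each fixed $s\ge2$ there is $N$ such that this holds for all such $r$ with $n\ge N$); (R2) $s=\alpha\cdot\frac n2$ with fixed $0<\alpha\le0.17$ and $n$ large enough (i.e., for each such $\alpha$ there is $N$ such that this holds for all $n\ge N$ for which $s=\alpha n/2$ is an integer and $r=n/2-s$ is even with $r\ge s$).
   Context: For $\mathbf{v}\in\mathbb{Z}_4^n$, its type is $(t_0,t_1,t_2,t_3)$ where $t_k$ is the number of coordinates equal to $k$. The Cayley graph has vertex set $\mathbb{Z}_4^n$, with $\mathbf{u},\mathbf{w}$ adjacent iff $\mathbf{u}-\mathbf{w}$ has type $(r,s,r,s)$. Its eigenvalues are $\lambda(\mathbf{v})=\sum_{\mathbf{b}}\zeta_4^{\mathbf{b}\cdot\mathbf{v}}$ ($\mathbf{b}$ ranging over vectors of type $(r,s,r,s)$, $\zeta_4=\sqrt{ -1}$, $\mathbf{b}\cdot\mathbf{v}=\sum_kb_kv_k\in\mathbb{Z}_4$), which depends only on the type $(t_0,t_1,t_2,t_3)$ of $\mathbf{v}$ and is denoted $\lambda(t_0,t_1,t_2,t_3)$. $\binom{n}{r,s,r,s}=\frac{n!}{(r!)^2(s!)^2}$.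 -}

module Defs where

open import Data.Nat as ℕ using (ℕ; zero; suc; _∸_; NonZero)
open import Data.Nat.Properties using (m*n≢0)
open import Data.Nat.Base using (_!)
open import Data.Nat.Properties using (_!≢0)
open import Data.Fin using (Fin; toℕ; zero; suc)
open import Data.Fin.Properties using () renaming (_≟_ to _≟ᶠ_)
open import Data.Vec using (Vec; []; _∷_; replicate; _++_; zipWith; foldr; count)
open import Data.List as L using (List; concatMap; map; filterᵇ)
open import Data.Integer as ℤ using (ℤ; +_; _⊓_)
open import Relation.Nullary.Decidable using (⌊_⌋)
open import Data.Bool using (Bool; _∧_)
open import Data.Nat using (_≡ᵇ_)

ℤ₄ : Set
ℤ₄ = Fin 4

allVecs : (n : ℕ) → List (Vec ℤ₄ n)
allVecs zero    = L.[ [] ]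
allVecs (suc n) = concatMap (λ x → map (x ∷_) (allVecs n)) (zero L.∷ suc zero L.∷ suc (suc zero) L.∷ suc (suc (suc zero)) L.∷ L.[])

cnt : ∀ {n} → ℤ₄ → Vec ℤ₄ n → ℕ
cnt k v = count (λ x → x ≟ᶠ k) v

hasTypeᵇ : ∀ {n} → Vec ℤ₄ n → ℕ → ℕ → ℕ → ℕ → Bool
hasTypeᵇ v t0 t1 t2 t3 =
  (cnt zero v ≡ᵇ t0) ∧ (cnt (suc zero) v ≡ᵇ t1) ∧
  (cnt (suc (suc zero)) v ≡ᵇ t2) ∧ (cnt (suc (suc (suc zero))) v ≡ᵇ t3)

connSet : (r s n : ℕ) → List (Vec ℤ₄ n)
connSet r s n = filterᵇ (λ b → hasTypeᵇ b r s r s) (allVecs n)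

dot : ∀ {n} → Vec ℤ₄ n → Vec ℤ₄ n → ℕ
dot b v = foldr _ ℕ._+_ 0 (zipWith (λ x y → toℕ x ℕ.* toℕ y) b v) ℕ.% 4

infix 4 _+i_
record ℤ[i] : Set where
  constructor _+i_
  field re im : ℤ
open ℤ[i] public

_⊕_ : ℤ[i] → ℤ[i] → ℤ[i]
(a +i b) ⊕ (c +i d) = (a ℤ.+ c) +i (b ℤ.+ d)

-- ζ₄^k for k ∈ {0,1,2,3}, ζ₄ = √-1
ζ₄^ : ℕ → ℤ[i]
ζ₄^ 0 = + 1 +i + 0
ζ₄^ 1 = + 0 +i + 1
ζ₄^ 2 = ℤ.- + 1 +i + 0
ζ₄^ _ = + 0 +i ℤ.- + 1

eigenC : (r s : ℕ) → ∀ {n} → Vec ℤ₄ n → ℤ[i]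
eigenC r s {n} v = L.foldr (λ b acc → ζ₄^ (dot b v) ⊕ acc) (+ 0 +i + 0) (connSet r s n)

-- the eigenvalue as a real number (its imaginary part is 0 since the
-- connection set is closed under negation); we take the real part.
eigen : (r s : ℕ) → ∀ {n} → Vec ℤ₄ n → ℤ
eigen r s v = re (eigenC r s v)

typeVec : (t0 t1 t2 t3 : ℕ) → Vec ℤ₄ (t0 ℕ.+ (t1 ℕ.+ (t2 ℕ.+ t3)))
typeVec t0 t1 t2 t3 =
  replicate t0 zero ++ replicate t1 (suc zero) ++
  replicate t2 (suc (suc zero)) ++ replicate t3 (suc (suc (suc zero)))

eigenType : (r s t0 t1 t2 t3 : ℕ) → ℤ
eigenType r s t0 t1 t2 t3 = eigen r s (typeVec t0 t1 t2 t3)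

lamMin : (r s n : ℕ) → ℤ
lamMin r s n = L.foldr (λ v acc → eigen r s v ⊓ acc) (eigen r s (replicate n zero)) (allVecs n)

multinom : (n r s : ℕ) → ℕ
multinom n r s = (n ! ℕ./ (r ! ℕ.* r ! ℕ.* s ! ℕ.* s !))
  {{m*n≢0 (r ! ℕ.* r ! ℕ.* s !) (s !) {{m*n≢0 (r ! ℕ.* r !) (s !) {{m*n≢0 (r !) (r !) {{r !≢0}} {{r !≢0}}}} {{s !≢0}}}} {{s !≢0}}}}

{-# OPTIONS --safe #-}
-- Write n = 2(r + s) and M = n! / (r!² s!²).  Splitting each vector of the connection set by the
-- positions of its odd entries turns λ(v) into a signed sum, over the 2s-subsets S of the
-- coordinates, of κ_r(c) κ_s(d), where κ_r(c) = [xʳyʳ] (x + y)^{2r−c} (x − y)^c, and c and d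
-- are the numbers of odd coordinates of v outside and inside S; put m = c + d.  The Euler operator x∂ₓ − y∂ᵧ gives
-- (2r − c − 1) κ_r(c + 2) = −(c + 1) κ_r(c): odd c contribute nothing and all nonzero products
-- κ_r(c) κ_s(d) have the sign (−1)^{m/2}.  Hence |λ(v)| is at most the absolute value w(m) of the
-- unsigned sum, which obeys the same recurrence (n − m − 1) w(m + 2) = (m + 1) w(m), so that
-- w(m) ≤ w(2) = M / (n − 1) for even m with 2 ≤ m ≤ n − 2; the vector of type (0, 1, n − 2, 1) attains −w(2).
--
-- For m = 0, and for m = n as r is even, λ(v) is a positive multiple of the Krawtchouk value
-- K(t) = [x^{2s}] (1 + x)^{n−t} (1 − x)^t, and (n − 1) K(t) ≥ −C(n, 2s) is needed.  By symmetry t ≤ n/2;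
-- put D = n − 2t.  If D is large, the three-term recurrence in the degree keeps the coefficients
-- nonnegative.  Otherwise expand (1 + x)^D (1 − x²)^t: the term j = 0 is positive, the term j = 1 is
-- at most C(n, 2s) / (2(n − 1)) because C(D, 2s − 2) is much smaller than C(n − 2, 2s − 2), and so are
-- the remaining ones together, since 2(n − 1) C(t, j) ≤ C(t, j)² ≤ C(2t, 2j).
module Submission where

open import Defs
open import Data.Bool using (Bool; true; false; if_then_else_; _∧_)
open import Data.Empty using (⊥-elim)
open import Data.Fin using (toℕ) renaming (zero to fzero; suc to fsuc)
open import Data.Integer as ℤ using (ℤ; +_; 0ℤ; 1ℤ)
import Data.Integer.Properties as ℤₚ
open import Data.Integer.Tactic.RingSolver using (solve-∀)
open import Data.List as L using (List; filterᵇ)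
open import Data.List.Membership.Propositional using (_∈_)
open import Data.List.Membership.Propositional.Properties using (∈-++⁺ˡ; ∈-++⁺ʳ; ∈-map⁺)
open import Data.List.Relation.Unary.Any using (here; there)
open import Data.Nat as ℕ using (ℕ; zero; suc; _≡ᵇ_; _!; _≤_; _∸_)
open import Data.Nat.Combinatorics using (_C_; nCk+nC[k+1]≡[n+1]C[k+1]; nC1≡n; k![n∸k]!∣n!; nCk≡n!/k![n-k]!)
import Data.Nat.DivMod as DM
open import Data.Nat.Divisibility using (_∣_; divides)
import Data.Nat.Properties as ℕₚ
open import Data.Nat.Tactic.RingSolver using () renaming (solve-∀ to solve-∀ℕ)
open import Data.Product using (∃; _×_; _,_; proj₁; proj₂)
open import Data.Rational as ℚ using (ℚ; _/_; mkℚ; toℚᵘ)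
import Data.Rational.Properties as ℚₚ
open import Data.Rational.Unnormalised using (mkℚᵘ; *≡*)
import Data.Rational.Unnormalised.Properties as ℚᵘₚ
open import Data.Sum using (_⊎_; inj₁; inj₂)
open import Data.Vec as V using (Vec; []; _∷_)
open import Function using (_∘_)
open import Relation.Binary.PropositionalEquality
open import Relation.Nullary using (yes; no; ¬_)

-- Absolute values decide everything except m = 0 and m = n: there the unsigned sum is as large as M
-- itself (the zero vector has eigenvalue M), so the sign has to be controlled, which is what brings
-- in Krawtchouk values. The two methods for these must overlap in D. With k = 2s, the recurrence
-- asks for roughly 4k(n - k) ≤ D². The expansion asks for t - s ≥ 2√n, which makes C(t, j) ≥ 2(n -
-- 1), and for D/n away from 1, which makes C(D, 2s - 2) small. For s proportional to n the methods
-- meet at D = 4n/5, that is t = n/10: there both demands amount to k < n/5, and k ≤ 0.17 n leaves a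
-- margin for explicit constants. For fixed s a cut near D = n/4 serves. All estimates are
-- multiplied by their denominators, so they live in ℤ and ℕ, and families of coefficients carry
-- counters that only grow, so that inductions need no truncated subtraction.

pattern 𝟘 = fzero
pattern 𝟙 = fsuc fzero
pattern 𝟚 = fsuc (fsuc fzero)
pattern 𝟛 = fsuc (fsuc (fsuc fzero))

-- Eigenvalues as weighted sums over all vectors

-- ρ k = Re (√-1 ^ k)
ρ : ℕ → ℤ
ρ 0 = + 1
ρ 1 = + 0
ρ (suc (suc k)) = ℤ.- ρ k

ρ+2 : ∀ k m → ρ (k ℕ.+ suc (suc m)) ≡ ℤ.- ρ (k ℕ.+ m)
ρ+2 k m = cong ρ (trans (ℕₚ.+-suc k (suc m)) (cong suc (ℕₚ.+-suc k m)))

re-ζ₄ : ∀ k → re (ζ₄^ (k ℕ.% 4)) ≡ ρ k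
re-ζ₄ 0 = refl
re-ζ₄ 1 = refl
re-ζ₄ 2 = refl
re-ζ₄ 3 = refl
re-ζ₄ (suc (suc (suc (suc k)))) = begin
  re (ζ₄^ ((4 ℕ.+ k) ℕ.% 4)) ≡⟨ cong (λ m → re (ζ₄^ (m ℕ.% 4))) (ℕₚ.+-comm 4 k) ⟩
  re (ζ₄^ ((k ℕ.+ 4) ℕ.% 4)) ≡⟨ cong (re ∘ ζ₄^) (DM.[m+n]%n≡m%n k 4) ⟩
  re (ζ₄^ (k ℕ.% 4))         ≡⟨ re-ζ₄ k ⟩
  ρ k                        ≡⟨ sym (ℤₚ.neg-involutive (ρ k)) ⟩
  ℤ.- ℤ.- ρ k                ∎
  where open ≡-Reasoning

sumℤ : ∀ {A : Set} → (A → ℤ) → List A → ℤ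
sumℤ f L.[] = + 0
sumℤ f (x L.∷ xs) = f x ℤ.+ sumℤ f xs

sumℤ-cong : ∀ {A : Set} {f g : A → ℤ} → (∀ x → f x ≡ g x) → ∀ xs → sumℤ f xs ≡ sumℤ g xs
sumℤ-cong h L.[] = refl
sumℤ-cong h (x L.∷ xs) = cong₂ ℤ._+_ (h x) (sumℤ-cong h xs)

sumℤ-++ : ∀ {A : Set} (f : A → ℤ) xs ys → sumℤ f (xs L.++ ys) ≡ sumℤ f xs ℤ.+ sumℤ f ys
sumℤ-++ f L.[] ys = sym (ℤₚ.+-identityˡ _)
sumℤ-++ f (x L.∷ xs) ys = trans (cong (ℤ._+_ (f x)) (sumℤ-++ f xs ys)) (sym (ℤₚ.+-assoc (f x) _ _))

sumℤ-map : ∀ {A B : Set} (f : B → ℤ) (h : A → B) xs → sumℤ f (L.map h xs) ≡ sumℤ (f ∘ h) xs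
sumℤ-map f h L.[] = refl
sumℤ-map f h (x L.∷ xs) = cong (ℤ._+_ (f (h x))) (sumℤ-map f h xs)

indicator : Bool → ℤ
indicator b = if b then + 1 else + 0

indicator-∧ : ∀ x y → indicator (x ∧ y) ≡ indicator x ℤ.* indicator y
indicator-∧ true  y = sym (ℤₚ.*-identityˡ (indicator y))
indicator-∧ false y = sym (ℤₚ.*-zeroˡ (indicator y))

dotℕ : ∀ {n} → Vec ℤ₄ n → Vec ℤ₄ n → ℕ
dotℕ b v = V.foldr _ ℕ._+_ 0 (V.zipWith (λ x y → toℕ x ℕ.* toℕ y) b v)

re-sum-filter : ∀ {A : Set} (p : A → Bool) (k : A → ℕ) xs →
  re (L.foldr (λ b acc → ζ₄^ (k b ℕ.% 4) ⊕ acc) (+ 0 +i + 0) (filterᵇ p xs))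
    ≡ sumℤ (λ b → ρ (k b) ℤ.* indicator (p b)) xs
re-sum-filter p k L.[] = refl
re-sum-filter p k (x L.∷ xs) with p x
... | true  = cong₂ ℤ._+_ (trans (re-ζ₄ (k x)) (sym (ℤₚ.*-identityʳ _))) (re-sum-filter p k xs)
... | false = trans (re-sum-filter p k xs)
                (trans (sym (ℤₚ.+-identityˡ _)) (cong (ℤ._+ _) (sym (ℤₚ.*-zeroʳ (ρ (k x))))))

TypeFun : Set
TypeFun = ℕ → ℕ → ℕ → ℕ → ℤ

-- The weight ψ generalises the indicator of the type and e is the exponent of √-1 collected so far.
-- Both are needed for the family to be closed under removing the first coordinate, which shifts ψ
-- by one of `X₀`, ..., `X₃` and increases e.
typeSum : ∀ {n} → Vec ℤ₄ n → TypeFun → ℕ → ℤ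
typeSum {n} v ψ e =
  sumℤ (λ b → ρ (dotℕ b v ℕ.+ e) ℤ.* ψ (cnt 𝟘 b) (cnt 𝟙 b) (cnt 𝟚 b) (cnt 𝟛 b)) (allVecs n)

X₀ X₁ X₂ X₃ : TypeFun → TypeFun
X₀ ψ p q t u = ψ (suc p) q t u
X₁ ψ p q t u = ψ p (suc q) t u
X₂ ψ p q t u = ψ p q (suc t) u
X₃ ψ p q t u = ψ p q t (suc u)

typeSum-∷ : ∀ {n} (x : ℤ₄) (v : Vec ℤ₄ n) ψ e → typeSum (x ∷ v) ψ e ≡
  typeSum v (X₀ ψ) e ℤ.+ (typeSum v (X₁ ψ) (1 ℕ.* toℕ x ℕ.+ e) ℤ.+
  (typeSum v (X₂ ψ) (2 ℕ.* toℕ x ℕ.+ e) ℤ.+ typeSum v (X₃ ψ) (3 ℕ.* toℕ x ℕ.+ e)))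
typeSum-∷ {n} x v ψ e = begin
  sumℤ f (m 𝟘 L.++ (m 𝟙 L.++ (m 𝟚 L.++ (m 𝟛 L.++ L.[]))))
    ≡⟨ sumℤ-++ f (m 𝟘) _ ⟩
  sumℤ f (m 𝟘) ℤ.+ sumℤ f (m 𝟙 L.++ (m 𝟚 L.++ (m 𝟛 L.++ L.[])))
    ≡⟨ cong₂ ℤ._+_ (part 𝟘 (X₀ ψ) (λ b → refl)) (trans (sumℤ-++ f (m 𝟙) _)
        (cong₂ ℤ._+_ (part 𝟙 (X₁ ψ) (λ b → refl)) (trans (sumℤ-++ f (m 𝟚) _)
        (cong₂ ℤ._+_ (part 𝟚 (X₂ ψ) (λ b → refl)) (trans (sumℤ-++ f (m 𝟛) _)
          (trans (ℤₚ.+-identityʳ _) (part 𝟛 (X₃ ψ) (λ b → refl)))))))) ⟩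
  _ ∎
  where
  open ≡-Reasoning
  weight : TypeFun → ∀ {k} → Vec ℤ₄ k → ℤ
  weight φ b = φ (cnt 𝟘 b) (cnt 𝟙 b) (cnt 𝟚 b) (cnt 𝟛 b)
  f : Vec ℤ₄ (suc n) → ℤ
  f b = ρ (dotℕ b (x ∷ v) ℕ.+ e) ℤ.* weight ψ b
  m : ℤ₄ → List (Vec ℤ₄ (suc n))
  m y = L.map (y ∷_) (allVecs n)
  shuffle : ∀ a d → a ℕ.+ d ℕ.+ e ≡ d ℕ.+ (a ℕ.+ e)
  shuffle a d = trans (cong (ℕ._+ e) (ℕₚ.+-comm a d)) (ℕₚ.+-assoc d a e)
  part : ∀ y φ → (∀ b → weight ψ (y ∷ b) ≡ weight φ b) →
         sumℤ f (m y) ≡ typeSum v φ (toℕ y ℕ.* toℕ x ℕ.+ e)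
  part y φ h = trans (sumℤ-map f (y ∷_) (allVecs n))
    (sumℤ-cong (λ b → cong₂ ℤ._*_ (cong ρ (shuffle (toℕ y ℕ.* toℕ x) (dotℕ b v))) (h b)) (allVecs n))

sumℤ-+ : ∀ {A : Set} {f g h : A → ℤ} → (∀ x → f x ℤ.+ g x ≡ h x) → ∀ xs → sumℤ f xs ℤ.+ sumℤ g xs ≡ sumℤ h xs
sumℤ-+ eq L.[] = refl
sumℤ-+ {f = f} {g} eq (x L.∷ xs) =
  trans (shuffle (f x) (sumℤ f xs) (g x) (sumℤ g xs)) (cong₂ ℤ._+_ (eq x) (sumℤ-+ eq xs))
  where
  shuffle : ∀ a b c d → (a ℤ.+ b) ℤ.+ (c ℤ.+ d) ≡ (a ℤ.+ c) ℤ.+ (b ℤ.+ d)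
  shuffle = solve-∀

typeSum-+ : ∀ {n} (v : Vec ℤ₄ n) ψ φ {θ} e → (∀ p q t u → ψ p q t u ℤ.+ φ p q t u ≡ θ p q t u) →
  typeSum v ψ e ℤ.+ typeSum v φ e ≡ typeSum v θ e
typeSum-+ {n} v ψ φ e h = sumℤ-+ (λ b →
  trans (sym (ℤₚ.*-distribˡ-+ (ρ (dotℕ b v ℕ.+ e)) _ _)) (cong (ℤ._*_ (ρ (dotℕ b v ℕ.+ e))) (h _ _ _ _))) (allVecs n)

sumℤ-neg : ∀ {A : Set} {f g : A → ℤ} → (∀ x → f x ≡ ℤ.- g x) → ∀ xs → sumℤ f xs ≡ ℤ.- sumℤ g xs
sumℤ-neg eq L.[] = refl
sumℤ-neg {g = g} eq (x L.∷ xs) = trans (cong₂ ℤ._+_ (eq x) (sumℤ-neg eq xs)) (sym (ℤₚ.neg-distrib-+ (g x) _))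

typeSum-neg : ∀ {n} (v : Vec ℤ₄ n) ψ {φ} e → (∀ p q t u → φ p q t u ≡ ℤ.- ψ p q t u) →
  typeSum v φ e ≡ ℤ.- typeSum v ψ e
typeSum-neg {n} v ψ e h = sumℤ-neg (λ b → trans (cong (ℤ._*_ (ρ (dotℕ b v ℕ.+ e))) (h _ _ _ _))
  (sym (ℤₚ.neg-distribʳ-* (ρ (dotℕ b v ℕ.+ e)) _))) (allVecs n)

typeSum-2+ : ∀ {n} (v : Vec ℤ₄ n) ψ e → typeSum v ψ (suc (suc e)) ≡ ℤ.- typeSum v ψ e
typeSum-2+ {n} v ψ e = sumℤ-neg (λ b → trans (cong (ℤ._* _) (ρ+2 (dotℕ b v) e))
  (sym (ℤₚ.neg-distribˡ-* (ρ (dotℕ b v ℕ.+ e)) _))) (allVecs n)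

typeSum-4+ : ∀ {n} (v : Vec ℤ₄ n) ψ e → typeSum v ψ (4 ℕ.+ e) ≡ typeSum v ψ e
typeSum-4+ v ψ e = trans (typeSum-2+ v ψ (2 ℕ.+ e))
  (trans (cong ℤ.-_ (typeSum-2+ v ψ e)) (ℤₚ.neg-involutive _))

-- Splitting even and odd entries: the signed sum `T`

δ : ℕ → ℕ → ℤ
δ p r = indicator (p ≡ᵇ r)

-- g r a c p q is the coefficient of x^{r−p} y^{r−q} in (x + y)ᵃ (x − y)ᶜ; indexing by p and q
-- turns multiplication by x and y into increments, so that no index is ever decreased.
g : ℕ → (a c p q : ℕ) → ℤ
g r zero    zero    p q = δ p r ℤ.* δ q r
g r zero    (suc c) p q = g r zero c (suc p) q ℤ.- g r zero c p (suc q)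
g r (suc a) c       p q = g r a c (suc p) q ℤ.+ g r a c p (suc q)

-- The recursion uses up the factors x + y first; as the factors commute, a factor x - y can be
-- split off at any time.
g-sucʳ : ∀ r a c p q → g r a (suc c) p q ≡ g r a c (suc p) q ℤ.- g r a c p (suc q)
g-sucʳ r zero    c p q = refl
g-sucʳ r (suc a) c p q = trans (cong₂ ℤ._+_ (g-sucʳ r a c (suc p) q) (g-sucʳ r a c p (suc q)))
  (shuffle (g r a c (suc (suc p)) q) (g r a c (suc p) (suc q)) (g r a c p (suc (suc q))))
  where
  shuffle : ∀ x y z → (x ℤ.- y) ℤ.+ (y ℤ.- z) ≡ (x ℤ.+ y) ℤ.- (y ℤ.+ z)
  shuffle = solve-∀

Q : (r s a b c d : ℕ) → ℤ
Q r s a b c d = g r a c 0 0 ℤ.* g s b d 0 0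

-- The linear form of a coordinate 0, 1, 2, 3 of v is A + B, C + √-1 D, A − B, C − √-1 D with
-- A = x₀ + x₂, B = x₁ + x₃, C = x₀ − x₂, D = x₁ − x₃; the arguments a b c d count the factors chosen.
T : (r s : ℕ) → ∀ {n} → Vec ℤ₄ n → (a b c d : ℕ) → ℤ
T r s []      a b c d = ρ d ℤ.* Q r s a b c d
T r s (𝟘 ∷ v) a b c d = T r s v (suc a) b c d ℤ.+ T r s v a (suc b) c d
T r s (𝟙 ∷ v) a b c d = T r s v a b (suc c) d ℤ.+ T r s v a b c (suc d)
T r s (𝟚 ∷ v) a b c d = T r s v (suc a) b c d ℤ.- T r s v a (suc b) c d
T r s (𝟛 ∷ v) a b c d = T r s v a b (suc c) d ℤ.- T r s v a b c (suc d)

-- A and C involve only x₀ and x₂, B and D only x₁ and x₃. Hence a coefficient of a product of such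
-- forms factors, with p, t tested against r and q, u against s.
G : (r s a b c d : ℕ) → TypeFun
G r s a b c d p q t u = g r a c p t ℤ.* g s b d q u

-- The summands for entries 0 and 2 of the removed coordinate merge into A or C, those for 1 and 3
-- into B or D, according to the parity of x. Each chosen D carries one factor √-1, so the exponent
-- equals the counter d.
typeSum-G : ∀ r s {n} (v : Vec ℤ₄ n) a b c d → typeSum v (G r s a b c d) d ≡ T r s v a b c d
typeSum-G r s [] a b c d = ℤₚ.+-identityʳ _
typeSum-G r s (x ∷ v) a b c d = trans (typeSum-∷ x v (G r s a b c d) d) (step x)
  where
  open ≡-Reasoning
  ψ = G r s a b c d
  A-part : typeSum v (X₀ ψ) d ℤ.+ typeSum v (X₂ ψ) d ≡ T r s v (suc a) b c d
  A-part = trans (typeSum-+ v (X₀ ψ) (X₂ ψ) d (λ p q t u → sym (ℤₚ.*-distribʳ-+ (g s b d q u) (g r a c (suc p) t) (g r a c p (suc t)))))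
    (typeSum-G r s v (suc a) b c d)
  B-part : typeSum v (X₁ ψ) d ℤ.+ typeSum v (X₃ ψ) d ≡ T r s v a (suc b) c d
  B-part = trans (typeSum-+ v (X₁ ψ) (X₃ ψ) d (λ p q t u → sym (ℤₚ.*-distribˡ-+ (g r a c p t) _ _)))
    (typeSum-G r s v a (suc b) c d)
  minus : ∀ φ χ e {θ} → (∀ p q t u → θ p q t u ≡ φ p q t u ℤ.- χ p q t u) →
    typeSum v φ e ℤ.- typeSum v χ e ≡ typeSum v θ e
  minus φ χ e h = trans (cong (ℤ._+_ (typeSum v φ e))
    (sym (typeSum-neg v χ {λ p q t u → ℤ.- χ p q t u} e (λ p q t u → refl))))
    (typeSum-+ v φ (λ p q t u → ℤ.- χ p q t u) e (λ p q t u → sym (h p q t u)))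
  distribʳ : ∀ x y z → (y ℤ.- z) ℤ.* x ≡ y ℤ.* x ℤ.- z ℤ.* x
  distribʳ = solve-∀
  distribˡ : ∀ x y z → x ℤ.* (y ℤ.- z) ≡ x ℤ.* y ℤ.- x ℤ.* z
  distribˡ = solve-∀
  C-part : typeSum v (X₀ ψ) d ℤ.- typeSum v (X₂ ψ) d ≡ T r s v a b (suc c) d
  C-part = trans (minus (X₀ ψ) (X₂ ψ) d (λ p q t u →
    trans (cong (ℤ._* g s b d q u) (g-sucʳ r a c p t)) (distribʳ (g s b d q u) (g r a c (suc p) t) (g r a c p (suc t)))))
    (typeSum-G r s v a b (suc c) d)
  D-part : typeSum v (X₁ ψ) (suc d) ℤ.- typeSum v (X₃ ψ) (suc d) ≡ T r s v a b c (suc d)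
  D-part = trans (minus (X₁ ψ) (X₃ ψ) (suc d) (λ p q t u →
    trans (cong (ℤ._*_ (g r a c p t)) (g-sucʳ s b d q u)) (distribˡ (g r a c p t) _ _)))
    (typeSum-G r s v a b c (suc d))
  at : TypeFun → ℕ → ℤ
  at = typeSum v
  2+ : ∀ φ e → at φ (suc (suc e)) ≡ ℤ.- at φ e
  2+ = typeSum-2+ v
  4+ : ∀ φ e → at φ (4 ℕ.+ e) ≡ at φ e
  4+ = typeSum-4+ v
  step : ∀ x → at (X₀ ψ) d ℤ.+ (at (X₁ ψ) (1 ℕ.* toℕ x ℕ.+ d) ℤ.+
    (at (X₂ ψ) (2 ℕ.* toℕ x ℕ.+ d) ℤ.+ at (X₃ ψ) (3 ℕ.* toℕ x ℕ.+ d))) ≡ T r s (x ∷ v) a b c d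
  step 𝟘 = trans (shuffle (at (X₀ ψ) d) (at (X₁ ψ) d) (at (X₂ ψ) d) (at (X₃ ψ) d)) (cong₂ ℤ._+_ A-part B-part)
    where
    shuffle : ∀ w x y z → w ℤ.+ (x ℤ.+ (y ℤ.+ z)) ≡ (w ℤ.+ y) ℤ.+ (x ℤ.+ z)
    shuffle = solve-∀
  step 𝟙 = trans (cong₂ (λ y z → at (X₀ ψ) d ℤ.+ (at (X₁ ψ) (suc d) ℤ.+ (y ℤ.+ z)))
      (2+ (X₂ ψ) d) (2+ (X₃ ψ) (suc d)))
    (trans (shuffle (at (X₀ ψ) d) (at (X₁ ψ) (suc d)) (at (X₂ ψ) d) (at (X₃ ψ) (suc d))) (cong₂ ℤ._+_ C-part D-part))
    where
    shuffle : ∀ w x y z → w ℤ.+ (x ℤ.+ (ℤ.- y ℤ.+ ℤ.- z)) ≡ (w ℤ.- y) ℤ.+ (x ℤ.- z)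
    shuffle = solve-∀
  step 𝟚 = trans (cong₂ (λ x yz → at (X₀ ψ) d ℤ.+ (x ℤ.+ yz)) (2+ (X₁ ψ) d)
      (cong₂ ℤ._+_ (4+ (X₂ ψ) d) (trans (4+ (X₃ ψ) (2 ℕ.+ d)) (2+ (X₃ ψ) d))))
    (trans (shuffle (at (X₀ ψ) d) (at (X₁ ψ) d) (at (X₂ ψ) d) (at (X₃ ψ) d)) (cong₂ ℤ._-_ A-part B-part))
    where
    shuffle : ∀ w x y z → w ℤ.+ (ℤ.- x ℤ.+ (y ℤ.+ ℤ.- z)) ≡ (w ℤ.+ y) ℤ.- (x ℤ.+ z)
    shuffle = solve-∀
  step 𝟛 = trans (cong₂ (λ x yz → at (X₀ ψ) d ℤ.+ (x ℤ.+ yz)) (2+ (X₁ ψ) (suc d))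
      (cong₂ ℤ._+_ (trans (4+ (X₂ ψ) (2 ℕ.+ d)) (2+ (X₂ ψ) d)) (trans (4+ (X₃ ψ) (5 ℕ.+ d)) (4+ (X₃ ψ) (suc d)))))
    (trans (shuffle (at (X₀ ψ) d) (at (X₁ ψ) (suc d)) (at (X₂ ψ) d) (at (X₃ ψ) (suc d))) (cong₂ ℤ._-_ C-part D-part))
    where
    shuffle : ∀ w x y z → w ℤ.+ (ℤ.- x ℤ.+ (ℤ.- y ℤ.+ z)) ≡ (w ℤ.- y) ℤ.- (x ℤ.- z)
    shuffle = solve-∀

-- For empty products `G` is the indicator of the type (r, s, r, s).
eigen≡T : ∀ r s {n} (v : Vec ℤ₄ n) → eigen r s v ≡ T r s v 0 0 0 0
eigen≡T r s {n} v = begin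
  eigen r s v
    ≡⟨ re-sum-filter (λ b → hasTypeᵇ b r s r s) (λ b → dotℕ b v) (allVecs n) ⟩
  sumℤ (λ b → ρ (dotℕ b v) ℤ.* indicator (hasTypeᵇ b r s r s)) (allVecs n)
    ≡⟨ sumℤ-cong (λ b → cong₂ ℤ._*_ (cong ρ (sym (ℕₚ.+-identityʳ (dotℕ b v)))) (split b)) (allVecs n) ⟩
  typeSum v (G r s 0 0 0 0) 0
    ≡⟨ typeSum-G r s v 0 0 0 0 ⟩
  T r s v 0 0 0 0 ∎
  where
  open ≡-Reasoning
  shuffle : ∀ w x y z → w ℤ.* (x ℤ.* (y ℤ.* z)) ≡ (w ℤ.* y) ℤ.* (x ℤ.* z)
  shuffle = solve-∀
  split : ∀ (b : Vec ℤ₄ n) → indicator (hasTypeᵇ b r s r s) ≡ G r s 0 0 0 0 (cnt 𝟘 b) (cnt 𝟙 b) (cnt 𝟚 b) (cnt 𝟛 b)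
  split b = trans (indicator-∧ (cnt 𝟘 b ≡ᵇ r) _)
    (trans (cong (ℤ._*_ (δ (cnt 𝟘 b) r)) (trans (indicator-∧ (cnt 𝟙 b ≡ᵇ s) _)
      (cong (ℤ._*_ (δ (cnt 𝟙 b) s)) (indicator-∧ (cnt 𝟚 b ≡ᵇ r) _))))
    (shuffle (δ (cnt 𝟘 b) r) (δ (cnt 𝟙 b) s) (δ (cnt 𝟚 b) r) (δ (cnt 𝟛 b) s)))

-- Parity, signs and bounds on absolute values

double : ℕ → ℕ
double zero    = zero
double (suc k) = suc (suc (double k))

double≡ : ∀ k → double k ≡ k ℕ.+ k
double≡ zero    = refl
double≡ (suc k) = cong suc (trans (cong suc (double≡ k)) (sym (ℕₚ.+-suc k k)))

double-+ : ∀ j k → double (j ℕ.+ k) ≡ double j ℕ.+ double k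
double-+ zero    k = refl
double-+ (suc j) k = cong (suc ∘ suc) (double-+ j k)

double-injective : ∀ j k → double j ≡ double k → j ≡ k
double-injective zero    zero    _  = refl
double-injective (suc j) (suc k) eq = cong suc (double-injective j k (ℕₚ.suc-injective (ℕₚ.suc-injective eq)))

odd≢even : ∀ j k → suc (double j) ≢ double k
odd≢even zero    (suc zero)    ()
odd≢even zero    (suc (suc k)) ()
odd≢even (suc j) (suc k)       eq = odd≢even j k (ℕₚ.suc-injective (ℕₚ.suc-injective eq))

parity : ∀ k → ∃ (λ j → k ≡ double j) ⊎ ∃ (λ j → k ≡ suc (double j))
parity zero = inj₁ (0 , refl)
parity (suc k) with parity k
... | inj₁ (j , eq) = inj₂ (j , cong suc eq)
... | inj₂ (j , eq) = inj₁ (suc j , cong suc eq)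

sgn : ℕ → ℤ
sgn zero    = 1ℤ
sgn (suc k) = ℤ.- sgn k

sgn-+ : ∀ j k → sgn (j ℕ.+ k) ≡ sgn j ℤ.* sgn k
sgn-+ zero    k = sym (ℤₚ.*-identityˡ _)
sgn-+ (suc j) k = trans (cong ℤ.-_ (sgn-+ j k)) (ℤₚ.neg-distribˡ-* (sgn j) (sgn k))

sgn² : ∀ k → sgn k ℤ.* sgn k ≡ 1ℤ
sgn² zero    = refl
sgn² (suc k) = trans (neg² (sgn k)) (sgn² k)
  where
  neg² : ∀ x → (ℤ.- x) ℤ.* (ℤ.- x) ≡ x ℤ.* x
  neg² = solve-∀

sgn-double : ∀ k → sgn (double k) ≡ 1ℤ
sgn-double zero    = refl
sgn-double (suc k) = trans (ℤₚ.neg-involutive _) (sgn-double k)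

ρ-double : ∀ k → ρ (double k) ≡ sgn k
ρ-double zero    = refl
ρ-double (suc k) = cong ℤ.-_ (ρ-double k)

infix 4 _≼_
_≼_ : ℤ → ℤ → Set
x ≼ y = x ℤ.≤ y × ℤ.- x ℤ.≤ y

≼-neg : ∀ {x y} → x ≼ y → ℤ.- x ≼ y
≼-neg {x} {y} (p , q) = q , subst (ℤ._≤ y) (sym (ℤₚ.neg-involutive x)) p

≼-+ : ∀ {x y u v} → x ≼ u → y ≼ v → x ℤ.+ y ≼ u ℤ.+ v
≼-+ {x} {y} (p , q) (p′ , q′) =
  ℤₚ.+-mono-≤ p p′ , subst (ℤ._≤ _) (sym (ℤₚ.neg-distrib-+ x y)) (ℤₚ.+-mono-≤ q q′)

≼-minus : ∀ {x y u v} → x ≼ u → y ≼ v → x ℤ.- y ≼ u ℤ.+ v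
≼-minus p q = ≼-+ p (≼-neg q)

≼-refl : ∀ {x} → 0ℤ ℤ.≤ x → x ≼ x
≼-refl {x} p = ℤₚ.≤-refl , ℤₚ.≤-trans (ℤₚ.neg-mono-≤ p) p

≼-sgn : ∀ k {x y} → x ≼ y → sgn k ℤ.* x ≼ y
≼-sgn zero    {x} {y} p = subst (_≼ y) (sym (ℤₚ.*-identityˡ x)) p
≼-sgn (suc k) {x} {y} p = subst (_≼ y) (ℤₚ.neg-distribˡ-* (sgn k) x) (≼-neg (≼-sgn k p))

0≤* : ∀ {x y} → 0ℤ ℤ.≤ x → 0ℤ ℤ.≤ y → 0ℤ ℤ.≤ x ℤ.* y
0≤* {x} {y} p q = subst (ℤ._≤ x ℤ.* y) (ℤₚ.*-zeroˡ y) (ℤₚ.*-monoʳ-≤-nonNeg y {{ℤ.nonNegative q}} p)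

-- 2 (u v − x y) = (u − x)(v + y) + (u + x)(v − y)
≼-* : ∀ {x y u v} → x ≼ u → y ≼ v → x ℤ.* y ≼ u ℤ.* v
≼-* {x} {y} {u} {v} (p , q) (p′ , q′) = bound p q p′ q′ ,
  subst (ℤ._≤ u ℤ.* v) (sym (ℤₚ.neg-distribˡ-* x y)) (bound q (proj₂ (≼-neg (p , q))) p′ q′)
  where
  identity : ∀ x y u v → (u ℤ.- x) ℤ.* (v ℤ.- (ℤ.- y)) ℤ.+ (u ℤ.- (ℤ.- x)) ℤ.* (v ℤ.- y)
    ≡ (+ 2) ℤ.* (u ℤ.* v ℤ.- x ℤ.* y)
  identity = solve-∀
  bound : ∀ {x} → x ℤ.≤ u → ℤ.- x ℤ.≤ u → y ℤ.≤ v → ℤ.- y ℤ.≤ v → x ℤ.* y ℤ.≤ u ℤ.* v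
  bound {x} p q p′ q′ = ℤₚ.0≤i-j⇒j≤i {u ℤ.* v} {x ℤ.* y}
    (ℤₚ.*-cancelˡ-≤-pos (+ 0) (u ℤ.* v ℤ.- x ℤ.* y) (+ 2)
    (subst (0ℤ ℤ.≤_) (identity x y u v)
      (ℤₚ.+-mono-≤ (0≤* (ℤₚ.i≤j⇒0≤j-i p) (ℤₚ.i≤j⇒0≤j-i q′)) (0≤* (ℤₚ.i≤j⇒0≤j-i q) (ℤₚ.i≤j⇒0≤j-i p′)))))

-- The Euler operator and the signs of κ

-- This is k f(k - 1), with value 0 at k = 0: what the Leibniz rule yields when a derivation hits
-- one of k equal factors.
pred· : ℕ → (ℕ → ℤ) → ℤ
pred· zero    f = 0ℤ
pred· (suc k) f = (1ℤ ℤ.+ + k) ℤ.* f k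

pred·-suc : ∀ k f → pred· k (f ∘ suc) ≡ + k ℤ.* f k
pred·-suc zero    f = sym (ℤₚ.*-zeroˡ (f 0))
pred·-suc (suc k) f = refl

pred·-cong : ∀ k {f h : ℕ → ℤ} → (∀ j → f j ≡ h j) → pred· k f ≡ pred· k h
pred·-cong zero    eq = refl
pred·-cong (suc k) eq = cong (ℤ._*_ (1ℤ ℤ.+ + k)) (eq k)

pred·-+ : ∀ k (f h : ℕ → ℤ) → pred· k (λ j → f j ℤ.+ h j) ≡ pred· k f ℤ.+ pred· k h
pred·-+ zero    f h = refl
pred·-+ (suc k) f h = ℤₚ.*-distribˡ-+ (1ℤ ℤ.+ + k) (f k) (h k)

pred·-neg : ∀ k (f : ℕ → ℤ) → pred· k (λ j → ℤ.- f j) ≡ ℤ.- pred· k f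
pred·-neg zero    f = refl
pred·-neg (suc k) f = sym (ℤₚ.neg-distribʳ-* (1ℤ ℤ.+ + k) (f k))

pred·-*ʳ : ∀ k (f : ℕ → ℤ) y → pred· k (λ j → f j ℤ.* y) ≡ pred· k f ℤ.* y
pred·-*ʳ zero    f y = sym (ℤₚ.*-zeroˡ y)
pred·-*ʳ (suc k) f y = sym (ℤₚ.*-assoc (1ℤ ℤ.+ + k) (f k) y)

pred·-*ˡ : ∀ k (f : ℕ → ℤ) y → pred· k (λ j → y ℤ.* f j) ≡ y ℤ.* pred· k f
pred·-*ˡ k f y = trans (pred·-cong k (λ j → ℤₚ.*-comm y (f j))) (trans (pred·-*ʳ k f y) (ℤₚ.*-comm _ y))

δ-off : ∀ p r → p ≢ r → δ p r ≡ 0ℤ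
δ-off zero    zero    p≢r = ⊥-elim (p≢r refl)
δ-off zero    (suc r) p≢r = refl
δ-off (suc p) zero    p≢r = refl
δ-off (suc p) (suc r) p≢r = δ-off p r (p≢r ∘ cong suc)

δδ-off : ∀ p q r s → ¬ (p ≡ r × q ≡ s) → δ p r ℤ.* δ q s ≡ 0ℤ
δδ-off p q r s off with p ℕ.≟ r
... | no p≢r = trans (cong (ℤ._* δ q s) (δ-off p r p≢r)) (ℤₚ.*-zeroˡ (δ q s))
... | yes p≡r = trans (cong (ℤ._*_ (δ p r)) (δ-off q s (λ q≡s → off (p≡r , q≡s)))) (ℤₚ.*-zeroʳ (δ p r))

-- The Euler operator x∂ₓ − y∂ᵧ maps x + y to x − y and x − y to x + y.
g-euler : ∀ r a c p q → (+ p ℤ.- + q) ℤ.* g r a c p q ℤ.+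
  (pred· a (λ a′ → g r a′ (suc c) p q) ℤ.+ pred· c (λ c′ → g r (suc a) c′ p q)) ≡ 0ℤ
g-euler r zero zero p q = trans (ℤₚ.+-identityʳ _) base
  where
  base : (+ p ℤ.- + q) ℤ.* (δ p r ℤ.* δ q r) ≡ 0ℤ
  base with p ℕ.≟ q
  ... | yes refl = trans (cong (ℤ._* (δ p r ℤ.* δ p r)) (ℤₚ.+-inverseʳ (+ p))) (ℤₚ.*-zeroˡ (δ p r ℤ.* δ p r))
  ... | no p≢q = trans (cong (ℤ._*_ (+ p ℤ.- + q)) (δδ-off p q r r (λ (e , f) → p≢q (trans e (sym f)))))
                  (ℤₚ.*-zeroʳ (+ p ℤ.- + q))
g-euler r zero (suc c) p q = begin
  (+ p ℤ.- + q) ℤ.* (x ℤ.- y) ℤ.+ (0ℤ ℤ.+ (1ℤ ℤ.+ + c) ℤ.* (x ℤ.+ y))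
    ≡⟨ shuffle (+ p) (+ q) (+ c) x y ⟩
  ((1ℤ ℤ.+ + p ℤ.- + q) ℤ.* x ℤ.- (+ p ℤ.- (1ℤ ℤ.+ + q)) ℤ.* y)
    ℤ.+ (+ c) ℤ.* (x ℤ.+ y) ℤ.+ ((x ℤ.+ y) ℤ.- (x ℤ.+ y))
    ≡⟨ cong₂ (λ u w → ((1ℤ ℤ.+ + p ℤ.- + q) ℤ.* x ℤ.- (+ p ℤ.- (1ℤ ℤ.+ + q)) ℤ.* y) ℤ.+ u ℤ.+ w)
        (trans (sym (pred·-suc c (λ c′ → g r 1 c′ p q)))
          (trans (pred·-cong c (λ c′ → g-sucʳ r 1 c′ p q))
          (trans (pred·-+ c (λ c′ → g r 1 c′ (suc p) q) (λ c′ → ℤ.- g r 1 c′ p (suc q)))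
            (cong (ℤ._+_ f₁) (pred·-neg c (λ c′ → g r 1 c′ p (suc q)))))))
        (ℤₚ.+-inverseʳ (x ℤ.+ y)) ⟩
  ((1ℤ ℤ.+ + p ℤ.- + q) ℤ.* x ℤ.- (+ p ℤ.- (1ℤ ℤ.+ + q)) ℤ.* y) ℤ.+ (f₁ ℤ.- f₂) ℤ.+ 0ℤ
    ≡⟨ shuffle′ ((1ℤ ℤ.+ + p ℤ.- + q) ℤ.* x) ((+ p ℤ.- (1ℤ ℤ.+ + q)) ℤ.* y) f₁ f₂ ⟩
  ((1ℤ ℤ.+ + p ℤ.- + q) ℤ.* x ℤ.+ (0ℤ ℤ.+ f₁)) ℤ.- ((+ p ℤ.- (1ℤ ℤ.+ + q)) ℤ.* y ℤ.+ (0ℤ ℤ.+ f₂))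
    ≡⟨ cong₂ ℤ._-_ (g-euler r zero c (suc p) q) (g-euler r zero c p (suc q)) ⟩
  0ℤ ∎
  where
  open ≡-Reasoning
  x = g r 0 c (suc p) q
  y = g r 0 c p (suc q)
  f₁ = pred· c (λ c′ → g r 1 c′ (suc p) q)
  f₂ = pred· c (λ c′ → g r 1 c′ p (suc q))
  shuffle : ∀ p q c x y → (p ℤ.- q) ℤ.* (x ℤ.- y) ℤ.+ (0ℤ ℤ.+ (1ℤ ℤ.+ c) ℤ.* (x ℤ.+ y))
    ≡ ((1ℤ ℤ.+ p ℤ.- q) ℤ.* x ℤ.- (p ℤ.- (1ℤ ℤ.+ q)) ℤ.* y) ℤ.+ c ℤ.* (x ℤ.+ y) ℤ.+ ((x ℤ.+ y) ℤ.- (x ℤ.+ y))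
  shuffle = solve-∀
  shuffle′ : ∀ x y u v → (x ℤ.- y) ℤ.+ (u ℤ.- v) ℤ.+ 0ℤ ≡ (x ℤ.+ (0ℤ ℤ.+ u)) ℤ.- (y ℤ.+ (0ℤ ℤ.+ v))
  shuffle′ = solve-∀
g-euler r (suc a) c p q = begin
  (+ p ℤ.- + q) ℤ.* (x ℤ.+ y) ℤ.+ ((1ℤ ℤ.+ + a) ℤ.* z ℤ.+ pred· c (λ c′ → g r (suc (suc a)) c′ p q))
    ≡⟨ cong (λ u → (+ p ℤ.- + q) ℤ.* (x ℤ.+ y) ℤ.+ ((1ℤ ℤ.+ + a) ℤ.* z ℤ.+ u))
        (pred·-+ c (λ c′ → g r (suc a) c′ (suc p) q) (λ c′ → g r (suc a) c′ p (suc q))) ⟩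
  (+ p ℤ.- + q) ℤ.* (x ℤ.+ y) ℤ.+ ((1ℤ ℤ.+ + a) ℤ.* z ℤ.+ (f₁ ℤ.+ f₂))
    ≡⟨ shuffle (+ p) (+ q) (+ a) x y z f₁ f₂ ⟩
  ((1ℤ ℤ.+ + p ℤ.- + q) ℤ.* x ℤ.+ (+ p ℤ.- (1ℤ ℤ.+ + q)) ℤ.* y) ℤ.+ (f₁ ℤ.+ f₂) ℤ.+ (+ a) ℤ.* z ℤ.+ (z ℤ.- (x ℤ.- y))
    ≡⟨ cong₂ (λ u w → ((1ℤ ℤ.+ + p ℤ.- + q) ℤ.* x ℤ.+ (+ p ℤ.- (1ℤ ℤ.+ + q)) ℤ.* y) ℤ.+ (f₁ ℤ.+ f₂) ℤ.+ u ℤ.+ w)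
        (trans (sym (pred·-suc a (λ a′ → g r a′ (suc c) p q)))
          (pred·-+ a (λ a′ → g r a′ (suc c) (suc p) q) (λ a′ → g r a′ (suc c) p (suc q))))
        (trans (cong (ℤ._- (x ℤ.- y)) (g-sucʳ r a c p q)) (ℤₚ.+-inverseʳ (x ℤ.- y))) ⟩
  ((1ℤ ℤ.+ + p ℤ.- + q) ℤ.* x ℤ.+ (+ p ℤ.- (1ℤ ℤ.+ + q)) ℤ.* y) ℤ.+ (f₁ ℤ.+ f₂) ℤ.+ (h₁ ℤ.+ h₂) ℤ.+ 0ℤ
    ≡⟨ shuffle′ ((1ℤ ℤ.+ + p ℤ.- + q) ℤ.* x) ((+ p ℤ.- (1ℤ ℤ.+ + q)) ℤ.* y) f₁ f₂ h₁ h₂ ⟩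
  ((1ℤ ℤ.+ + p ℤ.- + q) ℤ.* x ℤ.+ (h₁ ℤ.+ f₁)) ℤ.+ ((+ p ℤ.- (1ℤ ℤ.+ + q)) ℤ.* y ℤ.+ (h₂ ℤ.+ f₂))
    ≡⟨ cong₂ ℤ._+_ (g-euler r a c (suc p) q) (g-euler r a c p (suc q)) ⟩
  0ℤ ∎
  where
  open ≡-Reasoning
  x = g r a c (suc p) q
  y = g r a c p (suc q)
  z = g r a (suc c) p q
  f₁ = pred· c (λ c′ → g r (suc a) c′ (suc p) q)
  f₂ = pred· c (λ c′ → g r (suc a) c′ p (suc q))
  h₁ = pred· a (λ a′ → g r a′ (suc c) (suc p) q)
  h₂ = pred· a (λ a′ → g r a′ (suc c) p (suc q))
  shuffle : ∀ p q a x y z f₁ f₂ → (p ℤ.- q) ℤ.* (x ℤ.+ y) ℤ.+ ((1ℤ ℤ.+ a) ℤ.* z ℤ.+ (f₁ ℤ.+ f₂))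
    ≡ ((1ℤ ℤ.+ p ℤ.- q) ℤ.* x ℤ.+ (p ℤ.- (1ℤ ℤ.+ q)) ℤ.* y) ℤ.+ (f₁ ℤ.+ f₂) ℤ.+ a ℤ.* z ℤ.+ (z ℤ.- (x ℤ.- y))
  shuffle = solve-∀
  shuffle′ : ∀ x y f₁ f₂ h₁ h₂ → (x ℤ.+ y) ℤ.+ (f₁ ℤ.+ f₂) ℤ.+ (h₁ ℤ.+ h₂) ℤ.+ 0ℤ
    ≡ (x ℤ.+ (h₁ ℤ.+ f₁)) ℤ.+ (y ℤ.+ (h₂ ℤ.+ f₂))
  shuffle′ = solve-∀

-- The exponent a stays free instead of being fixed to 2r - c; by `g-vanish` the value is 0 unless a
-- + c = 2r.
κ : ℕ → ℕ → ℕ → ℤ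
κ r a c = g r a c 0 0

-- The monomial xʳyʳ has weight 0 under x∂ₓ - y∂ᵧ, so only the Leibniz terms remain.
κ-euler : ∀ r a c → pred· a (λ a′ → κ r a′ (suc c)) ℤ.+ pred· c (λ c′ → κ r (suc a) c′) ≡ 0ℤ
κ-euler r a c = trans (sym (ℤₚ.+-identityˡ _)) (g-euler r a c 0 0)

κ-1 : ∀ r a → κ r a 1 ≡ 0ℤ
κ-1 r a = ℤₚ.*-cancelˡ-≡ (1ℤ ℤ.+ + a) (κ r a 1) 0ℤ
  (trans (trans (sym (ℤₚ.+-identityʳ _)) (κ-euler r (suc a) 0)) (sym (ℤₚ.*-zeroʳ (1ℤ ℤ.+ + a))))

κ-2+ : ∀ r a c → (1ℤ ℤ.+ + a) ℤ.* κ r a (suc (suc c)) ≡ ℤ.- ((1ℤ ℤ.+ + c) ℤ.* κ r (suc (suc a)) c)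
κ-2+ r a c = inverse (κ-euler r (suc a) (suc c))
  where
  inverse : ∀ {x y} → x ℤ.+ y ≡ 0ℤ → x ≡ ℤ.- y
  inverse {x} {y} eq = trans (add-sub x y) (trans (cong (ℤ._+ ℤ.- y) eq) (ℤₚ.+-identityˡ _))
    where
    add-sub : ∀ x y → x ≡ (x ℤ.+ y) ℤ.+ ℤ.- y
    add-sub = solve-∀

κ-odd : ∀ r a j → κ r a (suc (double j)) ≡ 0ℤ
κ-odd r a zero    = κ-1 r a
κ-odd r a (suc j) = ℤₚ.*-cancelˡ-≡ (1ℤ ℤ.+ + a) (κ r a (suc (double (suc j)))) 0ℤ (begin
  (1ℤ ℤ.+ + a) ℤ.* κ r a (suc (double (suc j)))
    ≡⟨ κ-2+ r a (suc (double j)) ⟩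
  ℤ.- ((1ℤ ℤ.+ + suc (double j)) ℤ.* κ r (suc (suc a)) (suc (double j)))
    ≡⟨ cong (λ x → ℤ.- ((1ℤ ℤ.+ + suc (double j)) ℤ.* x)) (κ-odd r (suc (suc a)) j) ⟩
  ℤ.- ((1ℤ ℤ.+ + suc (double j)) ℤ.* 0ℤ)
    ≡⟨ cong ℤ.-_ (ℤₚ.*-zeroʳ (1ℤ ℤ.+ + suc (double j))) ⟩
  0ℤ
    ≡⟨ sym (ℤₚ.*-zeroʳ (1ℤ ℤ.+ + a)) ⟩
  (1ℤ ℤ.+ + a) ℤ.* 0ℤ ∎)
  where open ≡-Reasoning

δ-nonneg : ∀ p r → 0ℤ ℤ.≤ δ p r
δ-nonneg p r with p ≡ᵇ r
... | true  = ℤ.+≤+ ℕ.z≤n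
... | false = ℤ.+≤+ ℕ.z≤n

g-nonneg : ∀ r a p q → 0ℤ ℤ.≤ g r a 0 p q
g-nonneg r zero    p q = 0≤* (δ-nonneg p r) (δ-nonneg q r)
g-nonneg r (suc a) p q = ℤₚ.+-mono-≤ (g-nonneg r a (suc p) q) (g-nonneg r a p (suc q))

κ-sign : ∀ r a j → 0ℤ ℤ.≤ sgn j ℤ.* κ r a (double j)
κ-sign r a zero    = 0≤* {1ℤ} (ℤ.+≤+ ℕ.z≤n) (g-nonneg r a 0 0)
κ-sign r a (suc j) = ℤₚ.*-cancelˡ-≤-pos 0ℤ _ (1ℤ ℤ.+ + a) (begin
  (1ℤ ℤ.+ + a) ℤ.* 0ℤ
    ≡⟨ ℤₚ.*-zeroʳ (1ℤ ℤ.+ + a) ⟩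
  0ℤ
    ≤⟨ 0≤* {1ℤ ℤ.+ + double j} (ℤ.+≤+ ℕ.z≤n) (κ-sign r (suc (suc a)) j) ⟩
  (1ℤ ℤ.+ + double j) ℤ.* (sgn j ℤ.* κ r (suc (suc a)) (double j))
    ≡⟨ shuffle (1ℤ ℤ.+ + double j) (sgn j) _ ⟩
  (ℤ.- sgn j) ℤ.* (ℤ.- ((1ℤ ℤ.+ + double j) ℤ.* κ r (suc (suc a)) (double j)))
    ≡⟨ cong (ℤ._*_ (ℤ.- sgn j)) (sym (κ-2+ r a (double j))) ⟩
  (ℤ.- sgn j) ℤ.* ((1ℤ ℤ.+ + a) ℤ.* κ r a (double (suc j)))
    ≡⟨ shuffle′ (ℤ.- sgn j) (1ℤ ℤ.+ + a) _ ⟩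
  (1ℤ ℤ.+ + a) ℤ.* (sgn (suc j) ℤ.* κ r a (double (suc j))) ∎)
  where
  open ℤₚ.≤-Reasoning
  shuffle : ∀ x y z → x ℤ.* (y ℤ.* z) ≡ (ℤ.- y) ℤ.* (ℤ.- (x ℤ.* z))
  shuffle = solve-∀
  shuffle′ : ∀ x y z → x ℤ.* (y ℤ.* z) ≡ y ℤ.* (x ℤ.* z)
  shuffle′ = solve-∀

-- Homogeneity: the product has degree a + c, the extracted monomial degree 2r - p - q.
g-vanish : ∀ r a c p q → a ℕ.+ (c ℕ.+ (p ℕ.+ q)) ≢ double r → g r a c p q ≡ 0ℤ
g-vanish r zero zero p q off = δδ-off p q r r (λ { (refl , refl) → off (sym (double≡ p)) })
g-vanish r zero (suc c) p q off = cong₂ ℤ._-_ (g-vanish r zero c (suc p) q (off ∘ trans (sym (ℕₚ.+-suc c (p ℕ.+ q)))))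
  (g-vanish r zero c p (suc q) (off ∘ trans (trans (sym (ℕₚ.+-suc c (p ℕ.+ q))) (cong (c ℕ.+_) (sym (ℕₚ.+-suc p q))))))
g-vanish r (suc a) c p q off = cong₂ ℤ._+_
  (g-vanish r a c (suc p) q (off ∘ trans shift))
  (g-vanish r a c p (suc q) (off ∘ trans (trans shift (cong (λ x → a ℕ.+ (c ℕ.+ x)) (sym (ℕₚ.+-suc p q))))))
  where
  shift : suc (a ℕ.+ (c ℕ.+ (p ℕ.+ q))) ≡ a ℕ.+ (c ℕ.+ suc (p ℕ.+ q))
  shift = sym (trans (cong (a ℕ.+_) (ℕₚ.+-suc c (p ℕ.+ q))) (ℕₚ.+-suc a _))

-- Replacing y by -y turns x - y into x + y and multiplies the coefficient of a monomial with
-- y^{r-q} by (-1)^{r-q}.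
g-flip : ∀ r c p q → g r 0 c p q ≡ (sgn q ℤ.* sgn r) ℤ.* g r c 0 p q
g-flip r zero p q with q ℕ.≟ r
... | yes refl = sym (trans (cong (ℤ._* (δ p r ℤ.* δ q r)) (sgn² q)) (ℤₚ.*-identityˡ _))
... | no q≢r = trans zero-δ (sym (trans (cong (ℤ._*_ (sgn q ℤ.* sgn r)) zero-δ) (ℤₚ.*-zeroʳ (sgn q ℤ.* sgn r))))
  where
  zero-δ : δ p r ℤ.* δ q r ≡ 0ℤ
  zero-δ = δδ-off p q r r (q≢r ∘ proj₂)
g-flip r (suc c) p q = trans (cong₂ ℤ._-_ (g-flip r c (suc p) q) (g-flip r c p (suc q)))
  (shuffle (sgn q) (sgn r) _ _)
  where
  shuffle : ∀ x y z w → (x ℤ.* y) ℤ.* z ℤ.- ((ℤ.- x) ℤ.* y) ℤ.* w ≡ (x ℤ.* y) ℤ.* (z ℤ.+ w)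
  shuffle = solve-∀

g-abs : ∀ r c p q → g r 0 c p q ≼ g r c 0 p q
g-abs r zero    p q = ≼-refl (g-nonneg r 0 p q)
g-abs r (suc c) p q = ≼-minus (g-abs r c (suc p) q) (g-abs r c p (suc q))

-- The unsigned sum `U` and its recurrence

-- The coefficient extracted from (A + B)^α (C + D)^μ A^a B^b C^c D^d.
U : (r s α μ a b c d : ℕ) → ℤ
U r s zero    zero    a b c d = Q r s a b c d
U r s zero    (suc μ) a b c d = U r s zero μ a b (suc c) d ℤ.+ U r s zero μ a b c (suc d)
U r s (suc α) μ       a b c d = U r s α μ (suc a) b c d ℤ.+ U r s α μ a (suc b) c d

exchange : ∀ w x y z → (w ℤ.+ x) ℤ.+ (y ℤ.+ z) ≡ (w ℤ.+ y) ℤ.+ (x ℤ.+ z)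
exchange = solve-∀

U-sucʳ : ∀ r s α μ a b c d → U r s α (suc μ) a b c d ≡ U r s α μ a b (suc c) d ℤ.+ U r s α μ a b c (suc d)
U-sucʳ r s zero    μ a b c d = refl
U-sucʳ r s (suc α) μ a b c d = trans (cong₂ ℤ._+_ (U-sucʳ r s α μ (suc a) b c d) (U-sucʳ r s α μ a (suc b) c d))
  (exchange (U r s α μ (suc a) b (suc c) d) (U r s α μ (suc a) b c (suc d))
            (U r s α μ a (suc b) (suc c) d) (U r s α μ a (suc b) c (suc d)))

Q-euler : ∀ r s a b c d →
  (pred· a (λ a′ → Q r s a′ b (suc c) d) ℤ.+ pred· c (λ c′ → Q r s (suc a) b c′ d)) ℤ.+
  (pred· b (λ b′ → Q r s a b′ c (suc d)) ℤ.+ pred· d (λ d′ → Q r s a (suc b) c d′)) ≡ 0ℤ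
Q-euler r s a b c d = cong₂ ℤ._+_
  (trans (cong₂ ℤ._+_ (pred·-*ʳ a (λ a′ → κ r a′ (suc c)) (κ s b d)) (pred·-*ʳ c (κ r (suc a)) (κ s b d)))
    (trans (sym (ℤₚ.*-distribʳ-+ (κ s b d) (pred· a (λ a′ → κ r a′ (suc c))) (pred· c (κ r (suc a)))))
      (trans (cong (ℤ._* κ s b d) (κ-euler r a c)) (ℤₚ.*-zeroˡ (κ s b d)))))
  (trans (cong₂ ℤ._+_ (pred·-*ˡ b (λ b′ → κ s b′ (suc d)) (κ r a c)) (pred·-*ˡ d (κ s (suc b)) (κ r a c)))
    (trans (sym (ℤₚ.*-distribˡ-+ (κ r a c) (pred· b (λ b′ → κ s b′ (suc d))) (pred· d (κ s (suc b)))))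
      (trans (cong (ℤ._*_ (κ r a c)) (κ-euler s b d)) (ℤₚ.*-zeroʳ (κ r a c)))))

-- The derivation A ↦ C, C ↦ A, B ↦ D, D ↦ B maps A + B to C + D and back.
U-derivation : (r s α μ a b c d : ℕ) → ℤ
U-derivation r s α μ a b c d =
  (pred· α (λ α′ → U r s α′ (suc μ) a b c d) ℤ.+ pred· μ (λ μ′ → U r s (suc α) μ′ a b c d)) ℤ.+
  ((pred· a (λ a′ → U r s α μ a′ b (suc c) d) ℤ.+ pred· c (λ c′ → U r s α μ (suc a) b c′ d)) ℤ.+
   (pred· b (λ b′ → U r s α μ a b′ c (suc d)) ℤ.+ pred· d (λ d′ → U r s α μ a (suc b) c d′)))

-- The derivation is the Euler operator in both pairs of variables at once, and the extracted
-- monomial has weight 0 in each pair; this is the base case. A factor A + B or C + D splits the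
-- identity into two smaller instances, and the Leibniz term that hits this factor is redistributed
-- between them.
U-euler : ∀ r s α μ a b c d → U-derivation r s α μ a b c d ≡ 0ℤ
U-euler r s zero zero a b c d = trans (ℤₚ.+-identityˡ _) (Q-euler r s a b c d)
U-euler r s zero (suc μ) a b c d = begin
  U-derivation r s zero (suc μ) a b c d
    ≡⟨ cong₂ ℤ._+_ (cong (ℤ._+_ 0ℤ) (cong (ℤ._*_ (1ℤ ℤ.+ + μ)) (refl {x = x ℤ.+ y})))
        (cong₂ ℤ._+_
          (cong₂ ℤ._+_
            (pred·-+ a (λ a′ → U r s 0 μ a′ b (suc (suc c)) d) (λ a′ → U r s 0 μ a′ b (suc c) (suc d)))
            (trans (pred·-+ c (λ c′ → U r s 0 μ (suc a) b (suc c′) d) (λ c′ → U r s 0 μ (suc a) b c′ (suc d)))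
              (cong (ℤ._+ c₂) (pred·-suc c (λ c′ → U r s 0 μ (suc a) b c′ d)))))
          (cong₂ ℤ._+_
            (pred·-+ b (λ b′ → U r s 0 μ a b′ (suc c) (suc d)) (λ b′ → U r s 0 μ a b′ c (suc (suc d))))
            (trans (pred·-+ d (λ d′ → U r s 0 μ a (suc b) (suc c) d′) (λ d′ → U r s 0 μ a (suc b) c (suc d′)))
              (cong (ℤ._+_ d₁) (pred·-suc d (λ d′ → U r s 0 μ a (suc b) c d′)))))) ⟩
  (0ℤ ℤ.+ (1ℤ ℤ.+ + μ) ℤ.* (x ℤ.+ y)) ℤ.+
  (((a₁ ℤ.+ a₂) ℤ.+ ((+ c) ℤ.* x ℤ.+ c₂)) ℤ.+ ((b₁ ℤ.+ b₂) ℤ.+ (d₁ ℤ.+ (+ d) ℤ.* y)))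
    ≡⟨ shuffle (+ μ) (+ c) (+ d) x y a₁ a₂ b₁ b₂ c₂ d₁ ⟩
  ((+ μ) ℤ.* (x ℤ.+ y)) ℤ.+
  (((a₁ ℤ.+ (1ℤ ℤ.+ + c) ℤ.* x) ℤ.+ (b₁ ℤ.+ d₁)) ℤ.+ ((a₂ ℤ.+ c₂) ℤ.+ (b₂ ℤ.+ (1ℤ ℤ.+ + d) ℤ.* y)))
    ≡⟨ cong (ℤ._+ (((a₁ ℤ.+ (1ℤ ℤ.+ + c) ℤ.* x) ℤ.+ (b₁ ℤ.+ d₁)) ℤ.+ ((a₂ ℤ.+ c₂) ℤ.+ (b₂ ℤ.+ (1ℤ ℤ.+ + d) ℤ.* y))))
        (trans (sym (pred·-suc μ (λ μ′ → U r s 1 μ′ a b c d)))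
          (trans (pred·-cong μ (λ μ′ → U-sucʳ r s 1 μ′ a b c d))
            (pred·-+ μ (λ μ′ → U r s 1 μ′ a b (suc c) d) (λ μ′ → U r s 1 μ′ a b c (suc d))))) ⟩
  (m₁ ℤ.+ m₂) ℤ.+
  (((a₁ ℤ.+ (1ℤ ℤ.+ + c) ℤ.* x) ℤ.+ (b₁ ℤ.+ d₁)) ℤ.+ ((a₂ ℤ.+ c₂) ℤ.+ (b₂ ℤ.+ (1ℤ ℤ.+ + d) ℤ.* y)))
    ≡⟨ shuffle′ m₁ m₂ ((a₁ ℤ.+ (1ℤ ℤ.+ + c) ℤ.* x) ℤ.+ (b₁ ℤ.+ d₁)) ((a₂ ℤ.+ c₂) ℤ.+ (b₂ ℤ.+ (1ℤ ℤ.+ + d) ℤ.* y)) ⟩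
  ((0ℤ ℤ.+ m₁) ℤ.+ ((a₁ ℤ.+ (1ℤ ℤ.+ + c) ℤ.* x) ℤ.+ (b₁ ℤ.+ d₁))) ℤ.+
  ((0ℤ ℤ.+ m₂) ℤ.+ ((a₂ ℤ.+ c₂) ℤ.+ (b₂ ℤ.+ (1ℤ ℤ.+ + d) ℤ.* y)))
    ≡⟨ cong₂ ℤ._+_ (U-euler r s zero μ a b (suc c) d) (U-euler r s zero μ a b c (suc d)) ⟩
  0ℤ ∎
  where
  open ≡-Reasoning
  x = U r s 0 μ (suc a) b c d
  y = U r s 0 μ a (suc b) c d
  a₁ = pred· a (λ a′ → U r s 0 μ a′ b (suc (suc c)) d)
  a₂ = pred· a (λ a′ → U r s 0 μ a′ b (suc c) (suc d))
  b₁ = pred· b (λ b′ → U r s 0 μ a b′ (suc c) (suc d))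
  b₂ = pred· b (λ b′ → U r s 0 μ a b′ c (suc (suc d)))
  c₂ = pred· c (λ c′ → U r s 0 μ (suc a) b c′ (suc d))
  d₁ = pred· d (λ d′ → U r s 0 μ a (suc b) (suc c) d′)
  m₁ = pred· μ (λ μ′ → U r s 1 μ′ a b (suc c) d)
  m₂ = pred· μ (λ μ′ → U r s 1 μ′ a b c (suc d))
  shuffle : ∀ μ c d x y a₁ a₂ b₁ b₂ c₂ d₁ →
    (0ℤ ℤ.+ (1ℤ ℤ.+ μ) ℤ.* (x ℤ.+ y)) ℤ.+ (((a₁ ℤ.+ a₂) ℤ.+ (c ℤ.* x ℤ.+ c₂)) ℤ.+ ((b₁ ℤ.+ b₂) ℤ.+ (d₁ ℤ.+ d ℤ.* y)))
    ≡ (μ ℤ.* (x ℤ.+ y)) ℤ.+ (((a₁ ℤ.+ (1ℤ ℤ.+ c) ℤ.* x) ℤ.+ (b₁ ℤ.+ d₁)) ℤ.+ ((a₂ ℤ.+ c₂) ℤ.+ (b₂ ℤ.+ (1ℤ ℤ.+ d) ℤ.* y)))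
  shuffle = solve-∀
  shuffle′ : ∀ x y z w → (x ℤ.+ y) ℤ.+ (z ℤ.+ w) ≡ ((0ℤ ℤ.+ x) ℤ.+ z) ℤ.+ ((0ℤ ℤ.+ y) ℤ.+ w)
  shuffle′ = solve-∀
U-euler r s (suc α) μ a b c d = begin
  U-derivation r s (suc α) μ a b c d
    ≡⟨ cong₂ ℤ._+_ (cong₂ ℤ._+_ (cong (ℤ._*_ (1ℤ ℤ.+ + α)) (U-sucʳ r s α μ a b c d))
          (pred·-+ μ (λ μ′ → U r s (suc α) μ′ (suc a) b c d) (λ μ′ → U r s (suc α) μ′ a (suc b) c d)))
        (cong₂ ℤ._+_
          (cong₂ ℤ._+_
            (trans (pred·-+ a (λ a′ → U r s α μ (suc a′) b (suc c) d) (λ a′ → U r s α μ a′ (suc b) (suc c) d))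
              (cong (ℤ._+ a₂) (pred·-suc a (λ a′ → U r s α μ a′ b (suc c) d))))
            (pred·-+ c (λ c′ → U r s α μ (suc (suc a)) b c′ d) (λ c′ → U r s α μ (suc a) (suc b) c′ d)))
          (cong₂ ℤ._+_
            (trans (pred·-+ b (λ b′ → U r s α μ (suc a) b′ c (suc d)) (λ b′ → U r s α μ a (suc b′) c (suc d)))
              (cong (ℤ._+_ b₁) (pred·-suc b (λ b′ → U r s α μ a b′ c (suc d)))))
            (pred·-+ d (λ d′ → U r s α μ (suc a) (suc b) c d′) (λ d′ → U r s α μ a (suc (suc b)) c d′)))) ⟩
  ((1ℤ ℤ.+ + α) ℤ.* (x ℤ.+ y) ℤ.+ (m₁ ℤ.+ m₂)) ℤ.+
  ((((+ a) ℤ.* x ℤ.+ a₂) ℤ.+ (c₁ ℤ.+ c₂)) ℤ.+ ((b₁ ℤ.+ (+ b) ℤ.* y) ℤ.+ (d₁ ℤ.+ d₂)))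
    ≡⟨ shuffle (+ α) (+ a) (+ b) x y a₂ b₁ c₁ c₂ d₁ d₂ (m₁ ℤ.+ m₂) ⟩
  ((+ α) ℤ.* (x ℤ.+ y) ℤ.+ (m₁ ℤ.+ m₂)) ℤ.+
  ((((1ℤ ℤ.+ + a) ℤ.* x ℤ.+ c₁) ℤ.+ (b₁ ℤ.+ d₁)) ℤ.+ ((a₂ ℤ.+ c₂) ℤ.+ ((1ℤ ℤ.+ + b) ℤ.* y ℤ.+ d₂)))
    ≡⟨ cong (λ u → (u ℤ.+ (m₁ ℤ.+ m₂)) ℤ.+
          ((((1ℤ ℤ.+ + a) ℤ.* x ℤ.+ c₁) ℤ.+ (b₁ ℤ.+ d₁)) ℤ.+ ((a₂ ℤ.+ c₂) ℤ.+ ((1ℤ ℤ.+ + b) ℤ.* y ℤ.+ d₂))))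
        (trans (cong (ℤ._*_ (+ α)) (sym (U-sucʳ r s α μ a b c d)))
          (trans (sym (pred·-suc α (λ α′ → U r s α′ (suc μ) a b c d)))
            (pred·-+ α (λ α′ → U r s α′ (suc μ) (suc a) b c d) (λ α′ → U r s α′ (suc μ) a (suc b) c d)))) ⟩
  ((l₁ ℤ.+ l₂) ℤ.+ (m₁ ℤ.+ m₂)) ℤ.+
  ((((1ℤ ℤ.+ + a) ℤ.* x ℤ.+ c₁) ℤ.+ (b₁ ℤ.+ d₁)) ℤ.+ ((a₂ ℤ.+ c₂) ℤ.+ ((1ℤ ℤ.+ + b) ℤ.* y ℤ.+ d₂)))
    ≡⟨ cong (ℤ._+ ((((1ℤ ℤ.+ + a) ℤ.* x ℤ.+ c₁) ℤ.+ (b₁ ℤ.+ d₁)) ℤ.+ ((a₂ ℤ.+ c₂) ℤ.+ ((1ℤ ℤ.+ + b) ℤ.* y ℤ.+ d₂))))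
        (exchange l₁ l₂ m₁ m₂) ⟩
  ((l₁ ℤ.+ m₁) ℤ.+ (l₂ ℤ.+ m₂)) ℤ.+
  ((((1ℤ ℤ.+ + a) ℤ.* x ℤ.+ c₁) ℤ.+ (b₁ ℤ.+ d₁)) ℤ.+ ((a₂ ℤ.+ c₂) ℤ.+ ((1ℤ ℤ.+ + b) ℤ.* y ℤ.+ d₂)))
    ≡⟨ exchange (l₁ ℤ.+ m₁) (l₂ ℤ.+ m₂) (((1ℤ ℤ.+ + a) ℤ.* x ℤ.+ c₁) ℤ.+ (b₁ ℤ.+ d₁)) ((a₂ ℤ.+ c₂) ℤ.+ ((1ℤ ℤ.+ + b) ℤ.* y ℤ.+ d₂)) ⟩
  ((l₁ ℤ.+ m₁) ℤ.+ (((1ℤ ℤ.+ + a) ℤ.* x ℤ.+ c₁) ℤ.+ (b₁ ℤ.+ d₁))) ℤ.+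
  ((l₂ ℤ.+ m₂) ℤ.+ ((a₂ ℤ.+ c₂) ℤ.+ ((1ℤ ℤ.+ + b) ℤ.* y ℤ.+ d₂)))
    ≡⟨ cong₂ ℤ._+_ (U-euler r s α μ (suc a) b c d) (U-euler r s α μ a (suc b) c d) ⟩
  0ℤ ∎
  where
  open ≡-Reasoning
  x = U r s α μ a b (suc c) d
  y = U r s α μ a b c (suc d)
  a₂ = pred· a (λ a′ → U r s α μ a′ (suc b) (suc c) d)
  b₁ = pred· b (λ b′ → U r s α μ (suc a) b′ c (suc d))
  c₁ = pred· c (λ c′ → U r s α μ (suc (suc a)) b c′ d)
  c₂ = pred· c (λ c′ → U r s α μ (suc a) (suc b) c′ d)
  d₁ = pred· d (λ d′ → U r s α μ (suc a) (suc b) c d′)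
  d₂ = pred· d (λ d′ → U r s α μ a (suc (suc b)) c d′)
  l₁ = pred· α (λ α′ → U r s α′ (suc μ) (suc a) b c d)
  l₂ = pred· α (λ α′ → U r s α′ (suc μ) a (suc b) c d)
  m₁ = pred· μ (λ μ′ → U r s (suc α) μ′ (suc a) b c d)
  m₂ = pred· μ (λ μ′ → U r s (suc α) μ′ a (suc b) c d)
  shuffle : ∀ α a b x y a₂ b₁ c₁ c₂ d₁ d₂ m →
    ((1ℤ ℤ.+ α) ℤ.* (x ℤ.+ y) ℤ.+ m) ℤ.+ (((a ℤ.* x ℤ.+ a₂) ℤ.+ (c₁ ℤ.+ c₂)) ℤ.+ ((b₁ ℤ.+ b ℤ.* y) ℤ.+ (d₁ ℤ.+ d₂)))
    ≡ (α ℤ.* (x ℤ.+ y) ℤ.+ m) ℤ.+ ((((1ℤ ℤ.+ a) ℤ.* x ℤ.+ c₁) ℤ.+ (b₁ ℤ.+ d₁)) ℤ.+ ((a₂ ℤ.+ c₂) ℤ.+ ((1ℤ ℤ.+ b) ℤ.* y ℤ.+ d₂)))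
  shuffle = solve-∀

-- With no separate factors A, B, C, D only the two Leibniz terms of the sums A + B and C + D
-- survive. For n = α + μ + 2 and m = μ the factor 1 + α is n - m - 1.
U-2+ : ∀ r s α μ → (1ℤ ℤ.+ + α) ℤ.* U r s α (suc (suc μ)) 0 0 0 0
  ≡ ℤ.- ((1ℤ ℤ.+ + μ) ℤ.* U r s (suc (suc α)) μ 0 0 0 0)
U-2+ r s α μ = inverse ((1ℤ ℤ.+ + α) ℤ.* U r s α (suc (suc μ)) 0 0 0 0) ((1ℤ ℤ.+ + μ) ℤ.* U r s (suc (suc α)) μ 0 0 0 0)
  (trans (sym (ℤₚ.+-identityʳ _)) (U-euler r s (suc α) (suc μ) 0 0 0 0))
  where
  add-sub : ∀ x y → x ≡ (x ℤ.+ y) ℤ.+ ℤ.- y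
  add-sub = solve-∀
  inverse : ∀ x y → x ℤ.+ y ≡ 0ℤ → x ≡ ℤ.- y
  inverse x y eq = trans (add-sub x y) (trans (cong (ℤ._+ ℤ.- y) eq) (ℤₚ.+-identityˡ _))

-- Comparing the eigenvalue with the unsigned sum

evens odds : ∀ {n} → Vec ℤ₄ n → ℕ
evens []      = 0
evens (𝟘 ∷ v) = suc (evens v)
evens (𝟙 ∷ v) = evens v
evens (𝟚 ∷ v) = suc (evens v)
evens (𝟛 ∷ v) = evens v
odds []      = 0
odds (𝟘 ∷ v) = odds v
odds (𝟙 ∷ v) = suc (odds v)
odds (𝟚 ∷ v) = odds v
odds (𝟛 ∷ v) = suc (odds v)

evens+odds : ∀ {n} (v : Vec ℤ₄ n) → evens v ℕ.+ odds v ≡ n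
evens+odds []      = refl
evens+odds (𝟘 ∷ v) = cong suc (evens+odds v)
evens+odds (𝟙 ∷ v) = trans (ℕₚ.+-suc (evens v) (odds v)) (cong suc (evens+odds v))
evens+odds (𝟚 ∷ v) = cong suc (evens+odds v)
evens+odds (𝟛 ∷ v) = trans (ℕₚ.+-suc (evens v) (odds v)) (cong suc (evens+odds v))

Q-zeroˡ : ∀ r s a b c d → κ r a c ≡ 0ℤ → Q r s a b c d ≡ 0ℤ
Q-zeroˡ r s a b c d eq = trans (cong (ℤ._* κ s b d) eq) (ℤₚ.*-zeroˡ (κ s b d))

Q-zeroʳ : ∀ r s a b c d → κ s b d ≡ 0ℤ → Q r s a b c d ≡ 0ℤ
Q-zeroʳ r s a b c d eq = trans (cong (ℤ._*_ (κ r a c)) eq) (ℤₚ.*-zeroʳ (κ r a c))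

Q-odd : ∀ r s a b c d m → c ℕ.+ d ≡ suc (double m) → Q r s a b c d ≡ 0ℤ
Q-odd r s a b c d m eq with parity c | parity d
... | inj₂ (i , refl) | _               = Q-zeroˡ r s a b c d (κ-odd r a i)
... | inj₁ _          | inj₂ (j , refl) = Q-zeroʳ r s a b c d (κ-odd s b j)
... | inj₁ (i , refl) | inj₁ (j , refl) = ⊥-elim (odd≢even m (i ℕ.+ j) (trans (sym eq) (sym (double-+ i j))))

-- For c = 2i and d = 2j the two coefficients have the signs (-1)^i and (-1)^j by `κ-sign`, so the
-- right side is the absolute value of `Q`. Its sign depends on c + d only, not on how the odd
-- coordinates are distributed.
ρ-Q : ∀ r s a b c d m → c ℕ.+ d ≡ double m → ρ d ℤ.* Q r s a b c d ≼ sgn m ℤ.* Q r s a b c d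
ρ-Q r s a b c d m eq with parity c | parity d
... | _ | inj₂ (j , refl) = subst (λ x → ρ d ℤ.* x ≼ sgn m ℤ.* x) (sym (Q-zeroʳ r s a b c d (κ-odd s b j)))
        (subst₂ _≼_ (sym (ℤₚ.*-zeroʳ (ρ d))) (sym (ℤₚ.*-zeroʳ (sgn m))) (≼-refl {0ℤ} ℤₚ.≤-refl))
... | inj₂ (i , refl) | inj₁ (j , refl) = ⊥-elim (odd≢even (i ℕ.+ j) m (trans (cong suc (double-+ i j)) eq))
... | inj₁ (i , refl) | inj₁ (j , refl) = subst₂ _≼_ left right
        (≼-sgn i (≼-refl {(sgn i ℤ.* κ r a c) ℤ.* (sgn j ℤ.* κ s b d)} (0≤* (κ-sign r a i) (κ-sign s b j))))
  where
  assoc : ∀ x y z w → x ℤ.* ((x ℤ.* y) ℤ.* (z ℤ.* w)) ≡ (x ℤ.* x) ℤ.* (z ℤ.* (y ℤ.* w))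
  assoc = solve-∀
  left : sgn i ℤ.* ((sgn i ℤ.* κ r a c) ℤ.* (sgn j ℤ.* κ s b d)) ≡ ρ d ℤ.* Q r s a b c d
  left = trans (assoc (sgn i) (κ r a c) (sgn j) (κ s b d))
    (trans (cong (ℤ._* (sgn j ℤ.* Q r s a b c d)) (sgn² i))
      (trans (ℤₚ.*-identityˡ _) (cong (ℤ._* Q r s a b c d) (sym (ρ-double j)))))
  pair : ∀ x y z w → (x ℤ.* y) ℤ.* (z ℤ.* w) ≡ (x ℤ.* z) ℤ.* (y ℤ.* w)
  pair = solve-∀
  right : (sgn i ℤ.* κ r a c) ℤ.* (sgn j ℤ.* κ s b d) ≡ sgn m ℤ.* Q r s a b c d
  right = trans (pair (sgn i) (κ r a c) (sgn j) (κ s b d))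
    (cong (ℤ._* Q r s a b c d) (trans (sym (sgn-+ i j))
      (cong sgn (double-injective (i ℕ.+ j) m (trans (double-+ i j) eq)))))

T-odd : ∀ r s {n} (v : Vec ℤ₄ n) a b c d m → odds v ℕ.+ (c ℕ.+ d) ≡ suc (double m) → T r s v a b c d ≡ 0ℤ
T-odd r s [] a b c d m eq = trans (cong (ℤ._*_ (ρ d)) (Q-odd r s a b c d m eq)) (ℤₚ.*-zeroʳ (ρ d))
T-odd r s (𝟘 ∷ v) a b c d m eq = cong₂ ℤ._+_ (T-odd r s v (suc a) b c d m eq) (T-odd r s v a (suc b) c d m eq)
T-odd r s (𝟙 ∷ v) a b c d m eq = cong₂ ℤ._+_
  (T-odd r s v a b (suc c) d m (trans (ℕₚ.+-suc (odds v) (c ℕ.+ d)) eq))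
  (T-odd r s v a b c (suc d) m (trans (cong (odds v ℕ.+_) (ℕₚ.+-suc c d)) (trans (ℕₚ.+-suc (odds v) (c ℕ.+ d)) eq)))
T-odd r s (𝟚 ∷ v) a b c d m eq = cong₂ ℤ._-_ (T-odd r s v (suc a) b c d m eq) (T-odd r s v a (suc b) c d m eq)
T-odd r s (𝟛 ∷ v) a b c d m eq = cong₂ ℤ._-_
  (T-odd r s v a b (suc c) d m (trans (ℕₚ.+-suc (odds v) (c ℕ.+ d)) eq))
  (T-odd r s v a b c (suc d) m (trans (cong (odds v ℕ.+_) (ℕₚ.+-suc c d)) (trans (ℕₚ.+-suc (odds v) (c ℕ.+ d)) eq)))

-- The sum of `odds v` and c + d is constant along the recursion, so one sign `sgn m` serves all
-- leaves. The triangle inequality then adds up bounds that do not cancel.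
T-bound : ∀ r s {n} (v : Vec ℤ₄ n) a b c d m → odds v ℕ.+ (c ℕ.+ d) ≡ double m →
  T r s v a b c d ≼ sgn m ℤ.* U r s (evens v) (odds v) a b c d
T-bound r s v₀ a b c d m eq = go v₀ a b c d eq
  where
  V : ∀ {n} (v : Vec ℤ₄ n) (a b c d : ℕ) → ℤ
  V v a b c d = U r s (evens v) (odds v) a b c d
  collect : ∀ {x y z w} → x ≼ sgn m ℤ.* y ℤ.+ sgn m ℤ.* z → w ≡ y ℤ.+ z → x ≼ sgn m ℤ.* w
  collect {x} {y} {z} p refl = subst (x ≼_) (sym (ℤₚ.*-distribˡ-+ (sgn m) y z)) p
  go : ∀ {n} (v : Vec ℤ₄ n) a b c d → odds v ℕ.+ (c ℕ.+ d) ≡ double m → T r s v a b c d ≼ sgn m ℤ.* V v a b c d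
  go-C : ∀ {n} (v : Vec ℤ₄ n) a b c d → suc (odds v ℕ.+ (c ℕ.+ d)) ≡ double m →
    T r s v a b (suc c) d ≼ sgn m ℤ.* V v a b (suc c) d
  go-C v a b c d eq = go v a b (suc c) d (trans (ℕₚ.+-suc (odds v) (c ℕ.+ d)) eq)
  go-D : ∀ {n} (v : Vec ℤ₄ n) a b c d → suc (odds v ℕ.+ (c ℕ.+ d)) ≡ double m →
    T r s v a b c (suc d) ≼ sgn m ℤ.* V v a b c (suc d)
  go-D v a b c d eq = go v a b c (suc d) (trans (cong (odds v ℕ.+_) (ℕₚ.+-suc c d)) (trans (ℕₚ.+-suc (odds v) (c ℕ.+ d)) eq))
  go [] a b c d eq = ρ-Q r s a b c d m eq
  go (𝟘 ∷ v) a b c d eq = collect {y = V v (suc a) b c d} {V v a (suc b) c d} (≼-+ (go v (suc a) b c d eq) (go v a (suc b) c d eq)) refl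
  go (𝟙 ∷ v) a b c d eq = collect {y = V v a b (suc c) d} {V v a b c (suc d)} (≼-+ (go-C v a b c d eq) (go-D v a b c d eq)) (U-sucʳ r s (evens v) (odds v) a b c d)
  go (𝟚 ∷ v) a b c d eq = collect {y = V v (suc a) b c d} {V v a (suc b) c d} (≼-minus (go v (suc a) b c d eq) (go v a (suc b) c d eq)) refl
  go (𝟛 ∷ v) a b c d eq = collect {y = V v a b (suc c) d} {V v a b c (suc d)} (≼-minus (go-C v a b c d eq) (go-D v a b c d eq)) (U-sucʳ r s (evens v) (odds v) a b c d)

Q-abs : ∀ r s c d → Q r s 0 0 c d ≼ Q r s c d 0 0
Q-abs r s c d = ≼-* (g-abs r c 0 0) (g-abs s d 0 0)

-- Expanding powers of x + y in place of powers of x - y can only increase absolute values. This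
-- bounds w(n) by w(0), the starting value of the descent from the far end.
U-abs : ∀ r s μ c d → U r s 0 μ 0 0 c d ≼ U r s μ 0 c d 0 0
U-abs r s zero    c d = Q-abs r s c d
U-abs r s (suc μ) c d = ≼-+ (U-abs r s μ (suc c) d) (U-abs r s μ c (suc d))

Q-nonneg : ∀ r s a b → 0ℤ ℤ.≤ Q r s a b 0 0
Q-nonneg r s a b = 0≤* (g-nonneg r a 0 0) (g-nonneg s b 0 0)

U-nonneg : ∀ r s α a b → 0ℤ ℤ.≤ U r s α 0 a b 0 0
U-nonneg r s zero    a b = Q-nonneg r s a b
U-nonneg r s (suc α) a b = ℤₚ.+-mono-≤ (U-nonneg r s α (suc a) b) (U-nonneg r s α a (suc b))

-- The descent to w(2)

-- This is w(2j) for n = 2(i + j); `sgn j` removes the common sign of the summands.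
W : (r s i j : ℕ) → ℤ
W r s i j = sgn j ℤ.* U r s (double i) (double j) 0 0 0 0

W-step : ∀ r s i j → (1ℤ ℤ.+ + double i) ℤ.* W r s i (suc j) ≡ (1ℤ ℤ.+ + double j) ℤ.* W r s (suc i) j
W-step r s i j = begin
  (1ℤ ℤ.+ + double i) ℤ.* ((ℤ.- sgn j) ℤ.* u)  ≡⟨ shuffle (1ℤ ℤ.+ + double i) (sgn j) u ⟩
  (ℤ.- sgn j) ℤ.* ((1ℤ ℤ.+ + double i) ℤ.* u)  ≡⟨ cong (ℤ._*_ (ℤ.- sgn j)) (U-2+ r s (double i) (double j)) ⟩
  (ℤ.- sgn j) ℤ.* (ℤ.- ((1ℤ ℤ.+ + double j) ℤ.* u′)) ≡⟨ shuffle′ (1ℤ ℤ.+ + double j) (sgn j) u′ ⟩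
  (1ℤ ℤ.+ + double j) ℤ.* (sgn j ℤ.* u′) ∎
  where
  open ≡-Reasoning
  u = U r s (double i) (double (suc j)) 0 0 0 0
  u′ = U r s (double (suc i)) (double j) 0 0 0 0
  shuffle : ∀ x y z → x ℤ.* ((ℤ.- y) ℤ.* z) ≡ (ℤ.- y) ℤ.* (x ℤ.* z)
  shuffle = solve-∀
  shuffle′ : ∀ x y z → (ℤ.- y) ℤ.* (ℤ.- (x ℤ.* z)) ≡ x ℤ.* (y ℤ.* z)
  shuffle′ = solve-∀

W-nonneg : ∀ r s i j → 0ℤ ℤ.≤ W r s i j
W-nonneg r s i zero    = 0≤* {1ℤ} (ℤ.+≤+ ℕ.z≤n) (U-nonneg r s (double i) 0 0)
W-nonneg r s i (suc j) = ℤₚ.*-cancelˡ-≤-pos 0ℤ _ (1ℤ ℤ.+ + double i) (begin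
  (1ℤ ℤ.+ + double i) ℤ.* 0ℤ                ≡⟨ ℤₚ.*-zeroʳ (1ℤ ℤ.+ + double i) ⟩
  0ℤ                                        ≤⟨ 0≤* {1ℤ ℤ.+ + double j} (ℤ.+≤+ ℕ.z≤n) (W-nonneg r s (suc i) j) ⟩
  (1ℤ ℤ.+ + double j) ℤ.* W r s (suc i) j    ≡⟨ sym (W-step r s i j) ⟩
  (1ℤ ℤ.+ + double i) ℤ.* W r s i (suc j) ∎)
  where open ℤₚ.≤-Reasoning

double-mono-≤ : ∀ {i j} → i ℕ.≤ j → double i ℕ.≤ double j
double-mono-≤ ℕ.z≤n     = ℕ.z≤n
double-mono-≤ (ℕ.s≤s p) = ℕ.s≤s (ℕ.s≤s (double-mono-≤ p))

-- The recurrence is symmetric in i and j. Keeping w abstract lets the same argument run towards m =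
-- 2 and, with i and j exchanged, towards m = n - 2.
module Descent (w : ℕ → ℕ → ℤ) (M : ℤ) (w-nonneg : ∀ i j → 0ℤ ℤ.≤ w i j)
  (w-step : ∀ i j → (1ℤ ℤ.+ + double i) ℤ.* w i (suc j) ≡ (1ℤ ℤ.+ + double j) ℤ.* w (suc i) j) where

  descend : ∀ i j → j ℕ.≤ i → w i (suc j) ℤ.≤ w (suc i) j
  descend i j j≤i = ℤₚ.*-cancelˡ-≤-pos (w i (suc j)) (w (suc i) j) (1ℤ ℤ.+ + double i) (begin
    (1ℤ ℤ.+ + double i) ℤ.* w i (suc j) ≡⟨ w-step i j ⟩
    (1ℤ ℤ.+ + double j) ℤ.* w (suc i) j
      ≤⟨ ℤₚ.*-monoʳ-≤-nonNeg (w (suc i) j) {{ℤ.nonNegative (w-nonneg (suc i) j)}} (ℤ.+≤+ (ℕ.s≤s (double-mono-≤ j≤i))) ⟩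
    (1ℤ ℤ.+ + double i) ℤ.* w (suc i) j ∎)
    where open ℤₚ.≤-Reasoning

  -- Every move from `suc j` to j increases w as long as j ≤ i. At w N 1 the recurrence is exact,
  -- and its factor 1 + 2N is n - 1.
  bound : ∀ N → w (suc N) 0 ℤ.≤ M → ∀ i j → j ℕ.≤ i → i ℕ.+ j ≡ N → (1ℤ ℤ.+ + double N) ℤ.* w i (suc j) ℤ.≤ M
  bound N top i zero j≤i eq = begin
    (1ℤ ℤ.+ + double N) ℤ.* w i 1  ≡⟨ cong (λ k → (1ℤ ℤ.+ + double k) ℤ.* w i 1) (trans (sym eq) (ℕₚ.+-identityʳ i)) ⟩
    (1ℤ ℤ.+ + double i) ℤ.* w i 1  ≡⟨ w-step i 0 ⟩
    1ℤ ℤ.* w (suc i) 0             ≡⟨ ℤₚ.*-identityˡ _ ⟩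
    w (suc i) 0                    ≡⟨ cong (λ k → w (suc k) 0) (trans (sym (ℕₚ.+-identityʳ i)) eq) ⟩
    w (suc N) 0                    ≤⟨ top ⟩
    M ∎
    where open ℤₚ.≤-Reasoning
  bound N top i (suc j) j<i eq = ℤₚ.≤-trans
    (ℤₚ.*-monoˡ-≤-nonNeg (1ℤ ℤ.+ + double N) (descend i (suc j) j<i))
    (bound N top (suc i) j (ℕₚ.≤-trans (ℕₚ.n≤1+n j) (ℕₚ.≤-trans j<i (ℕₚ.n≤1+n i))) (trans (sym (ℕₚ.+-suc i j)) eq))

W-bound : ∀ r s i j → (1ℤ ℤ.+ + double (i ℕ.+ suc j)) ℤ.* W r s (suc i) (suc j) ℤ.≤ W r s (suc (suc (i ℕ.+ j))) 0
W-bound r s i j with ℕₚ.≤-total i j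
... | inj₂ j≤i = subst (λ N → (1ℤ ℤ.+ + double N) ℤ.* W r s (suc i) (suc j) ℤ.≤ W r s (suc (suc (i ℕ.+ j))) 0)
        (sym (ℕₚ.+-suc i j))
        (Descent.bound (W r s) (W r s (suc (suc (i ℕ.+ j))) 0) (W-nonneg r s) (W-step r s)
          (suc (i ℕ.+ j)) ℤₚ.≤-refl (suc i) j (ℕₚ.≤-trans j≤i (ℕₚ.n≤1+n i)) refl)
-- On this side the descent ends next to m = n, and w(n) ≤ w(0) provides its starting value.
... | inj₁ i≤j = Descent.bound (λ p q → W r s q p) (W r s (suc (suc (i ℕ.+ j))) 0) (λ p q → W-nonneg r s q p)
        (λ p q → sym (W-step r s q p)) (i ℕ.+ suc j) end (suc j) i (ℕₚ.≤-trans i≤j (ℕₚ.n≤1+n j)) (ℕₚ.+-comm (suc j) i)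
  where
  end : W r s 0 (suc (i ℕ.+ suc j)) ℤ.≤ W r s (suc (suc (i ℕ.+ j))) 0
  end = subst (λ N → W r s 0 (suc N) ℤ.≤ W r s (suc (suc (i ℕ.+ j))) 0) (sym (ℕₚ.+-suc i j))
    (subst (W r s 0 (suc (suc (i ℕ.+ j))) ℤ.≤_) (sym (ℤₚ.*-identityˡ _))
      (proj₁ (≼-sgn (suc (suc (i ℕ.+ j))) (U-abs r s (double (suc (suc (i ℕ.+ j)))) 0 0))))

-- The eigenvalue of the extremal vector

-- By homogeneity b + 2e = 2s unless `Q` vanishes, so b is even.
sgn-Q : ∀ r s a b c e → sgn b ℤ.* Q r s a b c (double e) ≡ Q r s a b c (double e)
sgn-Q r s a b c e with parity b
... | inj₁ (j , refl) = trans (cong (ℤ._* Q r s a b c (double e)) (sgn-double j)) (ℤₚ.*-identityˡ _)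
... | inj₂ (j , refl) = trans (cong (ℤ._*_ (sgn b)) Q≡0) (trans (ℤₚ.*-zeroʳ (sgn b)) (sym Q≡0))
  where
  Q≡0 : Q r s a b c (double e) ≡ 0ℤ
  Q≡0 = Q-zeroʳ r s a b c (double e) (g-vanish s b (double e) 0 0 (λ eq → odd≢even (j ℕ.+ e) s
    (trans (cong suc (trans (double-+ j e) (cong (double j ℕ.+_) (sym (ℕₚ.+-identityʳ (double e)))))) eq)))

twosThree : ∀ j → Vec ℤ₄ (j ℕ.+ 1)
twosThree j = V.replicate j 𝟚 V.++ (𝟛 ∷ [])

-- A coordinate 2 gives A - B, so a term is signed by the number of factors B chosen from now on.
-- The final number of factors B is even, hence this sign is that of the b factors chosen before.
T-twos : ∀ r s c d → (∀ a b → T r s (𝟛 ∷ []) a b c d ≡ sgn b ℤ.* U r s 0 1 a b c d) →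
  ∀ j a b → T r s (twosThree j) a b c d ≡ sgn b ℤ.* U r s j 1 a b c d
T-twos r s c d base zero    a b = base a b
T-twos r s c d base (suc j) a b = trans
  (cong₂ ℤ._-_ (T-twos r s c d base j (suc a) b) (T-twos r s c d base j a (suc b)))
  (shuffle (sgn b) (U r s j 1 (suc a) b c d) (U r s j 1 a (suc b) c d))
  where
  shuffle : ∀ x y z → x ℤ.* y ℤ.- (ℤ.- x) ℤ.* z ≡ x ℤ.* (y ℤ.+ z)
  shuffle = solve-∀

-- The entries 1 and 3 give (C + √-1 D)(C - √-1 D) = C² + D², which differs from (C + D)² by 2CD,
-- and odd powers of C contribute nothing. So all terms have the same sign and the bound is
-- attained.
T-extremal : ∀ r s j → T r s (typeVec 0 1 j 1) 0 0 0 0 ≡ U r s j 2 0 0 0 0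
T-extremal r s j = begin
  T r s (twosThree j) 0 0 1 0 ℤ.+ T r s (twosThree j) 0 0 0 1
    ≡⟨ cong₂ ℤ._+_ (trans (T-twos r s 1 0 base-C j 0 0) (ℤₚ.*-identityˡ _)) (trans (T-twos r s 0 1 base-D j 0 0) (ℤₚ.*-identityˡ _)) ⟩
  U r s j 1 0 0 1 0 ℤ.+ U r s j 1 0 0 0 1
    ≡⟨ sym (U-sucʳ r s j 1 0 0 0 0) ⟩
  U r s j 2 0 0 0 0 ∎
  where
  open ≡-Reasoning
  Q₁₁ : ∀ a b → Q r s a b 1 1 ≡ 0ℤ
  Q₁₁ a b = Q-zeroˡ r s a b 1 1 (κ-1 r a)
  base-C : ∀ a b → T r s (𝟛 ∷ []) a b 1 0 ≡ sgn b ℤ.* U r s 0 1 a b 1 0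
  base-C a b = trans
    (cong₂ ℤ._-_ (ℤₚ.*-identityˡ (Q r s a b 2 0)) (ℤₚ.*-zeroˡ (Q r s a b 1 1)))
    (trans (ℤₚ.+-identityʳ (Q r s a b 2 0)) (trans (sym (sgn-Q r s a b 2 0)) (cong (ℤ._*_ (sgn b))
      (trans (sym (ℤₚ.+-identityʳ (Q r s a b 2 0))) (cong (ℤ._+_ (Q r s a b 2 0)) (sym (Q₁₁ a b)))))))
  neg-one : ∀ x → 0ℤ ℤ.- (ℤ.- 1ℤ) ℤ.* x ≡ x
  neg-one = solve-∀
  base-D : ∀ a b → T r s (𝟛 ∷ []) a b 0 1 ≡ sgn b ℤ.* U r s 0 1 a b 0 1
  base-D a b = trans
    (cong (ℤ._- (ℤ.- 1ℤ) ℤ.* Q r s a b 0 2) (ℤₚ.*-zeroˡ (Q r s a b 1 1)))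
    (trans (neg-one (Q r s a b 0 2)) (trans (sym (sgn-Q r s a b 0 1)) (cong (ℤ._*_ (sgn b))
      (trans (sym (ℤₚ.+-identityˡ (Q r s a b 0 2))) (cong (ℤ._+ Q r s a b 0 2) (sym (Q₁₁ a b)))))))

-- Vectors with only even or only odd entries: Krawtchouk values

-- Krawtchouk values: the coefficient of xᵏ in (1 + x)ᵃ (1 − x)ᵗ
kr : (a t k : ℕ) → ℤ
kr zero    zero    zero    = 1ℤ
kr zero    zero    (suc k) = 0ℤ
kr zero    (suc t) zero    = kr zero t zero
kr zero    (suc t) (suc k) = kr zero t (suc k) ℤ.- kr zero t k
kr (suc a) t       zero    = kr a t zero
kr (suc a) t       (suc k) = kr a t (suc k) ℤ.+ kr a t k

kr-0 : ∀ a t → kr a t 0 ≡ 1ℤ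
kr-0 zero    zero    = refl
kr-0 zero    (suc t) = kr-0 zero t
kr-0 (suc a) t       = kr-0 a t

kr-sucʳ : ∀ a t k → kr a (suc t) (suc k) ≡ kr a t (suc k) ℤ.- kr a t k
kr-sucʳ zero    t k       = refl
kr-sucʳ (suc a) t zero    = trans (cong₂ ℤ._+_ (kr-sucʳ a t 0) (trans (kr-0 a (suc t)) (sym (kr-0 a t))))
  (shuffle (kr a t 1) (kr a t 0))
  where
  shuffle : ∀ x y → (x ℤ.- y) ℤ.+ y ≡ (x ℤ.+ y) ℤ.- y
  shuffle = solve-∀
kr-sucʳ (suc a) t (suc k) = trans (cong₂ ℤ._+_ (kr-sucʳ a t (suc k)) (kr-sucʳ a t k))
  (shuffle (kr a t (suc (suc k))) (kr a t (suc k)) (kr a t k))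
  where
  shuffle : ∀ x y z → (x ℤ.- y) ℤ.+ (y ℤ.- z) ≡ (x ℤ.+ y) ℤ.- (y ℤ.+ z)
  shuffle = solve-∀

-- Expands a product of sums (`true`) and differences (`false`) of two symbols, x and y counting the
-- choices made. It serves A ± B for even entries and C ± D for odd ones.
walk : List Bool → (ℕ → ℕ → ℤ) → ℕ → ℕ → ℤ
walk L.[]            f x y = f x y
walk (true  L.∷ w) f x y = walk w f (suc x) y ℤ.+ walk w f x (suc y)
walk (false L.∷ w) f x y = walk w f (suc x) y ℤ.- walk w f x (suc y)

trues falses : List Bool → ℕ
trues L.[]              = 0
trues (true  L.∷ w)   = suc (trues w)
trues (false L.∷ w)   = trues w
falses L.[]             = 0
falses (true  L.∷ w)  = falses w
falses (false L.∷ w)  = suc (falses w)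

trues+falses : ∀ w → trues w ℕ.+ falses w ≡ L.length w
trues+falses L.[]            = refl
trues+falses (true  L.∷ w) = cong suc (trues+falses w)
trues+falses (false L.∷ w) = trans (ℕₚ.+-suc (trues w) (falses w)) (cong suc (trues+falses w))

-- When f lives on one point, what is left is the signed number of ways to reach it: the coefficient
-- of x^j in (1 + x)^{trues} (1 - x)^{falses}, where j second symbols are still to be chosen.
module Walk (f : ℕ → ℕ → ℤ) (A B : ℕ) (off : ∀ x y → ¬ (x ≡ A × y ≡ B) → f x y ≡ 0ℤ) where

  walk-zero : ∀ w x y → B ℕ.< y → walk w f x y ≡ 0ℤ
  walk-zero L.[]            x y B<y = off x y (λ (_ , y≡B) → ℕₚ.<⇒≢ B<y (sym y≡B))
  walk-zero (true  L.∷ w) x y B<y = cong₂ ℤ._+_ (walk-zero w (suc x) y B<y) (walk-zero w x (suc y) (ℕₚ.m<n⇒m<1+n B<y))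
  walk-zero (false L.∷ w) x y B<y = cong₂ ℤ._-_ (walk-zero w (suc x) y B<y) (walk-zero w x (suc y) (ℕₚ.m<n⇒m<1+n B<y))

  walk-kr : ∀ w x y j → y ℕ.+ j ≡ B → x ℕ.+ L.length w ≡ A ℕ.+ j → walk w f x y ≡ kr (trues w) (falses w) j ℤ.* f A B
  walk-kr L.[] x y zero yj xw = trans
    (cong₂ f (trans (sym (ℕₚ.+-identityʳ x)) (trans xw (ℕₚ.+-identityʳ A))) (trans (sym (ℕₚ.+-identityʳ y)) yj))
    (sym (ℤₚ.*-identityˡ _))
  walk-kr L.[] x y (suc j) yj xw = trans (off x y (λ { (refl , y≡B) → ℕₚ.m≢1+m+n x (trans (sym (ℕₚ.+-identityʳ x)) (trans xw (ℕₚ.+-suc x j))) }))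
    (sym (ℤₚ.*-zeroˡ (f A B)))
  walk-kr (true L.∷ w) x y zero yj xw = trans
    (cong₂ ℤ._+_ (walk-kr w (suc x) y zero yj (trans (sym (ℕₚ.+-suc x _)) xw))
      (walk-zero w x (suc y) (ℕₚ.≤-reflexive (cong suc (trans (sym yj) (ℕₚ.+-identityʳ y))))))
    (ℤₚ.+-identityʳ _)
  walk-kr (true L.∷ w) x y (suc j) yj xw = trans
    (cong₂ ℤ._+_ (walk-kr w (suc x) y (suc j) yj (trans (sym (ℕₚ.+-suc x _)) xw))
      (walk-kr w x (suc y) j (trans (sym (ℕₚ.+-suc y j)) yj)
        (ℕₚ.suc-injective (trans (sym (ℕₚ.+-suc x _)) (trans xw (ℕₚ.+-suc A j))))))
    (sym (ℤₚ.*-distribʳ-+ (f A B) (kr (trues w) (falses w) (suc j)) (kr (trues w) (falses w) j)))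
  walk-kr (false L.∷ w) x y zero yj xw = trans
    (cong₂ ℤ._-_ (walk-kr w (suc x) y zero yj (trans (sym (ℕₚ.+-suc x _)) xw))
      (walk-zero w x (suc y) (ℕₚ.≤-reflexive (cong suc (trans (sym yj) (ℕₚ.+-identityʳ y))))))
    (trans (ℤₚ.+-identityʳ _) (cong (ℤ._* f A B) (trans (kr-0 (trues w) (falses w)) (sym (kr-0 (trues w) (suc (falses w)))))))
  walk-kr (false L.∷ w) x y (suc j) yj xw = trans
    (cong₂ ℤ._-_ (walk-kr w (suc x) y (suc j) yj (trans (sym (ℕₚ.+-suc x _)) xw))
      (walk-kr w x (suc y) j (trans (sym (ℕₚ.+-suc y j)) yj)
        (ℕₚ.suc-injective (trans (sym (ℕₚ.+-suc x _)) (trans xw (ℕₚ.+-suc A j))))))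
    (trans (factor (kr (trues w) (falses w) (suc j)) (kr (trues w) (falses w) j) (f A B))
      (cong (ℤ._* f A B) (sym (kr-sucʳ (trues w) (falses w) j))))
    where
    factor : ∀ x y z → x ℤ.* z ℤ.- y ℤ.* z ≡ (x ℤ.- y) ℤ.* z
    factor = solve-∀

signs : ∀ {n} → Vec ℤ₄ n → List Bool
signs []      = L.[]
signs (𝟘 ∷ v) = true L.∷ signs v
signs (𝟙 ∷ v) = true L.∷ signs v
signs (𝟚 ∷ v) = false L.∷ signs v
signs (𝟛 ∷ v) = false L.∷ signs v

length-signs : ∀ {n} (v : Vec ℤ₄ n) → L.length (signs v) ≡ n
length-signs []      = refl
length-signs (𝟘 ∷ v) = cong suc (length-signs v)
length-signs (𝟙 ∷ v) = cong suc (length-signs v)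
length-signs (𝟚 ∷ v) = cong suc (length-signs v)
length-signs (𝟛 ∷ v) = cong suc (length-signs v)

T-even-walk : ∀ r s {n} (v : Vec ℤ₄ n) → odds v ≡ 0 → ∀ a b →
  T r s v a b 0 0 ≡ walk (signs v) (λ x y → Q r s x y 0 0) a b
T-even-walk r s []      _  a b = ℤₚ.*-identityˡ _
T-even-walk r s (𝟘 ∷ v) eq a b = cong₂ ℤ._+_ (T-even-walk r s v eq (suc a) b) (T-even-walk r s v eq a (suc b))
T-even-walk r s (𝟙 ∷ v) () a b
T-even-walk r s (𝟛 ∷ v) () a b
T-even-walk r s (𝟚 ∷ v) eq a b = cong₂ ℤ._-_ (T-even-walk r s v eq (suc a) b) (T-even-walk r s v eq a (suc b))

T-odd-walk : ∀ r s {n} (v : Vec ℤ₄ n) → evens v ≡ 0 → ∀ c d →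
  T r s v 0 0 c d ≡ walk (signs v) (λ x y → ρ y ℤ.* Q r s 0 0 x y) c d
T-odd-walk r s []      _  c d = refl
T-odd-walk r s (𝟙 ∷ v) eq c d = cong₂ ℤ._+_ (T-odd-walk r s v eq (suc c) d) (T-odd-walk r s v eq c (suc d))
T-odd-walk r s (𝟘 ∷ v) () c d
T-odd-walk r s (𝟚 ∷ v) () c d
T-odd-walk r s (𝟛 ∷ v) eq c d = cong₂ ℤ._-_ (T-odd-walk r s v eq (suc c) d) (T-odd-walk r s v eq c (suc d))

U-walk : ∀ r s n a b → U r s n 0 a b 0 0 ≡ walk (L.replicate n true) (λ x y → Q r s x y 0 0) a b
U-walk r s zero    a b = refl
U-walk r s (suc n) a b = cong₂ ℤ._+_ (U-walk r s n (suc a) b) (U-walk r s n a (suc b))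

-- The common factor of the eigenvalues at m = 0 and m = n, equal to C(2r, r) C(2s, s) by
-- `κ-binomial`.
κκ : (r s : ℕ) → ℤ
κκ r s = Q r s (double r) (double s) 0 0

κκ-nonneg : ∀ r s → 0ℤ ℤ.≤ κκ r s
κκ-nonneg r s = Q-nonneg r s (double r) (double s)

Q-even-off : ∀ r s x y → ¬ (x ≡ double r × y ≡ double s) → Q r s x y 0 0 ≡ 0ℤ
Q-even-off r s x y off with x ℕ.≟ double r
... | no x≢ = Q-zeroˡ r s x y 0 0 (g-vanish r x 0 0 0 (x≢ ∘ trans (sym (ℕₚ.+-identityʳ x))))
... | yes x≡ = Q-zeroʳ r s x y 0 0 (g-vanish s y 0 0 0 (λ eq → off (x≡ , trans (sym (ℕₚ.+-identityʳ y)) eq)))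

Q-odd-off : ∀ r s x y → ¬ (x ≡ double r × y ≡ double s) → Q r s 0 0 x y ≡ 0ℤ
Q-odd-off r s x y off with x ℕ.≟ double r
... | no x≢ = Q-zeroˡ r s 0 0 x y (g-vanish r 0 x 0 0 (x≢ ∘ trans (sym (ℕₚ.+-identityʳ x))))
... | yes x≡ = Q-zeroʳ r s 0 0 x y (g-vanish s 0 y 0 0 (λ eq → off (x≡ , trans (sym (ℕₚ.+-identityʳ y)) eq)))

T-even : ∀ r s {n} (v : Vec ℤ₄ n) → n ≡ double (r ℕ.+ s) → odds v ≡ 0 →
  T r s v 0 0 0 0 ≡ kr (trues (signs v)) (falses (signs v)) (double s) ℤ.* κκ r s
T-even r s v n≡ eq = trans (T-even-walk r s v eq 0 0)
  (Walk.walk-kr (λ x y → Q r s x y 0 0) (double r) (double s) (Q-even-off r s) (signs v) 0 0 (double s) refl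
    (trans (length-signs v) (trans n≡ (double-+ r s))))

-- Flipping (x - y)^{2r} and (x - y)^{2s} produces (-1)^r (-1)^s. The factor √-1^{2s} = (-1)^s
-- cancels the second sign, and the evenness of r removes the first.
ρQ-top : ∀ r s q → r ≡ double q → ρ (double s) ℤ.* Q r s 0 0 (double r) (double s) ≡ κκ r s
ρQ-top r s q r≡ = begin
  ρ (double s) ℤ.* (κ r 0 (double r) ℤ.* κ s 0 (double s))
    ≡⟨ cong₂ (λ x y → x ℤ.* y) (ρ-double s) (cong₂ ℤ._*_ (g-flip r (double r) 0 0) (g-flip s (double s) 0 0)) ⟩
  sgn s ℤ.* ((1ℤ ℤ.* sgn r) ℤ.* κ r (double r) 0 ℤ.* ((1ℤ ℤ.* sgn s) ℤ.* κ s (double s) 0))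
    ≡⟨ shuffle (sgn s) (sgn r) (κ r (double r) 0) (κ s (double s) 0) ⟩
  (sgn s ℤ.* sgn s) ℤ.* sgn r ℤ.* κκ r s
    ≡⟨ cong (ℤ._* κκ r s) (cong₂ ℤ._*_ (sgn² s) (trans (cong sgn r≡) (sgn-double q))) ⟩
  1ℤ ℤ.* κκ r s
    ≡⟨ ℤₚ.*-identityˡ (κκ r s) ⟩
  κκ r s ∎
  where
  open ≡-Reasoning
  shuffle : ∀ x y z w → x ℤ.* ((1ℤ ℤ.* y) ℤ.* z ℤ.* ((1ℤ ℤ.* x) ℤ.* w)) ≡ (x ℤ.* x) ℤ.* y ℤ.* (z ℤ.* w)
  shuffle = solve-∀

T-all-odd : ∀ r s q {n} (v : Vec ℤ₄ n) → r ≡ double q → n ≡ double (r ℕ.+ s) → evens v ≡ 0 →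
  T r s v 0 0 0 0 ≡ kr (trues (signs v)) (falses (signs v)) (double s) ℤ.* κκ r s
T-all-odd r s q v r≡ n≡ eq = trans (T-odd-walk r s v eq 0 0)
  (trans (Walk.walk-kr (λ x y → ρ y ℤ.* Q r s 0 0 x y) (double r) (double s)
      (λ x y off → trans (cong (ℤ._*_ (ρ y)) (Q-odd-off r s x y off)) (ℤₚ.*-zeroʳ (ρ y)))
      (signs v) 0 0 (double s) refl (trans (length-signs v) (trans n≡ (double-+ r s))))
    (cong (ℤ._*_ (kr (trues (signs v)) (falses (signs v)) (double s))) (ρQ-top r s q r≡)))

trues-replicate : ∀ n → trues (L.replicate n true) ≡ n
trues-replicate zero    = refl
trues-replicate (suc n) = cong suc (trues-replicate n)

falses-replicate : ∀ n → falses (L.replicate n true) ≡ 0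
falses-replicate zero    = refl
falses-replicate (suc n) = falses-replicate n

length-replicate : ∀ n → L.length (L.replicate n true) ≡ n
length-replicate zero    = refl
length-replicate (suc n) = cong suc (length-replicate n)

U-top : ∀ r s n → n ≡ double (r ℕ.+ s) → U r s n 0 0 0 0 0 ≡ kr n 0 (double s) ℤ.* κκ r s
U-top r s n n≡ = trans (U-walk r s n 0 0)
  (trans (Walk.walk-kr (λ x y → Q r s x y 0 0) (double r) (double s) (Q-even-off r s) (L.replicate n true) 0 0 (double s) refl
    (trans (length-replicate n) (trans n≡ (double-+ r s))))
  (cong₂ (λ a t → kr a t (double s) ℤ.* κκ r s) (trues-replicate n) (falses-replicate n)))

-- Symmetry, three-term recurrence and nonnegativity for large D

-- Replacing x by -x exchanges the factors 1 + x and 1 - x.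
kr-flip : ∀ a t k → kr a t k ≡ sgn k ℤ.* kr t a k
kr-flip a       t       zero    = trans (kr-0 a t) (trans (sym (kr-0 t a)) (sym (ℤₚ.*-identityˡ _)))
kr-flip zero    zero    (suc k) = sym (ℤₚ.*-zeroʳ (sgn (suc k)))
kr-flip zero    (suc t) (suc k) = trans (cong₂ ℤ._-_ (kr-flip zero t (suc k)) (kr-flip zero t k))
  (shuffle (sgn k) (kr t 0 (suc k)) (kr t 0 k))
  where
  shuffle : ∀ x y z → (ℤ.- x) ℤ.* y ℤ.- x ℤ.* z ≡ (ℤ.- x) ℤ.* (y ℤ.+ z)
  shuffle = solve-∀
kr-flip (suc a) t       (suc k) = trans (cong₂ ℤ._+_ (kr-flip a t (suc k)) (kr-flip a t k))
  (trans (shuffle (sgn k) (kr t a (suc k)) (kr t a k)) (cong (ℤ._*_ (sgn (suc k))) (sym (kr-sucʳ t a k))))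
  where
  shuffle : ∀ x y z → (ℤ.- x) ℤ.* y ℤ.+ x ℤ.* z ≡ (ℤ.- x) ℤ.* (y ℤ.- z)
  shuffle = solve-∀

kr-sym : ∀ a t s → kr a t (double s) ≡ kr t a (double s)
kr-sym a t s = trans (kr-flip a t (double s))
  (trans (cong (ℤ._* kr t a (double s)) (sgn-double s)) (ℤₚ.*-identityˡ _))

kr-1 : ∀ a t → kr a t 1 ≡ + a ℤ.- + t
kr-1 zero    zero    = refl
kr-1 zero    (suc t) = trans (cong₂ ℤ._-_ (kr-1 zero t) (kr-0 zero t)) (shuffle (+ t))
  where
  shuffle : ∀ x → (0ℤ ℤ.- x) ℤ.- 1ℤ ≡ 0ℤ ℤ.- (1ℤ ℤ.+ x)
  shuffle = solve-∀
kr-1 (suc a) t       = trans (cong₂ ℤ._+_ (kr-1 a t) (kr-0 a t)) (shuffle (+ a) (+ t))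
  where
  shuffle : ∀ x y → (x ℤ.- y) ℤ.+ 1ℤ ≡ (1ℤ ℤ.+ x) ℤ.- y
  shuffle = solve-∀

-- Comes from (1 - x²) f′ = ((a - t) - (a + t) x) f for f = (1 + x)^a (1 - x)^t, by comparing
-- coefficients of x^{k+1}.
defect : (a t k c₂ c₁ c₀ : ℤ) → ℤ
defect a t k c₂ c₁ c₀ = (+ 2 ℤ.+ k) ℤ.* c₂ ℤ.- ((a ℤ.- t) ℤ.* c₁ ℤ.- (a ℤ.+ t ℤ.- k) ℤ.* c₀)

kr-defect : (a t k : ℕ) → ℤ
kr-defect a t k = defect (+ a) (+ t) (+ k) (kr a t (suc (suc k))) (kr a t (suc k)) (kr a t k)

-- Written as a defect, the recurrence is compatible with the recursion of `kr`: a further factor 1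
-- + x or 1 - x makes the defect at k + 1 the sum or difference of the old defects at k + 1 and k.
kr-recurrence : ∀ a t k → kr-defect a t k ≡ 0ℤ
kr-recurrence zero zero k = trans (vanish (+ k) (kr 0 0 k)) (k·δ k)
  where
  vanish : ∀ k x → (+ 2 ℤ.+ k) ℤ.* 0ℤ ℤ.- ((0ℤ ℤ.- 0ℤ) ℤ.* 0ℤ ℤ.- (0ℤ ℤ.+ 0ℤ ℤ.- k) ℤ.* x) ≡ ℤ.- (k ℤ.* x)
  vanish = solve-∀
  k·δ : ∀ k → ℤ.- (+ k ℤ.* kr 0 0 k) ≡ 0ℤ
  k·δ zero    = refl
  k·δ (suc k) = cong ℤ.-_ (ℤₚ.*-zeroʳ (+ suc k))
kr-recurrence zero (suc t) zero = begin
  defect 0ℤ (1ℤ ℤ.+ + t) 0ℤ (kr 0 t 2 ℤ.- kr 0 t 1) (kr 0 t 1 ℤ.- kr 0 t 0) (kr 0 t 0)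
    ≡⟨ identity (+ t) (kr 0 t 2) (kr 0 t 1) (kr 0 t 0) ⟩
  kr-defect 0 t 0 ℤ.+ ((0ℤ ℤ.- + t) ℤ.* kr 0 t 0 ℤ.- kr 0 t 1)
    ≡⟨ cong₂ ℤ._+_ (kr-recurrence 0 t 0) (trans (cong₂ (λ x y → (0ℤ ℤ.- + t) ℤ.* x ℤ.- y) (kr-0 0 t) (kr-1 0 t)) (cancel (+ t))) ⟩
  0ℤ ∎
  where
  open ≡-Reasoning
  identity : ∀ t c₂ c₁ c₀ →
    (+ 2 ℤ.+ 0ℤ) ℤ.* (c₂ ℤ.- c₁) ℤ.- ((0ℤ ℤ.- (1ℤ ℤ.+ t)) ℤ.* (c₁ ℤ.- c₀) ℤ.- (0ℤ ℤ.+ (1ℤ ℤ.+ t) ℤ.- 0ℤ) ℤ.* c₀)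
    ≡ ((+ 2 ℤ.+ 0ℤ) ℤ.* c₂ ℤ.- ((0ℤ ℤ.- t) ℤ.* c₁ ℤ.- (0ℤ ℤ.+ t ℤ.- 0ℤ) ℤ.* c₀)) ℤ.+ ((0ℤ ℤ.- t) ℤ.* c₀ ℤ.- c₁)
  identity = solve-∀
  cancel : ∀ t → (0ℤ ℤ.- t) ℤ.* 1ℤ ℤ.- (0ℤ ℤ.- t) ≡ 0ℤ
  cancel = solve-∀
kr-recurrence zero (suc t) (suc k) = trans
  (identity (+ t) (+ k) (kr 0 t (suc (suc (suc k)))) (kr 0 t (suc (suc k))) (kr 0 t (suc k)) (kr 0 t k))
  (cong₂ ℤ._-_ (kr-recurrence 0 t (suc k)) (kr-recurrence 0 t k))
  where
  identity : ∀ t k c₃ c₂ c₁ c₀ →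
    (+ 2 ℤ.+ (1ℤ ℤ.+ k)) ℤ.* (c₃ ℤ.- c₂) ℤ.- ((0ℤ ℤ.- (1ℤ ℤ.+ t)) ℤ.* (c₂ ℤ.- c₁) ℤ.- (0ℤ ℤ.+ (1ℤ ℤ.+ t) ℤ.- (1ℤ ℤ.+ k)) ℤ.* (c₁ ℤ.- c₀))
    ≡ ((+ 2 ℤ.+ (1ℤ ℤ.+ k)) ℤ.* c₃ ℤ.- ((0ℤ ℤ.- t) ℤ.* c₂ ℤ.- (0ℤ ℤ.+ t ℤ.- (1ℤ ℤ.+ k)) ℤ.* c₁))
      ℤ.- ((+ 2 ℤ.+ k) ℤ.* c₂ ℤ.- ((0ℤ ℤ.- t) ℤ.* c₁ ℤ.- (0ℤ ℤ.+ t ℤ.- k) ℤ.* c₀))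
  identity = solve-∀
kr-recurrence (suc a) t zero = begin
  defect (1ℤ ℤ.+ + a) (+ t) 0ℤ (kr a t 2 ℤ.+ kr a t 1) (kr a t 1 ℤ.+ kr a t 0) (kr a t 0)
    ≡⟨ identity (+ a) (+ t) (kr a t 2) (kr a t 1) (kr a t 0) ⟩
  kr-defect a t 0 ℤ.+ (kr a t 1 ℤ.- (+ a ℤ.- + t) ℤ.* kr a t 0)
    ≡⟨ cong₂ ℤ._+_ (kr-recurrence a t 0) (trans (cong₂ (λ x y → y ℤ.- (+ a ℤ.- + t) ℤ.* x) (kr-0 a t) (kr-1 a t)) (cancel (+ a ℤ.- + t))) ⟩
  0ℤ ∎
  where
  open ≡-Reasoning
  identity : ∀ a t c₂ c₁ c₀ →
    (+ 2 ℤ.+ 0ℤ) ℤ.* (c₂ ℤ.+ c₁) ℤ.- (((1ℤ ℤ.+ a) ℤ.- t) ℤ.* (c₁ ℤ.+ c₀) ℤ.- ((1ℤ ℤ.+ a) ℤ.+ t ℤ.- 0ℤ) ℤ.* c₀)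
    ≡ ((+ 2 ℤ.+ 0ℤ) ℤ.* c₂ ℤ.- ((a ℤ.- t) ℤ.* c₁ ℤ.- (a ℤ.+ t ℤ.- 0ℤ) ℤ.* c₀)) ℤ.+ (c₁ ℤ.- (a ℤ.- t) ℤ.* c₀)
  identity = solve-∀
  cancel : ∀ x → x ℤ.- x ℤ.* 1ℤ ≡ 0ℤ
  cancel = solve-∀
kr-recurrence (suc a) t (suc k) = trans
  (identity (+ a) (+ t) (+ k) (kr a t (suc (suc (suc k)))) (kr a t (suc (suc k))) (kr a t (suc k)) (kr a t k))
  (cong₂ ℤ._+_ (kr-recurrence a t (suc k)) (kr-recurrence a t k))
  where
  identity : ∀ a t k c₃ c₂ c₁ c₀ →
    (+ 2 ℤ.+ (1ℤ ℤ.+ k)) ℤ.* (c₃ ℤ.+ c₂) ℤ.- (((1ℤ ℤ.+ a) ℤ.- t) ℤ.* (c₂ ℤ.+ c₁) ℤ.- ((1ℤ ℤ.+ a) ℤ.+ t ℤ.- (1ℤ ℤ.+ k)) ℤ.* (c₁ ℤ.+ c₀))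
    ≡ ((+ 2 ℤ.+ (1ℤ ℤ.+ k)) ℤ.* c₃ ℤ.- ((a ℤ.- t) ℤ.* c₂ ℤ.- (a ℤ.+ t ℤ.- (1ℤ ℤ.+ k)) ℤ.* c₁))
      ℤ.+ ((+ 2 ℤ.+ k) ℤ.* c₂ ℤ.- ((a ℤ.- t) ℤ.* c₁ ℤ.- (a ℤ.+ t ℤ.- k) ℤ.* c₀))
  identity = solve-∀

-- The invariant D c_j ≤ 2 (j + 1) c_{j+1} for the coefficients c_j of (1 + x)^{D+t} (1 − x)^t
-- survives the three-term recurrence as long as 4 (j + 1) (D + 2t − j) ≤ D².
kr-nonneg : ∀ D t k → 0 ℕ.< D →
  (∀ j → suc j ℕ.< k → ∃ λ m → j ℕ.+ m ≡ D ℕ.+ (t ℕ.+ t) × 4 ℕ.* (suc j ℕ.* m) ℕ.≤ D ℕ.* D) →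
  0ℤ ℤ.≤ kr (D ℕ.+ t) t k
kr-nonneg D t zero    D>0 h = subst (0ℤ ℤ.≤_) (sym (kr-0 (D ℕ.+ t) t)) (ℤ.+≤+ ℕ.z≤n)
kr-nonneg D t (suc k) D>0 h = next k (invariant k ℕₚ.≤-refl)
  where
  c : ℕ → ℤ
  c = kr (D ℕ.+ t) t
  instance
    D-positive : ℤ.Positive (+ D)
    D-positive = ℤ.positive (ℤ.+<+ D>0)
  Invariant : ℕ → Set
  Invariant j = 0ℤ ℤ.≤ c j × + D ℤ.* c j ℤ.≤ + 2 ℤ.* ((1ℤ ℤ.+ + j) ℤ.* c (suc j))
  next : ∀ j → Invariant j → 0ℤ ℤ.≤ c (suc j)
  next j (nonneg , ratio) = ℤₚ.*-cancelˡ-≤-pos 0ℤ (c (suc j)) (1ℤ ℤ.+ + j) (ℤₚ.*-cancelˡ-≤-pos _ _ (+ 2) (begin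
    + 2 ℤ.* ((1ℤ ℤ.+ + j) ℤ.* 0ℤ)       ≡⟨ cong (ℤ._*_ (+ 2)) (ℤₚ.*-zeroʳ (1ℤ ℤ.+ + j)) ⟩
    0ℤ                                  ≤⟨ 0≤* {+ D} (ℤ.+≤+ ℕ.z≤n) nonneg ⟩
    + D ℤ.* c j                         ≤⟨ ratio ⟩
    + 2 ℤ.* ((1ℤ ℤ.+ + j) ℤ.* c (suc j)) ∎))
    where open ℤₚ.≤-Reasoning
  invariant : ∀ j → suc j ℕ.≤ suc k → Invariant j
  invariant zero _ = subst (0ℤ ℤ.≤_) (sym (kr-0 (D ℕ.+ t) t)) (ℤ.+≤+ ℕ.z≤n) ,
    subst₂ (λ x y → + D ℤ.* x ℤ.≤ + 2 ℤ.* (1ℤ ℤ.* y)) (sym (kr-0 (D ℕ.+ t) t)) (sym (trans (kr-1 (D ℕ.+ t) t) (shuffle (+ D) (+ t))))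
      (subst₂ ℤ._≤_ (sym (ℤₚ.*-identityʳ (+ D))) (cong (ℤ._*_ (+ 2)) (sym (ℤₚ.*-identityˡ (+ D))))
        (subst (ℤ._≤ + 2 ℤ.* + D) (ℤₚ.*-identityˡ (+ D)) (ℤₚ.*-monoʳ-≤-nonNeg (+ D) {1ℤ} {+ 2} (ℤ.+≤+ (ℕ.s≤s ℕ.z≤n)))))
    where
    shuffle : ∀ x y → (x ℤ.+ y) ℤ.- y ≡ x
    shuffle = solve-∀
  invariant (suc j) j<k with invariant j (ℕₚ.<⇒≤ j<k) | h j j<k
  ... | inv@(nonneg , ratio) | m , j+m , room = c≥0 , (begin
    + D ℤ.* c (suc j)
      ≡⟨ split (+ D ℤ.* c (suc j)) ⟩
    + 2 ℤ.* (+ D ℤ.* c (suc j)) ℤ.- + D ℤ.* c (suc j)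
      ≤⟨ ℤₚ.+-monoʳ-≤ (+ 2 ℤ.* (+ D ℤ.* c (suc j))) (ℤₚ.neg-mono-≤ main) ⟩
    + 2 ℤ.* (+ D ℤ.* c (suc j)) ℤ.- + 2 ℤ.* (+ m ℤ.* c j)
      ≡⟨ recurrence (+ D) (+ t) (+ j) (+ m) (c (suc (suc j))) (c (suc j)) (c j)
          (kr-recurrence (D ℕ.+ t) t j) (cong +_ j+m) ⟩
    + 2 ℤ.* ((1ℤ ℤ.+ (1ℤ ℤ.+ + j)) ℤ.* c (suc (suc j))) ∎)
    where
    open ℤₚ.≤-Reasoning
    c≥0 = next j inv
    split : ∀ x → x ≡ + 2 ℤ.* x ℤ.- x
    split = solve-∀
    swap : ∀ x y z → x ℤ.* (+ 2 ℤ.* (y ℤ.* z)) ≡ + 2 ℤ.* (y ℤ.* (x ℤ.* z))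
    swap = solve-∀
    regroup : ∀ j m x → + 2 ℤ.* (m ℤ.* (+ 2 ℤ.* ((1ℤ ℤ.+ j) ℤ.* x))) ≡ (+ 4 ℤ.* ((1ℤ ℤ.+ j) ℤ.* m)) ℤ.* x
    regroup = solve-∀
    room′ : + 4 ℤ.* ((1ℤ ℤ.+ + j) ℤ.* + m) ℤ.≤ + D ℤ.* + D
    room′ = subst₂ ℤ._≤_
      (trans (ℤₚ.pos-* 4 (suc j ℕ.* m)) (cong (ℤ._*_ (+ 4)) (ℤₚ.pos-* (suc j) m))) (ℤₚ.pos-* D D) (ℤ.+≤+ room)
    -- After multiplication by D, the invariant at j replaces c_j by c_{j+1} and `room` bounds the
    -- factor 4 (j + 1) m by D². Thus the subtracted term of the recurrence takes at most half of 2
    -- D c_{j+1}, and the other half is the next invariant.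
    main : + 2 ℤ.* (+ m ℤ.* c j) ℤ.≤ + D ℤ.* c (suc j)
    main = ℤₚ.*-cancelˡ-≤-pos (+ 2 ℤ.* (+ m ℤ.* c j)) (+ D ℤ.* c (suc j)) (+ D) (begin
      + D ℤ.* (+ 2 ℤ.* (+ m ℤ.* c j))
        ≡⟨ swap (+ D) (+ m) (c j) ⟩
      + 2 ℤ.* (+ m ℤ.* (+ D ℤ.* c j))
        ≤⟨ ℤₚ.*-monoˡ-≤-nonNeg (+ 2) (ℤₚ.*-monoˡ-≤-nonNeg (+ m) ratio) ⟩
      + 2 ℤ.* (+ m ℤ.* (+ 2 ℤ.* ((1ℤ ℤ.+ + j) ℤ.* c (suc j))))
        ≡⟨ regroup (+ j) (+ m) (c (suc j)) ⟩
      (+ 4 ℤ.* ((1ℤ ℤ.+ + j) ℤ.* + m)) ℤ.* c (suc j)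
        ≤⟨ ℤₚ.*-monoʳ-≤-nonNeg (c (suc j)) {{ℤ.nonNegative c≥0}} room′ ⟩
      (+ D ℤ.* + D) ℤ.* c (suc j)
        ≡⟨ ℤₚ.*-assoc (+ D) (+ D) (c (suc j)) ⟩
      + D ℤ.* (+ D ℤ.* c (suc j)) ∎)
    recurrence : ∀ D t j m c₂ c₁ c₀ → defect (D ℤ.+ t) t j c₂ c₁ c₀ ≡ 0ℤ → j ℤ.+ m ≡ D ℤ.+ (t ℤ.+ t) →
      + 2 ℤ.* (D ℤ.* c₁) ℤ.- + 2 ℤ.* (m ℤ.* c₀) ≡ + 2 ℤ.* ((1ℤ ℤ.+ (1ℤ ℤ.+ j)) ℤ.* c₂)
    recurrence D t j m c₂ c₁ c₀ zero-defect total = trans (identity D t j m c₂ c₁ c₀)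
      (trans (cong₂ (λ x y → + 2 ℤ.* ((1ℤ ℤ.+ (1ℤ ℤ.+ j)) ℤ.* c₂) ℤ.- + 2 ℤ.* x ℤ.- + 2 ℤ.* (y ℤ.* c₀))
        zero-defect (trans (cong (ℤ._- (D ℤ.+ (t ℤ.+ t))) total) (ℤₚ.+-inverseʳ (D ℤ.+ (t ℤ.+ t)))))
        (clean (+ 2 ℤ.* ((1ℤ ℤ.+ (1ℤ ℤ.+ j)) ℤ.* c₂)) c₀))
      where
      identity : ∀ D t j m c₂ c₁ c₀ → + 2 ℤ.* (D ℤ.* c₁) ℤ.- + 2 ℤ.* (m ℤ.* c₀) ≡
        + 2 ℤ.* ((1ℤ ℤ.+ (1ℤ ℤ.+ j)) ℤ.* c₂)
          ℤ.- + 2 ℤ.* ((+ 2 ℤ.+ j) ℤ.* c₂ ℤ.- (((D ℤ.+ t) ℤ.- t) ℤ.* c₁ ℤ.- ((D ℤ.+ t) ℤ.+ t ℤ.- j) ℤ.* c₀))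
          ℤ.- + 2 ℤ.* (((j ℤ.+ m) ℤ.- (D ℤ.+ (t ℤ.+ t))) ℤ.* c₀)
      identity = solve-∀
      clean : ∀ x y → x ℤ.- + 2 ℤ.* 0ℤ ℤ.- + 2 ℤ.* (0ℤ ℤ.* y) ≡ x
      clean = solve-∀

-- Binomial coefficients, convolutions and the terms of the expansion

pascal : ∀ n k → suc n C suc k ≡ n C k ℕ.+ n C suc k
pascal n k = sym (nCk+nC[k+1]≡[n+1]C[k+1] n k)

C-absorb : ∀ n k → suc k ℕ.* (suc n C suc k) ≡ suc n ℕ.* (n C k)
C-absorb zero    zero    = refl
C-absorb zero    (suc k) = ℕₚ.*-zeroʳ (suc (suc k))
C-absorb (suc n) zero    = trans (ℕₚ.*-identityˡ _) (trans (nC1≡n (suc (suc n))) (sym (ℕₚ.*-identityʳ _)))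
C-absorb (suc n) (suc k) = begin
  suc (suc k) ℕ.* (suc (suc n) C suc (suc k))
    ≡⟨ cong (suc (suc k) ℕ.*_) (pascal (suc n) (suc k)) ⟩
  suc (suc k) ℕ.* (suc n C suc k ℕ.+ suc n C suc (suc k))
    ≡⟨ shuffle (suc k) (suc n C suc k) (suc n C suc (suc k)) ⟩
  suc n C suc k ℕ.+ (suc k ℕ.* (suc n C suc k) ℕ.+ suc (suc k) ℕ.* (suc n C suc (suc k)))
    ≡⟨ cong (suc n C suc k ℕ.+_) (cong₂ ℕ._+_ (C-absorb n k) (C-absorb n (suc k))) ⟩
  suc n C suc k ℕ.+ (suc n ℕ.* (n C k) ℕ.+ suc n ℕ.* (n C suc k))
    ≡⟨ cong (suc n C suc k ℕ.+_) (trans (sym (ℕₚ.*-distribˡ-+ (suc n) (n C k) (n C suc k))) (cong (suc n ℕ.*_) (sym (pascal n k)))) ⟩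
  suc (suc n) ℕ.* (suc n C suc k) ∎
  where
  open ≡-Reasoning
  shuffle : ∀ k x y → suc k ℕ.* (x ℕ.+ y) ≡ x ℕ.+ (k ℕ.* x ℕ.+ suc k ℕ.* y)
  shuffle = solve-∀ℕ

C-mono-n : ∀ n k → n C k ℕ.≤ suc n C k
C-mono-n n zero    = ℕₚ.≤-refl
C-mono-n n (suc k) = subst (n C suc k ℕ.≤_) (sym (pascal n k)) (ℕₚ.m≤n+m _ _)

C-mono-both : ∀ n k → n C k ℕ.≤ suc n C suc k
C-mono-both n k = subst (n C k ℕ.≤_) (sym (pascal n k)) (ℕₚ.m≤m+n _ _)

C-mono : ∀ x y n k → n C k ℕ.≤ (y ℕ.+ (x ℕ.+ n)) C (y ℕ.+ k)
C-mono zero    zero    n k = ℕₚ.≤-refl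
C-mono (suc x) zero    n k = ℕₚ.≤-trans (C-mono x zero n k) (C-mono-n (x ℕ.+ n) k)
C-mono x       (suc y) n k = ℕₚ.≤-trans (C-mono x y n k) (C-mono-both (y ℕ.+ (x ℕ.+ n)) (y ℕ.+ k))

L²≤2C : ∀ L → L ℕ.* L ℕ.≤ 2 ℕ.* ((2 ℕ.+ L) C 2)
L²≤2C zero    = ℕ.z≤n
L²≤2C (suc L) = begin
  suc L ℕ.* suc L                                   ≤⟨ ℕₚ.m≤m+n _ 3 ⟩
  suc L ℕ.* suc L ℕ.+ 3                             ≡⟨ shuffle L ⟩
  2 ℕ.* (2 ℕ.+ L) ℕ.+ L ℕ.* L                       ≤⟨ ℕₚ.+-monoʳ-≤ (2 ℕ.* (2 ℕ.+ L)) (L²≤2C L) ⟩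
  2 ℕ.* (2 ℕ.+ L) ℕ.+ 2 ℕ.* ((2 ℕ.+ L) C 2)         ≡⟨ sym (ℕₚ.*-distribˡ-+ 2 (2 ℕ.+ L) ((2 ℕ.+ L) C 2)) ⟩
  2 ℕ.* ((2 ℕ.+ L) ℕ.+ ((2 ℕ.+ L) C 2))             ≡⟨ cong (λ x → 2 ℕ.* (x ℕ.+ ((2 ℕ.+ L) C 2))) (sym (nC1≡n (2 ℕ.+ L))) ⟩
  2 ℕ.* ((2 ℕ.+ L) C 1 ℕ.+ ((2 ℕ.+ L) C 2))         ≡⟨ cong (2 ℕ.*_) (sym (pascal (2 ℕ.+ L) 1)) ⟩
  2 ℕ.* ((3 ℕ.+ L) C 2) ∎
  where
  open ℕₚ.≤-Reasoning
  shuffle : ∀ L → suc L ℕ.* suc L ℕ.+ 3 ≡ 2 ℕ.* (2 ℕ.+ L) ℕ.+ L ℕ.* L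
  shuffle = solve-∀ℕ

conv : (ℕ → ℕ) → (ℕ → ℕ) → ℕ → ℕ
conv f g zero    = f 0 ℕ.* g 0
conv f g (suc s) = f 0 ℕ.* g (suc s) ℕ.+ conv (f ∘ suc) g s

conv-+ : ∀ f f′ g s → conv (λ j → f j ℕ.+ f′ j) g s ≡ conv f g s ℕ.+ conv f′ g s
conv-+ f f′ g zero    = ℕₚ.*-distribʳ-+ (g 0) (f 0) (f′ 0)
conv-+ f f′ g (suc s) = trans (cong₂ ℕ._+_ (ℕₚ.*-distribʳ-+ (g (suc s)) (f 0) (f′ 0)) (conv-+ (f ∘ suc) (f′ ∘ suc) g s))
  (shuffle (f 0 ℕ.* g (suc s)) (f′ 0 ℕ.* g (suc s)) (conv (f ∘ suc) g s) (conv (f′ ∘ suc) g s))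
  where
  shuffle : ∀ a b c d → (a ℕ.+ b) ℕ.+ (c ℕ.+ d) ≡ (a ℕ.+ c) ℕ.+ (b ℕ.+ d)
  shuffle = solve-∀ℕ

conv-cong : ∀ {f f′} g s → (∀ j → f j ≡ f′ j) → conv f g s ≡ conv f′ g s
conv-cong g zero    eq = cong (ℕ._* g 0) (eq 0)
conv-cong g (suc s) eq = cong₂ ℕ._+_ (cong (ℕ._* g (suc s)) (eq 0)) (conv-cong g s (eq ∘ suc))

conv-zero : ∀ g s → conv (λ _ → 0) g s ≡ 0
conv-zero g zero    = refl
conv-zero g (suc s) = conv-zero g s

vandermonde : ∀ a b k → conv (a C_) (b C_) k ≡ (a ℕ.+ b) C k
vandermonde zero    b zero    = refl
vandermonde zero    b (suc k) = trans (cong₂ ℕ._+_ (ℕₚ.*-identityˡ (b C suc k)) (conv-zero (b C_) k)) (ℕₚ.+-identityʳ _)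
vandermonde (suc a) b zero    = refl
vandermonde (suc a) b (suc k) = begin
  1 ℕ.* (b C suc k) ℕ.+ conv (λ j → suc a C suc j) (b C_) k
    ≡⟨ cong (1 ℕ.* (b C suc k) ℕ.+_) (trans (conv-cong (b C_) k (pascal a)) (conv-+ (a C_) (λ j → a C suc j) (b C_) k)) ⟩
  1 ℕ.* (b C suc k) ℕ.+ (conv (a C_) (b C_) k ℕ.+ conv (λ j → a C suc j) (b C_) k)
    ≡⟨ shuffle (1 ℕ.* (b C suc k)) (conv (a C_) (b C_) k) (conv (λ j → a C suc j) (b C_) k) ⟩
  conv (a C_) (b C_) k ℕ.+ conv (a C_) (b C_) (suc k)
    ≡⟨ cong₂ ℕ._+_ (vandermonde a b k) (vandermonde a b (suc k)) ⟩
  (a ℕ.+ b) C k ℕ.+ (a ℕ.+ b) C suc k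
    ≡⟨ sym (pascal (a ℕ.+ b) k) ⟩
  suc (a ℕ.+ b) C suc k ∎
  where
  open ≡-Reasoning
  shuffle : ∀ x y z → x ℕ.+ (y ℕ.+ z) ≡ y ℕ.+ (x ℕ.+ z)
  shuffle = solve-∀ℕ

conv-term : ∀ f g j i → f j ℕ.* g i ℕ.≤ conv f g (j ℕ.+ i)
conv-term f g zero    zero    = ℕₚ.≤-refl
conv-term f g zero    (suc i) = ℕₚ.m≤m+n _ _
conv-term f g (suc j) i       = ℕₚ.≤-trans (conv-term (f ∘ suc) g j i) (ℕₚ.m≤n+m _ _)

conv-even : ∀ f g s → conv (f ∘ double) (g ∘ double) s ℕ.≤ conv f g (double s)
conv-even f g zero    = ℕₚ.≤-refl
conv-even f g (suc s) = ℕₚ.+-monoʳ-≤ (f 0 ℕ.* g (double (suc s)))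
  (ℕₚ.≤-trans (conv-even (f ∘ suc ∘ suc) g s) (ℕₚ.m≤n+m _ _))

conv-mono : ∀ {f f′} g s → (∀ j → j ℕ.≤ s → f j ℕ.≤ f′ j) → conv f g s ℕ.≤ conv f′ g s
conv-mono g zero    h = ℕₚ.*-monoˡ-≤ (g 0) (h 0 ℕ.z≤n)
conv-mono g (suc s) h = ℕₚ.+-mono-≤ (ℕₚ.*-monoˡ-≤ (g (suc s)) (h 0 ℕ.z≤n)) (conv-mono g s (λ j j≤s → h (suc j) (ℕ.s≤s j≤s)))

conv-*ˡ : ∀ c f g s → conv (λ j → c ℕ.* f j) g s ≡ c ℕ.* conv f g s
conv-*ˡ c f g zero    = ℕₚ.*-assoc c (f 0) (g 0)
conv-*ˡ c f g (suc s) = trans (cong₂ ℕ._+_ (ℕₚ.*-assoc c (f 0) (g (suc s))) (conv-*ˡ c (f ∘ suc) g s))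
  (sym (ℕₚ.*-distribˡ-+ c (f 0 ℕ.* g (suc s)) (conv (f ∘ suc) g s)))

-- A single term of Vandermonde's sum.
C²≤C : ∀ t j → (t C j) ℕ.* (t C j) ℕ.≤ (t ℕ.+ t) C double j
C²≤C t j = subst ((t C j) ℕ.* (t C j) ℕ.≤_)
  (trans (vandermonde t t (j ℕ.+ j)) (cong ((t ℕ.+ t) C_) (sym (double≡ j))))
  (conv-term (t C_) (t C_) j j)

-- Pascal's triangle grows along (n, k) → (n + 1, k) and (n + 1, k + 1); such steps lead from (2 +
-- L, 2) to every (t, k) with 2 ≤ k ≤ t - L.
C-large : ∀ L x s j → j ℕ.≤ s → (2 ℕ.+ L) C 2 ℕ.≤ (2 ℕ.+ (s ℕ.+ (L ℕ.+ x))) C (2 ℕ.+ j)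
C-large L x s j j≤s with ℕₚ.m≤n⇒∃[o]m+o≡n j≤s
... | o , refl = subst₂ (λ n k → (2 ℕ.+ L) C 2 ℕ.≤ n C k) (shuffle j o L x) (ℕₚ.+-comm j 2) (C-mono (o ℕ.+ x) j (2 ℕ.+ L) 2)
  where
  shuffle : ∀ j o L x → j ℕ.+ ((o ℕ.+ x) ℕ.+ (2 ℕ.+ L)) ≡ 2 ℕ.+ ((j ℕ.+ o) ℕ.+ (L ℕ.+ x))
  shuffle = solve-∀ℕ

-- C(t,j) ≥ 2m for 2 ≤ j ≤ s + 2, so the tail is dominated by C(t,j)² ≤ C(2t,2j).
tail-bound : ∀ D L x s m t → t ≡ 2 ℕ.+ (s ℕ.+ (L ℕ.+ x)) → 2 ℕ.* m ℕ.≤ (2 ℕ.+ L) C 2 →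
  2 ℕ.* m ℕ.* conv (λ j → t C (2 ℕ.+ j)) (λ i → D C double i) s ℕ.≤ (t ℕ.+ t ℕ.+ D) C double (2 ℕ.+ s)
tail-bound D L x s m t t≡ large = begin
  2 ℕ.* m ℕ.* conv (λ j → t C (2 ℕ.+ j)) gD s
    ≡⟨ sym (conv-*ˡ (2 ℕ.* m) (λ j → t C (2 ℕ.+ j)) gD s) ⟩
  conv (λ j → 2 ℕ.* m ℕ.* (t C (2 ℕ.+ j))) gD s
    ≤⟨ conv-mono gD s (λ j j≤s → ℕₚ.≤-trans (ℕₚ.*-monoˡ-≤ (t C (2 ℕ.+ j)) (big j j≤s)) (C²≤C t (2 ℕ.+ j))) ⟩
  conv (λ j → (t ℕ.+ t) C double (2 ℕ.+ j)) gD s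
    -- The terms j = 0 and j = 1 are put back, so that Vandermonde's sum becomes available.
    ≤⟨ ℕₚ.≤-trans (ℕₚ.m≤n+m _ _) (ℕₚ.m≤n+m _ (((t ℕ.+ t) C 0) ℕ.* gD (2 ℕ.+ s))) ⟩
  conv (λ j → (t ℕ.+ t) C double j) gD (2 ℕ.+ s)
    ≤⟨ conv-even ((t ℕ.+ t) C_) (D C_) (2 ℕ.+ s) ⟩
  conv ((t ℕ.+ t) C_) (D C_) (double (2 ℕ.+ s))
    ≡⟨ vandermonde (t ℕ.+ t) D (double (2 ℕ.+ s)) ⟩
  (t ℕ.+ t ℕ.+ D) C double (2 ℕ.+ s) ∎
  where
  open ℕₚ.≤-Reasoning
  gD : ℕ → ℕ
  gD i = D C double i
  big : ∀ j → j ℕ.≤ s → 2 ℕ.* m ℕ.≤ t C (2 ℕ.+ j)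
  big j j≤s = subst (λ z → 2 ℕ.* m ℕ.≤ z C (2 ℕ.+ j)) (sym t≡) (ℕₚ.≤-trans large (C-large L x s j j≤s))

-- The term j = 1 of the expansion of (1 + x)^D (1 − x²)^t, for D + 2t = 2 + m.
first-bound : ∀ D t m k → t ℕ.+ t ℕ.≤ 2 ℕ.+ m → (2 ℕ.+ k) ℕ.* (1 ℕ.+ k) ℕ.* (D C k) ℕ.≤ m C k →
  2 ℕ.* suc m ℕ.* (t ℕ.* (D C k)) ℕ.≤ (2 ℕ.+ m) C (2 ℕ.+ k)
first-bound D t m k 2t≤n h = ℕₚ.*-cancelˡ-≤ ((2 ℕ.+ k) ℕ.* (1 ℕ.+ k)) (begin
  (2 ℕ.+ k) ℕ.* (1 ℕ.+ k) ℕ.* (2 ℕ.* suc m ℕ.* (t ℕ.* (D C k)))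
    ≡⟨ shuffle ((2 ℕ.+ k) ℕ.* (1 ℕ.+ k)) (suc m) t (D C k) ⟩
  (t ℕ.+ t) ℕ.* suc m ℕ.* ((2 ℕ.+ k) ℕ.* (1 ℕ.+ k) ℕ.* (D C k))
    ≤⟨ ℕₚ.*-mono-≤ (ℕₚ.*-monoˡ-≤ (suc m) 2t≤n) h ⟩
  (2 ℕ.+ m) ℕ.* suc m ℕ.* (m C k)
    ≡⟨ ℕₚ.*-assoc (2 ℕ.+ m) (suc m) (m C k) ⟩
  (2 ℕ.+ m) ℕ.* (suc m ℕ.* (m C k))
    ≡⟨ cong ((2 ℕ.+ m) ℕ.*_) (sym (C-absorb m k)) ⟩
  (2 ℕ.+ m) ℕ.* (suc k ℕ.* (suc m C suc k))
    ≡⟨ swap (2 ℕ.+ m) (suc k) (suc m C suc k) ⟩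
  suc k ℕ.* ((2 ℕ.+ m) ℕ.* (suc m C suc k))
    ≡⟨ cong (suc k ℕ.*_) (sym (C-absorb (suc m) (suc k))) ⟩
  suc k ℕ.* ((2 ℕ.+ k) ℕ.* ((2 ℕ.+ m) C (2 ℕ.+ k)))
    ≡⟨ swap′ (suc k) (2 ℕ.+ k) ((2 ℕ.+ m) C (2 ℕ.+ k)) ⟩
  (2 ℕ.+ k) ℕ.* (1 ℕ.+ k) ℕ.* ((2 ℕ.+ m) C (2 ℕ.+ k)) ∎)
  where
  open ℕₚ.≤-Reasoning
  shuffle : ∀ a m t x → a ℕ.* (2 ℕ.* m ℕ.* (t ℕ.* x)) ≡ (t ℕ.+ t) ℕ.* m ℕ.* (a ℕ.* x)
  shuffle = solve-∀ℕ
  swap : ∀ x y z → x ℕ.* (y ℕ.* z) ≡ y ℕ.* (x ℕ.* z)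
  swap = solve-∀ℕ
  swap′ : ∀ x y z → x ℕ.* (y ℕ.* z) ≡ y ℕ.* x ℕ.* z
  swap′ = solve-∀ℕ

-- A lower bound from (1 + x)^D (1 - x²)^t

kr-binomial : ∀ n k → kr n 0 k ≡ + (n C k)
kr-binomial zero    zero    = refl
kr-binomial zero    (suc k) = refl
kr-binomial (suc n) zero    = kr-binomial n 0
kr-binomial (suc n) (suc k) = trans (cong₂ ℤ._+_ (kr-binomial n (suc k)) (kr-binomial n k))
  (cong +_ (trans (ℕₚ.+-comm (n C suc k) (n C k)) (sym (pascal n k))))

convℤ : (ℕ → ℤ) → (ℕ → ℕ) → ℕ → ℤ
convℤ f g zero    = f 0 ℤ.* + g 0
convℤ f g (suc s) = f 0 ℤ.* + g (suc s) ℤ.+ convℤ (f ∘ suc) g s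

convℤ-minus : ∀ f f′ g s → convℤ (λ j → f j ℤ.- f′ j) g s ≡ convℤ f g s ℤ.- convℤ f′ g s
convℤ-minus f f′ g zero    = shuffle (f 0) (f′ 0) (+ g 0)
  where
  shuffle : ∀ x y z → (x ℤ.- y) ℤ.* z ≡ x ℤ.* z ℤ.- y ℤ.* z
  shuffle = solve-∀
convℤ-minus f f′ g (suc s) = trans (cong (ℤ._+_ ((f 0 ℤ.- f′ 0) ℤ.* + g (suc s))) (convℤ-minus (f ∘ suc) (f′ ∘ suc) g s))
  (shuffle (f 0) (f′ 0) (+ g (suc s)) (convℤ (f ∘ suc) g s) (convℤ (f′ ∘ suc) g s))
  where
  shuffle : ∀ x y z u v → (x ℤ.- y) ℤ.* z ℤ.+ (u ℤ.- v) ≡ (x ℤ.* z ℤ.+ u) ℤ.- (y ℤ.* z ℤ.+ v)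
  shuffle = solve-∀

convℤ-≼ : ∀ {f f′} g s → (∀ j → f j ≼ + f′ j) → convℤ f g s ≼ + conv f′ g s
convℤ-≼ {f} {f′} g zero    h = subst (f 0 ℤ.* + g 0 ≼_) (sym (ℤₚ.pos-* (f′ 0) (g 0))) (≼-* (h 0) (≼-refl {+ g 0} (ℤ.+≤+ ℕ.z≤n)))
convℤ-≼ {f} {f′} g (suc s) h = ≼-+
  (subst (f 0 ℤ.* + g (suc s) ≼_) (sym (ℤₚ.pos-* (f′ 0) (g (suc s)))) (≼-* (h 0) (≼-refl {+ g (suc s)} (ℤ.+≤+ ℕ.z≤n))))
  (convℤ-≼ g s (h ∘ suc))

convℤ-zero : ∀ g s → convℤ (λ _ → 0ℤ) g s ≡ 0ℤ
convℤ-zero g zero    = ℤₚ.*-zeroˡ (+ g 0)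
convℤ-zero g (suc s) = cong₂ ℤ._+_ (ℤₚ.*-zeroˡ (+ g (suc s))) (convℤ-zero g s)

-- (1 + x)^{D+t} (1 − x)^t = (1 + x)^D (1 − x²)^t
kr-conv : ∀ D t s → kr (D ℕ.+ t) t (double s) ≡ convℤ (kr 0 t) (λ i → D C double i) s
kr-conv D zero s = trans (cong (λ a → kr a 0 (double s)) (ℕₚ.+-identityʳ D)) (trans (kr-binomial D (double s)) (sym (only-first s)))
  where
  only-first : ∀ s → convℤ (kr 0 0) (λ i → D C double i) s ≡ + (D C double s)
  only-first zero    = refl
  only-first (suc s) = trans (cong₂ ℤ._+_ (ℤₚ.*-identityˡ (+ (D C double (suc s)))) (convℤ-zero (λ i → D C double i) s)) (ℤₚ.+-identityʳ _)
kr-conv D (suc t) zero = trans (kr-0 (D ℕ.+ suc t) (suc t)) (sym (cong (ℤ._* 1ℤ) (kr-0 0 (suc t))))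
kr-conv D (suc t) (suc s) = begin
  kr (D ℕ.+ suc t) (suc t) (double (suc s))
    ≡⟨ cong (λ a → kr a (suc t) (double (suc s))) (ℕₚ.+-suc D t) ⟩
  kr a (suc t) (suc (suc k)) ℤ.+ kr a (suc t) (suc k)
    ≡⟨ cong₂ ℤ._+_ (kr-sucʳ a t (suc k)) (kr-sucʳ a t k) ⟩
  (kr a t (suc (suc k)) ℤ.- kr a t (suc k)) ℤ.+ (kr a t (suc k) ℤ.- kr a t k)
    ≡⟨ telescope (kr a t (suc (suc k))) (kr a t (suc k)) (kr a t k) ⟩
  kr a t (suc (suc k)) ℤ.- kr a t k
    ≡⟨ cong₂ ℤ._-_ (kr-conv D t (suc s)) (kr-conv D t s) ⟩
  (kr 0 t 0 ℤ.* + gD (suc s) ℤ.+ convℤ (kr 0 t ∘ suc) gD s) ℤ.- convℤ (kr 0 t) gD s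
    ≡⟨ assoc (kr 0 t 0 ℤ.* + gD (suc s)) (convℤ (kr 0 t ∘ suc) gD s) (convℤ (kr 0 t) gD s) ⟩
  kr 0 t 0 ℤ.* + gD (suc s) ℤ.+ (convℤ (kr 0 t ∘ suc) gD s ℤ.- convℤ (kr 0 t) gD s)
    ≡⟨ cong (ℤ._+_ (kr 0 t 0 ℤ.* + gD (suc s))) (sym (convℤ-minus (kr 0 t ∘ suc) (kr 0 t) gD s)) ⟩
  convℤ (kr 0 (suc t)) gD (suc s) ∎
  where
  open ≡-Reasoning
  a = D ℕ.+ t
  k = double s
  gD : ℕ → ℕ
  gD i = D C double i
  telescope : ∀ x y z → (x ℤ.- y) ℤ.+ (y ℤ.- z) ≡ x ℤ.- z
  telescope = solve-∀
  assoc : ∀ x y z → (x ℤ.+ y) ℤ.- z ≡ x ℤ.+ (y ℤ.- z)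
  assoc = solve-∀

kr0-≼ : ∀ t j → kr 0 t j ≼ + (t C j)
kr0-≼ t j = subst₂ _≼_ (sym (kr-flip 0 t j)) refl
  (≼-sgn j (subst (_≼ + (t C j)) (sym (kr-binomial t j)) (≼-refl {+ (t C j)} (ℤ.+≤+ ℕ.z≤n))))

kr-lower : ∀ D t s →
  ℤ.- + (t ℕ.* (D C double (suc s)) ℕ.+ conv (λ j → t C (2 ℕ.+ j)) (λ i → D C double i) s)
    ℤ.≤ kr (D ℕ.+ t) t (double (2 ℕ.+ s))
kr-lower D t s = begin
  ℤ.- (+ (t ℕ.* y) ℤ.+ + z)
    ≡⟨ ℤₚ.neg-distrib-+ (+ (t ℕ.* y)) (+ z) ⟩
  ℤ.- + (t ℕ.* y) ℤ.+ ℤ.- + z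
    ≤⟨ ℤₚ.+-mono-≤ (ℤₚ.≤-reflexive first) last ⟩
  kr 0 t 1 ℤ.* + y ℤ.+ convℤ (λ j → kr 0 t (2 ℕ.+ j)) gD s
    ≡⟨ sym (ℤₚ.+-identityˡ _) ⟩
  0ℤ ℤ.+ (kr 0 t 1 ℤ.* + y ℤ.+ convℤ (λ j → kr 0 t (2 ℕ.+ j)) gD s)
    ≤⟨ ℤₚ.+-monoˡ-≤ (kr 0 t 1 ℤ.* + y ℤ.+ convℤ (λ j → kr 0 t (2 ℕ.+ j)) gD s) zeroth ⟩
  convℤ (kr 0 t) gD (2 ℕ.+ s)
    ≡⟨ sym (kr-conv D t (2 ℕ.+ s)) ⟩
  kr (D ℕ.+ t) t (double (2 ℕ.+ s)) ∎
  where
  open ℤₚ.≤-Reasoning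
  gD : ℕ → ℕ
  gD i = D C double i
  y = D C double (suc s)
  z = conv (λ j → t C (2 ℕ.+ j)) gD s
  flip-neg : ∀ x y → ℤ.- (x ℤ.* y) ≡ (0ℤ ℤ.- x) ℤ.* y
  flip-neg = solve-∀
  first : ℤ.- + (t ℕ.* y) ≡ kr 0 t 1 ℤ.* + y
  first = trans (cong ℤ.-_ (ℤₚ.pos-* t y)) (trans (flip-neg (+ t) (+ y)) (cong (ℤ._* + y) (sym (kr-1 0 t))))
  last : ℤ.- + z ℤ.≤ convℤ (λ j → kr 0 t (2 ℕ.+ j)) gD s
  last = subst (ℤ.- + z ℤ.≤_) (ℤₚ.neg-involutive _)
    (ℤₚ.neg-mono-≤ (proj₂ (convℤ-≼ gD s (λ j → kr0-≼ t (2 ℕ.+ j)))))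
  zeroth : 0ℤ ℤ.≤ kr 0 t 0 ℤ.* + gD (2 ℕ.+ s)
  zeroth = subst (λ x → 0ℤ ℤ.≤ x ℤ.* + gD (2 ℕ.+ s)) (sym (kr-0 0 t)) (0≤* {1ℤ} {+ gD (2 ℕ.+ s)} (ℤ.+≤+ ℕ.z≤n) (ℤ.+≤+ ℕ.z≤n))

-- Multiplied by n - 1, the term j = 1 and the tail take at most half of the binomial coefficient
-- each. L is a lower bound for the excess of t over the half-degree 2 + s, and 4(n - 1) ≤ L² gives
-- 2(n - 1) ≤ C(L + 2, 2).
kr-small : ∀ D t s m L x → D ℕ.+ (t ℕ.+ t) ≡ 2 ℕ.+ m → t ≡ 2 ℕ.+ (s ℕ.+ (L ℕ.+ x)) → 4 ℕ.* suc m ℕ.≤ L ℕ.* L →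
  (2 ℕ.+ double (suc s)) ℕ.* (1 ℕ.+ double (suc s)) ℕ.* (D C double (suc s)) ℕ.≤ m C double (suc s) →
  ℤ.- + ((2 ℕ.+ m) C double (2 ℕ.+ s)) ℤ.≤ + suc m ℤ.* kr (D ℕ.+ t) t (double (2 ℕ.+ s))
kr-small D t s m L x total t≡ large h = begin
  ℤ.- + ((2 ℕ.+ m) C double (2 ℕ.+ s))
    ≤⟨ ℤₚ.neg-mono-≤ (ℤ.+≤+ half) ⟩
  ℤ.- + (suc m ℕ.* (y ℕ.+ z))
    ≡⟨ cong ℤ.-_ (ℤₚ.pos-* (suc m) (y ℕ.+ z)) ⟩
  ℤ.- (+ suc m ℤ.* + (y ℕ.+ z))
    ≡⟨ ℤₚ.neg-distribʳ-* (+ suc m) (+ (y ℕ.+ z)) ⟩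
  + suc m ℤ.* (ℤ.- + (y ℕ.+ z))
    ≤⟨ ℤₚ.*-monoˡ-≤-nonNeg (+ suc m) (kr-lower D t s) ⟩
  + suc m ℤ.* kr (D ℕ.+ t) t (double (2 ℕ.+ s)) ∎
  where
  open ℤₚ.≤-Reasoning
  y = t ℕ.* (D C double (suc s))
  z = conv (λ j → t C (2 ℕ.+ j)) (λ i → D C double i) s
  N = (2 ℕ.+ m) C double (2 ℕ.+ s)
  quad : ∀ m → 4 ℕ.* m ≡ 2 ℕ.* (2 ℕ.* m)
  quad = solve-∀ℕ
  2m≤ : 2 ℕ.* suc m ℕ.≤ (2 ℕ.+ L) C 2
  2m≤ = ℕₚ.*-cancelˡ-≤ 2 (ℕₚ.≤-trans (subst (ℕ._≤ L ℕ.* L) (quad (suc m)) large) (L²≤2C L))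
  first : 2 ℕ.* suc m ℕ.* y ℕ.≤ N
  first = first-bound D t m (double (suc s)) (subst (t ℕ.+ t ℕ.≤_) total (ℕₚ.m≤n+m (t ℕ.+ t) D)) h
  second : 2 ℕ.* suc m ℕ.* z ℕ.≤ N
  second = subst (λ n → 2 ℕ.* suc m ℕ.* z ℕ.≤ n C double (2 ℕ.+ s)) (trans (ℕₚ.+-comm (t ℕ.+ t) D) total)
    (tail-bound D L x s (suc m) t t≡ 2m≤)
  add : ∀ m y z → 2 ℕ.* m ℕ.* y ℕ.+ 2 ℕ.* m ℕ.* z ≡ 2 ℕ.* (m ℕ.* (y ℕ.+ z))
  add = solve-∀ℕ
  twice : ∀ n → n ℕ.+ n ≡ 2 ℕ.* n
  twice = solve-∀ℕ
  half : suc m ℕ.* (y ℕ.+ z) ℕ.≤ N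
  half = ℕₚ.*-cancelˡ-≤ 2 (subst₂ ℕ._≤_ (add (suc m) y z) (twice N) (ℕₚ.+-mono-≤ first second))

-- The Krawtchouk bound in both regimes

-- The quotient of the binomials is a product of (D - i)/(X - i). As p ≤ q, the bound D/X ≤ p/q
-- passes to D - 1 and X - 1, so every factor is at most p/q.
C-ratio : ∀ p q .{{_ : ℕ.NonZero q}} → p ℕ.≤ q → ∀ j D X → D ℕ.* q ℕ.≤ p ℕ.* X → (D C j) ℕ.* q ℕ.^ j ℕ.≤ p ℕ.^ j ℕ.* (X C j)
C-ratio p q p≤q zero    D       X       h = ℕₚ.≤-refl
C-ratio p q p≤q (suc j) zero    X       h = ℕ.z≤n
C-ratio p q p≤q (suc j) (suc D) zero    h = ⊥-elim (ℕₚ.<⇒≱ (ℕ.>-nonZero⁻¹ (suc D ℕ.* q) {{ℕₚ.m*n≢0 (suc D) q}}) (subst (suc D ℕ.* q ℕ.≤_) (ℕₚ.*-zeroʳ p) h))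
C-ratio p q p≤q (suc j) (suc D) (suc X) h = ℕₚ.*-cancelˡ-≤ (suc j) (begin
  suc j ℕ.* ((suc D C suc j) ℕ.* (q ℕ.* q ℕ.^ j))
    ≡⟨ shuffle (suc j) (suc D C suc j) q (q ℕ.^ j) ⟩
  suc j ℕ.* (suc D C suc j) ℕ.* q ℕ.* q ℕ.^ j
    ≡⟨ cong (λ z → z ℕ.* q ℕ.* q ℕ.^ j) (C-absorb D j) ⟩
  suc D ℕ.* (D C j) ℕ.* q ℕ.* q ℕ.^ j
    ≡⟨ shuffle′ (suc D) (D C j) q (q ℕ.^ j) ⟩
  suc D ℕ.* q ℕ.* ((D C j) ℕ.* q ℕ.^ j)
    ≤⟨ ℕₚ.*-mono-≤ h (C-ratio p q p≤q j D X h′) ⟩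
  p ℕ.* suc X ℕ.* (p ℕ.^ j ℕ.* (X C j))
    ≡⟨ shuffle″ p (suc X) (p ℕ.^ j) (X C j) ⟩
  p ℕ.* p ℕ.^ j ℕ.* (suc X ℕ.* (X C j))
    ≡⟨ cong (p ℕ.* p ℕ.^ j ℕ.*_) (sym (C-absorb X j)) ⟩
  p ℕ.* p ℕ.^ j ℕ.* (suc j ℕ.* (suc X C suc j))
    ≡⟨ swap (p ℕ.* p ℕ.^ j) (suc j) (suc X C suc j) ⟩
  suc j ℕ.* (p ℕ.* p ℕ.^ j ℕ.* (suc X C suc j)) ∎)
  where
  open ℕₚ.≤-Reasoning
  h′ : D ℕ.* q ℕ.≤ p ℕ.* X
  h′ = ℕₚ.+-cancelˡ-≤ q (D ℕ.* q) (p ℕ.* X) (ℕₚ.≤-trans (subst (q ℕ.+ D ℕ.* q ℕ.≤_) (ℕₚ.*-suc p X) h) (ℕₚ.+-monoˡ-≤ (p ℕ.* X) p≤q))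
  shuffle : ∀ j x q y → j ℕ.* (x ℕ.* (q ℕ.* y)) ≡ j ℕ.* x ℕ.* q ℕ.* y
  shuffle = solve-∀ℕ
  shuffle′ : ∀ d x q y → d ℕ.* x ℕ.* q ℕ.* y ≡ d ℕ.* q ℕ.* (x ℕ.* y)
  shuffle′ = solve-∀ℕ
  shuffle″ : ∀ p x y z → p ℕ.* x ℕ.* (y ℕ.* z) ≡ p ℕ.* y ℕ.* (x ℕ.* z)
  shuffle″ = solve-∀ℕ
  swap : ∀ x y z → x ℕ.* (y ℕ.* z) ≡ y ℕ.* (x ℕ.* z)
  swap = solve-∀ℕ

C-ratio-small : ∀ p q .{{_ : ℕ.NonZero q}} → p ℕ.≤ q → ∀ c j D X → D ℕ.* q ℕ.≤ p ℕ.* X → c ℕ.* p ℕ.^ j ℕ.≤ q ℕ.^ j →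
  c ℕ.* (D C j) ℕ.≤ X C j
C-ratio-small p q p≤q c j D X h small = ℕₚ.*-cancelˡ-≤ (q ℕ.^ j) {{ℕₚ.m^n≢0 q j}} (begin
  q ℕ.^ j ℕ.* (c ℕ.* (D C j))   ≡⟨ shuffle (q ℕ.^ j) c (D C j) ⟩
  c ℕ.* ((D C j) ℕ.* q ℕ.^ j)   ≤⟨ ℕₚ.*-monoʳ-≤ c (C-ratio p q p≤q j D X h) ⟩
  c ℕ.* (p ℕ.^ j ℕ.* (X C j))   ≡⟨ sym (ℕₚ.*-assoc c (p ℕ.^ j) (X C j)) ⟩
  c ℕ.* p ℕ.^ j ℕ.* (X C j)     ≤⟨ ℕₚ.*-monoˡ-≤ (X C j) small ⟩
  q ℕ.^ j ℕ.* (X C j) ∎)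
  where
  open ℕₚ.≤-Reasoning
  shuffle : ∀ x y z → x ℕ.* (y ℕ.* z) ≡ y ℕ.* (z ℕ.* x)
  shuffle = solve-∀ℕ

-- The degree is n = 2 + m, so that suc m stands for n − 1.
KrawtchoukBound : (m k : ℕ) → Set
KrawtchoukBound m k = ∀ p q → p ℕ.+ q ≡ 2 ℕ.+ m → ℤ.- + ((2 ℕ.+ m) C k) ℤ.≤ + suc m ℤ.* kr p q k

bound-by-symmetry : ∀ m s → (∀ D t → D ℕ.+ (t ℕ.+ t) ≡ 2 ℕ.+ m →
    ℤ.- + ((2 ℕ.+ m) C double s) ℤ.≤ + suc m ℤ.* kr (D ℕ.+ t) t (double s)) →
  KrawtchoukBound m (double s)
bound-by-symmetry m s h p q p+q with ℕₚ.≤-total q p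
... | inj₁ q≤p with ℕₚ.m≤n⇒∃[o]m+o≡n q≤p
...   | D , refl = subst (λ a → ℤ.- + ((2 ℕ.+ m) C double s) ℤ.≤ + suc m ℤ.* kr a q (double s)) (ℕₚ.+-comm D q)
        (h D q (trans (shuffle D q) p+q))
  where
  shuffle : ∀ D q → D ℕ.+ (q ℕ.+ q) ≡ q ℕ.+ D ℕ.+ q
  shuffle = solve-∀ℕ
bound-by-symmetry m s h p q p+q | inj₂ p≤q with ℕₚ.m≤n⇒∃[o]m+o≡n p≤q
...   | D , refl = subst (λ a → ℤ.- + ((2 ℕ.+ m) C double s) ℤ.≤ + suc m ℤ.* a)
        (trans (cong (λ a → kr a p (double s)) (ℕₚ.+-comm D p)) (kr-sym (p ℕ.+ D) p s))
        (h D p (trans (shuffle D p) p+q))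
  where
  shuffle : ∀ D p → D ℕ.+ (p ℕ.+ p) ≡ p ℕ.+ (p ℕ.+ D)
  shuffle = solve-∀ℕ

nonneg⇒bound : ∀ m k {x} → 0ℤ ℤ.≤ x → ℤ.- + k ℤ.≤ + suc m ℤ.* x
nonneg⇒bound m k p = ℤₚ.≤-trans (ℤₚ.neg-mono-≤ (ℤ.+≤+ {0} {k} ℕ.z≤n)) (0≤* {+ suc m} (ℤ.+≤+ ℕ.z≤n) p)

-- The quadratic factor is the one that `first-bound` demands; (p/q)^j, from `C-ratio`, has to beat
-- it.
Decay : (p q j : ℕ) → Set
Decay p q j = (2 ℕ.+ j) ℕ.* (1 ℕ.+ j) ℕ.* p ℕ.^ j ℕ.≤ q ℕ.^ j

decay-suc : ∀ p q j → (3 ℕ.+ j) ℕ.* p ℕ.≤ q ℕ.* (1 ℕ.+ j) → Decay p q j → Decay p q (suc j)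
decay-suc p q j step decay = begin
  (3 ℕ.+ j) ℕ.* (2 ℕ.+ j) ℕ.* (p ℕ.* p ℕ.^ j)       ≡⟨ shuffle (3 ℕ.+ j) (2 ℕ.+ j) p (p ℕ.^ j) ⟩
  (3 ℕ.+ j) ℕ.* p ℕ.* ((2 ℕ.+ j) ℕ.* p ℕ.^ j)       ≤⟨ ℕₚ.*-monoˡ-≤ ((2 ℕ.+ j) ℕ.* p ℕ.^ j) step ⟩
  q ℕ.* (1 ℕ.+ j) ℕ.* ((2 ℕ.+ j) ℕ.* p ℕ.^ j)       ≡⟨ shuffle′ q (1 ℕ.+ j) (2 ℕ.+ j) (p ℕ.^ j) ⟩
  q ℕ.* ((2 ℕ.+ j) ℕ.* (1 ℕ.+ j) ℕ.* p ℕ.^ j)       ≤⟨ ℕₚ.*-monoʳ-≤ q decay ⟩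
  q ℕ.* q ℕ.^ j ∎
  where
  open ℕₚ.≤-Reasoning
  shuffle : ∀ x y p z → x ℕ.* y ℕ.* (p ℕ.* z) ≡ x ℕ.* p ℕ.* (y ℕ.* z)
  shuffle = solve-∀ℕ
  shuffle′ : ∀ q x y z → q ℕ.* x ℕ.* (y ℕ.* z) ≡ q ℕ.* (y ℕ.* x ℕ.* z)
  shuffle′ = solve-∀ℕ

decay-from : ∀ p q j₀ → Decay p q j₀ → (∀ i → (3 ℕ.+ (i ℕ.+ j₀)) ℕ.* p ℕ.≤ q ℕ.* (1 ℕ.+ (i ℕ.+ j₀))) →
  ∀ j → j₀ ℕ.≤ j → Decay p q j
decay-from p q j₀ base step j j₀≤j = subst (Decay p q) (ℕₚ.m∸n+n≡m j₀≤j) (go (j ℕ.∸ j₀))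
  where
  go : ∀ i → Decay p q (i ℕ.+ j₀)
  go zero    = base
  go (suc i) = decay-suc p q (i ℕ.+ j₀) (step i) (go i)

square-large : ∀ c L n .{{_ : ℕ.NonZero c}} → n ℕ.≤ c ℕ.* L → 4 ℕ.* (c ℕ.* c) ℕ.≤ n → 4 ℕ.* n ℕ.≤ L ℕ.* L
square-large c L n n≤cL 4cc≤n = ℕₚ.*-cancelˡ-≤ (c ℕ.* c) {{ℕₚ.m*n≢0 c c}} (begin
  c ℕ.* c ℕ.* (4 ℕ.* n)        ≡⟨ shuffle (c ℕ.* c) n ⟩
  4 ℕ.* (c ℕ.* c) ℕ.* n        ≤⟨ ℕₚ.*-monoˡ-≤ n 4cc≤n ⟩
  n ℕ.* n                      ≤⟨ ℕₚ.*-mono-≤ n≤cL n≤cL ⟩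
  (c ℕ.* L) ℕ.* (c ℕ.* L)      ≡⟨ shuffle′ c L ⟩
  c ℕ.* c ℕ.* (L ℕ.* L) ∎)
  where
  open ℕₚ.≤-Reasoning
  shuffle : ∀ x n → x ℕ.* (4 ℕ.* n) ≡ 4 ℕ.* x ℕ.* n
  shuffle = solve-∀ℕ
  shuffle′ : ∀ c L → (c ℕ.* L) ℕ.* (c ℕ.* L) ≡ c ℕ.* c ℕ.* (L ℕ.* L)
  shuffle′ = solve-∀ℕ

-- With L = t - S the gap says L ≥ n/c, and n ≥ 4c² turns this into L² ≥ 4n.
kr-small-gap : ∀ c .{{_ : ℕ.NonZero c}} D t s m n S → n ≡ 2 ℕ.+ m → S ≡ 2 ℕ.+ s → D ℕ.+ (t ℕ.+ t) ≡ n →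
  n ℕ.+ c ℕ.* S ℕ.≤ c ℕ.* t → 4 ℕ.* (c ℕ.* c) ℕ.≤ n →
  (2 ℕ.+ double (suc s)) ℕ.* (1 ℕ.+ double (suc s)) ℕ.* (D C double (suc s)) ℕ.≤ m C double (suc s) →
  ℤ.- + ((2 ℕ.+ m) C double (2 ℕ.+ s)) ℤ.≤ + suc m ℤ.* kr (D ℕ.+ t) t (double (2 ℕ.+ s))
kr-small-gap c D t s m n S refl refl total gap n-large h
  with ℕₚ.m≤n⇒∃[o]m+o≡n {2 ℕ.+ s} {t} (ℕₚ.*-cancelˡ-≤ c (ℕₚ.≤-trans (ℕₚ.m≤n+m (c ℕ.* (2 ℕ.+ s)) (2 ℕ.+ m)) gap))
... | L , refl = kr-small D (2 ℕ.+ s ℕ.+ L) s m L 0 total (cong (λ l → 2 ℕ.+ (s ℕ.+ l)) (sym (ℕₚ.+-identityʳ L)))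
        (ℕₚ.≤-trans (ℕₚ.*-monoʳ-≤ 4 (ℕₚ.n≤1+n (suc m))) (square-large c L (2 ℕ.+ m) n≤cL n-large)) h
  where
  n≤cL : 2 ℕ.+ m ℕ.≤ c ℕ.* L
  n≤cL = ℕₚ.+-cancelʳ-≤ (c ℕ.* (2 ℕ.+ s)) (2 ℕ.+ m) (c ℕ.* L)
    (subst (2 ℕ.+ m ℕ.+ c ℕ.* (2 ℕ.+ s) ℕ.≤_) (trans (ℕₚ.*-distribˡ-+ c (2 ℕ.+ s) L) (ℕₚ.+-comm (c ℕ.* (2 ℕ.+ s)) (c ℕ.* L))) gap)

-- Scaled by c², the claim follows from 4c²k (m + 2) ≤ m (m + 2) ≤ (m + 1)² ≤ (D c)². The strictness
-- of m < D c is what absorbs the 2 in n = m + 2.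
room-from-ratio : ∀ c .{{_ : ℕ.NonZero c}} k m D t → D ℕ.+ (t ℕ.+ t) ≡ 2 ℕ.+ m →
  4 ℕ.* (c ℕ.* c) ℕ.* k ℕ.≤ m → m ℕ.< D ℕ.* c →
  ∀ j → suc j ℕ.< k → ∃ λ x → j ℕ.+ x ≡ D ℕ.+ (t ℕ.+ t) × 4 ℕ.* (suc j ℕ.* x) ℕ.≤ D ℕ.* D
room-from-ratio c k m D t total k-small m<Dc j j<k with ℕₚ.m≤n⇒∃[o]m+o≡n {j} {2 ℕ.+ m}
    (ℕₚ.≤-trans (ℕₚ.<⇒≤ (ℕₚ.<-trans (ℕₚ.n<1+n j) j<k))
      (ℕₚ.≤-trans (ℕₚ.m≤n*m k (4 ℕ.* (c ℕ.* c)) {{ℕₚ.m*n≢0 4 (c ℕ.* c) {{_}} {{ℕₚ.m*n≢0 c c}}}}) (ℕₚ.≤-trans k-small (ℕₚ.m≤n+m m 2))))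
... | x , j+x = x , trans j+x (sym total) , ℕₚ.*-cancelˡ-≤ (c ℕ.* c) {{ℕₚ.m*n≢0 c c}} (begin
    c ℕ.* c ℕ.* (4 ℕ.* (suc j ℕ.* x))        ≡⟨ expand (c ℕ.* c) (suc j) x ⟩
    4 ℕ.* (c ℕ.* c) ℕ.* suc j ℕ.* x          ≤⟨ ℕₚ.*-mono-≤ (ℕₚ.*-monoʳ-≤ (4 ℕ.* (c ℕ.* c)) (ℕₚ.<⇒≤ j<k)) (subst (x ℕ.≤_) j+x (ℕₚ.m≤n+m x j)) ⟩
    4 ℕ.* (c ℕ.* c) ℕ.* k ℕ.* (2 ℕ.+ m)      ≤⟨ below-square (4 ℕ.* (c ℕ.* c) ℕ.* k) k-small ⟩
    suc m ℕ.* suc m                          ≤⟨ ℕₚ.*-mono-≤ m<Dc m<Dc ⟩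
    (D ℕ.* c) ℕ.* (D ℕ.* c)                  ≡⟨ collect D c ⟩
    c ℕ.* c ℕ.* (D ℕ.* D) ∎)
  where
  open ℕₚ.≤-Reasoning
  expand : ∀ c j x → c ℕ.* (4 ℕ.* (j ℕ.* x)) ≡ 4 ℕ.* c ℕ.* j ℕ.* x
  expand = solve-∀ℕ
  collect : ∀ D c → (D ℕ.* c) ℕ.* (D ℕ.* c) ≡ c ℕ.* c ℕ.* (D ℕ.* D)
  collect = solve-∀ℕ
  square : ∀ a e → a ℕ.* (2 ℕ.+ (a ℕ.+ e)) ℕ.+ (a ℕ.* e ℕ.+ (1 ℕ.+ e) ℕ.* (1 ℕ.+ e)) ≡ suc (a ℕ.+ e) ℕ.* suc (a ℕ.+ e)
  square = solve-∀ℕ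
  below-square : ∀ a → a ℕ.≤ m → a ℕ.* (2 ℕ.+ m) ℕ.≤ suc m ℕ.* suc m
  below-square a a≤m with ℕₚ.m≤n⇒∃[o]m+o≡n a≤m
  ... | e , refl = subst (a ℕ.* (2 ℕ.+ (a ℕ.+ e)) ℕ.≤_) (square a e) (ℕₚ.m≤m+n _ _)

-- D ≤ n/4 forces t ≥ 3n/8, and s ≤ n/8 leaves t - s ≥ n/4.
gap-fixed : ∀ n s D t → D ℕ.+ (t ℕ.+ t) ≡ n → D ℕ.* 4 ℕ.≤ n → 8 ℕ.* s ℕ.≤ n → n ℕ.+ 4 ℕ.* s ℕ.≤ 4 ℕ.* t
gap-fixed n s D t total 4D≤n 8s≤n = ℕₚ.*-cancelˡ-≤ 2 (ℕₚ.+-cancelˡ-≤ n (2 ℕ.* (n ℕ.+ 4 ℕ.* s)) (2 ℕ.* (4 ℕ.* t)) (begin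
  n ℕ.+ 2 ℕ.* (n ℕ.+ 4 ℕ.* s)        ≡⟨ expand n s ⟩
  3 ℕ.* n ℕ.+ 8 ℕ.* s                ≤⟨ ℕₚ.+-monoʳ-≤ (3 ℕ.* n) 8s≤n ⟩
  3 ℕ.* n ℕ.+ n                      ≡⟨ cong (λ z → 3 ℕ.* z ℕ.+ z) (sym total) ⟩
  3 ℕ.* (D ℕ.+ (t ℕ.+ t)) ℕ.+ (D ℕ.+ (t ℕ.+ t)) ≡⟨ collect D t ⟩
  D ℕ.* 4 ℕ.+ 2 ℕ.* (4 ℕ.* t)        ≤⟨ ℕₚ.+-monoˡ-≤ (2 ℕ.* (4 ℕ.* t)) 4D≤n ⟩
  n ℕ.+ 2 ℕ.* (4 ℕ.* t) ∎))
  where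
  open ℕₚ.≤-Reasoning
  expand : ∀ n s → n ℕ.+ 2 ℕ.* (n ℕ.+ 4 ℕ.* s) ≡ 3 ℕ.* n ℕ.+ 8 ℕ.* s
  expand = solve-∀ℕ
  collect : ∀ D t → 3 ℕ.* (D ℕ.+ (t ℕ.+ t)) ℕ.+ (D ℕ.+ (t ℕ.+ t)) ≡ D ℕ.* 4 ℕ.+ 2 ℕ.* (4 ℕ.* t)
  collect = solve-∀ℕ

-- The least degree 2s - 2 is 2, at s = 2, and 4 is the least q with 4 · 3 ≤ q². This fixes the cut
-- D = m/4.
fixed-decay : ∀ j → 2 ℕ.≤ j → Decay 1 4 j
fixed-decay = decay-from 1 4 2 (ℕₚ.≤ᵇ⇒≤ 12 16 _)
  (λ i → subst₂ ℕ._≤_ (left i) (right i) (ℕₚ.m≤m+n (i ℕ.+ 5) (3 ℕ.* i ℕ.+ 7)))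
  where
  left : ∀ i → i ℕ.+ 5 ≡ (3 ℕ.+ (i ℕ.+ 2)) ℕ.* 1
  left = solve-∀ℕ
  right : ∀ i → i ℕ.+ 5 ℕ.+ (3 ℕ.* i ℕ.+ 7) ≡ 4 ℕ.* (1 ℕ.+ (i ℕ.+ 2))
  right = solve-∀ℕ

-- The constant 64 is 4c² for c = 4, wanted by `room-from-ratio` above the cut and by `kr-small-gap`
-- below it.
krawtchouk-fixed : ∀ s m → 64 ℕ.* double (2 ℕ.+ s) ℕ.≤ m → KrawtchoukBound m (double (2 ℕ.+ s))
krawtchouk-fixed s m k-small = bound-by-symmetry m (2 ℕ.+ s) cases
  where
  open ℕₚ.≤-Reasoning
  k = double (2 ℕ.+ s)
  cases : ∀ D t → D ℕ.+ (t ℕ.+ t) ≡ 2 ℕ.+ m →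
    ℤ.- + ((2 ℕ.+ m) C k) ℤ.≤ + suc m ℤ.* kr (D ℕ.+ t) t k
  cases D t total with ℕₚ.≤-<-connex (D ℕ.* 4) m
  ... | inj₁ 4D≤m = kr-small-gap 4 D t s m (2 ℕ.+ m) (2 ℕ.+ s) refl refl total
      (gap-fixed (2 ℕ.+ m) (2 ℕ.+ s) D t total (ℕₚ.≤-trans 4D≤m (ℕₚ.m≤n+m m 2)) (ℕₚ.≤-trans 8s≤m (ℕₚ.m≤n+m m 2)))
      (ℕₚ.≤-trans 64≤m (ℕₚ.m≤n+m m 2))
      (C-ratio-small 1 4 (ℕ.s≤s ℕ.z≤n) ((2 ℕ.+ double (suc s)) ℕ.* (1 ℕ.+ double (suc s))) (double (suc s)) D m (subst (D ℕ.* 4 ℕ.≤_) (sym (ℕₚ.*-identityˡ m)) 4D≤m)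
        (fixed-decay (double (suc s)) (ℕ.s≤s (ℕ.s≤s ℕ.z≤n))))
    where
    s≤k : 2 ℕ.+ s ℕ.≤ k
    s≤k = subst (2 ℕ.+ s ℕ.≤_) (sym (double≡ (2 ℕ.+ s))) (ℕₚ.m≤m+n (2 ℕ.+ s) (2 ℕ.+ s))
    8s≤m : 8 ℕ.* (2 ℕ.+ s) ℕ.≤ m
    8s≤m = ℕₚ.≤-trans (ℕₚ.*-mono-≤ {8} {64} (ℕₚ.≤ᵇ⇒≤ 8 64 _) s≤k) k-small
    64≤m : 64 ℕ.≤ m
    64≤m = ℕₚ.≤-trans (ℕₚ.m≤m*n 64 k) k-small
  ... | inj₂ m<4D = nonneg⇒bound m ((2 ℕ.+ m) C k)
      (kr-nonneg D t k (ℕₚ.*-cancelʳ-< 4 0 D (ℕₚ.≤-trans (ℕ.s≤s ℕ.z≤n) m<4D)) (room-from-ratio 4 k m D t total k-small m<4D))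

-- As 100/17 exceeds 5, x stays below n/5; the strictness of x < k pays for the additive 2.
slack-linear : ∀ x k n → 1 ℕ.+ x ℕ.≤ k → 100 ℕ.* k ℕ.≤ 17 ℕ.* n → 5 ℕ.* x ℕ.+ 2 ℕ.≤ n
slack-linear x k n x<k k-small = ℕₚ.*-cancelˡ-≤ 17 (begin
  17 ℕ.* (5 ℕ.* x ℕ.+ 2)                           ≤⟨ ℕₚ.m≤m+n _ (15 ℕ.* x ℕ.+ 66) ⟩
  17 ℕ.* (5 ℕ.* x ℕ.+ 2) ℕ.+ (15 ℕ.* x ℕ.+ 66)     ≡⟨ collect x ⟩
  100 ℕ.* (1 ℕ.+ x)                                ≤⟨ ℕₚ.*-monoʳ-≤ 100 x<k ⟩
  100 ℕ.* k                                        ≤⟨ k-small ⟩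
  17 ℕ.* n ∎)
  where
  open ℕₚ.≤-Reasoning
  collect : ∀ x → 17 ℕ.* (5 ℕ.* x ℕ.+ 2) ℕ.+ (15 ℕ.* x ℕ.+ 66) ≡ 100 ℕ.* (1 ℕ.+ x)
  collect = solve-∀ℕ

-- With n = 5x + 2 + e this is 4x (n - x + 1) ≤ D². For x ≤ n/5 one has 4x (n - x) ≤ (4n/5)², with
-- equality at x = n/5, whence the cut D = 4n/5; the 2 in n makes up for the extra 1.
square-linear : ∀ x e D → 4 ℕ.* (5 ℕ.* x ℕ.+ 2 ℕ.+ e) ℕ.≤ D ℕ.* 5 → 4 ℕ.* (x ℕ.* (4 ℕ.* x ℕ.+ (3 ℕ.+ e))) ℕ.≤ D ℕ.* D
square-linear x e D 4n≤5D = ℕₚ.*-cancelˡ-≤ 25 (begin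
  25 ℕ.* (4 ℕ.* (x ℕ.* (4 ℕ.* x ℕ.+ (3 ℕ.+ e))))
    ≤⟨ ℕₚ.m≤m+n _ (20 ℕ.* x ℕ.+ 60 ℕ.* (x ℕ.* e) ℕ.+ 16 ℕ.* ((2 ℕ.+ e) ℕ.* (2 ℕ.+ e))) ⟩
  25 ℕ.* (4 ℕ.* (x ℕ.* (4 ℕ.* x ℕ.+ (3 ℕ.+ e)))) ℕ.+ (20 ℕ.* x ℕ.+ 60 ℕ.* (x ℕ.* e) ℕ.+ 16 ℕ.* ((2 ℕ.+ e) ℕ.* (2 ℕ.+ e)))
    ≡⟨ complete x e ⟩
  4 ℕ.* (5 ℕ.* x ℕ.+ 2 ℕ.+ e) ℕ.* (4 ℕ.* (5 ℕ.* x ℕ.+ 2 ℕ.+ e))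
    ≤⟨ ℕₚ.*-mono-≤ 4n≤5D 4n≤5D ⟩
  (D ℕ.* 5) ℕ.* (D ℕ.* 5)
    ≡⟨ collect D ⟩
  25 ℕ.* (D ℕ.* D) ∎)
  where
  open ℕₚ.≤-Reasoning
  collect : ∀ D → (D ℕ.* 5) ℕ.* (D ℕ.* 5) ≡ 25 ℕ.* (D ℕ.* D)
  collect = solve-∀ℕ
  complete : ∀ x e → 25 ℕ.* (4 ℕ.* (x ℕ.* (4 ℕ.* x ℕ.+ (3 ℕ.+ e)))) ℕ.+ (20 ℕ.* x ℕ.+ 60 ℕ.* (x ℕ.* e) ℕ.+ 16 ℕ.* ((2 ℕ.+ e) ℕ.* (2 ℕ.+ e)))
    ≡ 4 ℕ.* (5 ℕ.* x ℕ.+ 2 ℕ.+ e) ℕ.* (4 ℕ.* (5 ℕ.* x ℕ.+ 2 ℕ.+ e))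
  complete = solve-∀ℕ

room-linear : ∀ k n D t → D ℕ.+ (t ℕ.+ t) ≡ n → 100 ℕ.* k ℕ.≤ 17 ℕ.* n → 4 ℕ.* n ℕ.≤ D ℕ.* 5 →
  ∀ j → suc j ℕ.< k → ∃ λ x → j ℕ.+ x ≡ D ℕ.+ (t ℕ.+ t) × 4 ℕ.* (suc j ℕ.* x) ℕ.≤ D ℕ.* D
room-linear k n D t total k-small 4n≤5D j j<k = go (suc j) refl (ℕₚ.m≤n⇒∃[o]m+o≡n (slack-linear (suc j) k n j<k k-small))
  where
  sum : ∀ j e → 1 ℕ.+ (j ℕ.+ (4 ℕ.* (1 ℕ.+ j) ℕ.+ (3 ℕ.+ e))) ≡ 1 ℕ.+ (5 ℕ.* (1 ℕ.+ j) ℕ.+ 2 ℕ.+ e)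
  sum = solve-∀ℕ
  go : ∀ x → suc j ≡ x → ∃ (λ e → 5 ℕ.* x ℕ.+ 2 ℕ.+ e ≡ n) →
    ∃ λ y → j ℕ.+ y ≡ D ℕ.+ (t ℕ.+ t) × 4 ℕ.* (x ℕ.* y) ℕ.≤ D ℕ.* D
  go x x≡ (e , n≡) = 4 ℕ.* x ℕ.+ (3 ℕ.+ e) ,
    trans (subst (λ x → j ℕ.+ (4 ℕ.* x ℕ.+ (3 ℕ.+ e)) ≡ 5 ℕ.* x ℕ.+ 2 ℕ.+ e) x≡ (ℕₚ.suc-injective (sum j e))) (trans n≡ (sym total)) ,
    square-linear x e D (subst (λ z → 4 ℕ.* z ℕ.≤ D ℕ.* 5) (sym n≡) 4n≤5D)

-- D ≤ 4n/5 forces t ≥ n/10, while s ≤ 0.085 n, so t - s ≥ 0.015 n.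
gap-linear : ∀ n s D t → D ℕ.+ (t ℕ.+ t) ≡ n → D ℕ.* 5 ℕ.≤ 4 ℕ.* n → 200 ℕ.* s ℕ.≤ 17 ℕ.* n → n ℕ.+ 100 ℕ.* s ℕ.≤ 100 ℕ.* t
gap-linear n s D t total 5D≤4n s-small = ℕₚ.*-cancelˡ-≤ 2 (ℕₚ.+-cancelˡ-≤ (80 ℕ.* n) (2 ℕ.* (n ℕ.+ 100 ℕ.* s)) (2 ℕ.* (100 ℕ.* t)) (begin
  80 ℕ.* n ℕ.+ 2 ℕ.* (n ℕ.+ 100 ℕ.* s)         ≡⟨ expand n s ⟩
  82 ℕ.* n ℕ.+ 200 ℕ.* s                       ≤⟨ ℕₚ.+-monoʳ-≤ (82 ℕ.* n) s-small ⟩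
  82 ℕ.* n ℕ.+ 17 ℕ.* n                        ≤⟨ ℕₚ.m≤m+n _ n ⟩
  82 ℕ.* n ℕ.+ 17 ℕ.* n ℕ.+ n                  ≡⟨ hundred n ⟩
  100 ℕ.* n                                    ≡⟨ cong (100 ℕ.*_) (sym total) ⟩
  100 ℕ.* (D ℕ.+ (t ℕ.+ t))                    ≡⟨ collect D t ⟩
  20 ℕ.* (D ℕ.* 5) ℕ.+ 2 ℕ.* (100 ℕ.* t)       ≤⟨ ℕₚ.+-monoˡ-≤ (2 ℕ.* (100 ℕ.* t)) (ℕₚ.*-monoʳ-≤ 20 5D≤4n) ⟩
  20 ℕ.* (4 ℕ.* n) ℕ.+ 2 ℕ.* (100 ℕ.* t)       ≡⟨ cong (ℕ._+ 2 ℕ.* (100 ℕ.* t)) (sym (ℕₚ.*-assoc 20 4 n)) ⟩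
  80 ℕ.* n ℕ.+ 2 ℕ.* (100 ℕ.* t) ∎))
  where
  open ℕₚ.≤-Reasoning
  expand : ∀ n s → 80 ℕ.* n ℕ.+ 2 ℕ.* (n ℕ.+ 100 ℕ.* s) ≡ 82 ℕ.* n ℕ.+ 200 ℕ.* s
  expand = solve-∀ℕ
  hundred : ∀ n → 82 ℕ.* n ℕ.+ 17 ℕ.* n ℕ.+ n ≡ 100 ℕ.* n
  hundred = solve-∀ℕ
  collect : ∀ D t → 100 ℕ.* (D ℕ.+ (t ℕ.+ t)) ≡ 20 ℕ.* (D ℕ.* 5) ℕ.+ 2 ℕ.* (100 ℕ.* t)
  collect = solve-∀ℕ

-- A ratio this close to 1 beats the quadratic factor only for large degrees; 48 is the degree 2s -
-- 2 at s = 25, which explains the demand s ≥ 25.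
linear-decay : ∀ j → 48 ℕ.≤ j → Decay 5 6 j
linear-decay = decay-from 5 6 48 (ℕₚ.≤ᵇ⇒≤ (50 ℕ.* 49 ℕ.* 5 ℕ.^ 48) (6 ℕ.^ 48) _)
  (λ i → subst₂ ℕ._≤_ (left i) (right i) (ℕₚ.m≤m+n (5 ℕ.* i ℕ.+ 255) (i ℕ.+ 39)))
  where
  left : ∀ i → 5 ℕ.* i ℕ.+ 255 ≡ (3 ℕ.+ (i ℕ.+ 48)) ℕ.* 5
  left = solve-∀ℕ
  right : ∀ i → 5 ℕ.* i ℕ.+ 255 ℕ.+ (i ℕ.+ 39) ≡ 6 ℕ.* (1 ℕ.+ (i ℕ.+ 48))
  right = solve-∀ℕ

-- The cut compares D with n, the binomial estimate with m = n - 2; relaxing 4/5 to 5/6 covers the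
-- difference.
ratio-linear : ∀ D m → 48 ℕ.≤ m → D ℕ.* 5 ℕ.≤ 4 ℕ.* (2 ℕ.+ m) → D ℕ.* 6 ℕ.≤ 5 ℕ.* m
ratio-linear D m 48≤m h = ℕₚ.*-cancelˡ-≤ 5 (begin
  5 ℕ.* (D ℕ.* 6)                  ≡⟨ swap D ⟩
  6 ℕ.* (D ℕ.* 5)                  ≤⟨ ℕₚ.*-monoʳ-≤ 6 h ⟩
  6 ℕ.* (4 ℕ.* (2 ℕ.+ m))          ≡⟨ expand m ⟩
  48 ℕ.+ 24 ℕ.* m                  ≤⟨ ℕₚ.+-monoˡ-≤ (24 ℕ.* m) 48≤m ⟩
  m ℕ.+ 24 ℕ.* m                   ≡⟨ collect m ⟩
  5 ℕ.* (5 ℕ.* m) ∎)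
  where
  open ℕₚ.≤-Reasoning
  swap : ∀ D → 5 ℕ.* (D ℕ.* 6) ≡ 6 ℕ.* (D ℕ.* 5)
  swap = solve-∀ℕ
  expand : ∀ m → 6 ℕ.* (4 ℕ.* (2 ℕ.+ m)) ≡ 48 ℕ.+ 24 ℕ.* m
  expand = solve-∀ℕ
  collect : ∀ m → m ℕ.+ 24 ℕ.* m ≡ 5 ℕ.* (5 ℕ.* m)
  collect = solve-∀ℕ

linear-small : ∀ n S → 100 ℕ.* double S ℕ.≤ 17 ℕ.* n → 200 ℕ.* S ℕ.≤ 17 ℕ.* n
linear-small n S = subst (ℕ._≤ 17 ℕ.* n) (trans (cong (100 ℕ.*_) (double≡ S)) (two-hundred S))
  where
  two-hundred : ∀ s → 100 ℕ.* (s ℕ.+ s) ≡ 200 ℕ.* s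
  two-hundred = solve-∀ℕ

linear-ratio : ∀ s m D → 24 ℕ.≤ s → D ℕ.* 6 ℕ.≤ 5 ℕ.* m → (2 ℕ.+ double s) ℕ.* (1 ℕ.+ double s) ℕ.* (D C double s) ℕ.≤ m C double s
linear-ratio s m D 24≤s h = C-ratio-small 5 6 (ℕₚ.≤ᵇ⇒≤ 5 6 _) ((2 ℕ.+ double s) ℕ.* (1 ℕ.+ double s)) (double s) D m h (linear-decay (double s) (double-mono-≤ 24≤s))

-- The bound 4 · 100² on n is 4c² for the gap t - S ≥ n/100, that is c = 100.
krawtchouk-linear : ∀ s m n S → n ≡ 2 ℕ.+ m → S ≡ 2 ℕ.+ s → 25 ℕ.≤ S → 100 ℕ.* double S ℕ.≤ 17 ℕ.* n →
  4 ℕ.* (100 ℕ.* 100) ℕ.≤ n → KrawtchoukBound m (double (2 ℕ.+ s))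
krawtchouk-linear s m n S n≡ S≡ s-large k-small n-large = bound-by-symmetry m (2 ℕ.+ s) cases
  where
  48≤m : 48 ℕ.≤ m
  48≤m = ℕₚ.+-cancelˡ-≤ 2 48 m (subst (50 ℕ.≤_) n≡ (ℕₚ.≤-trans (ℕₚ.≤ᵇ⇒≤ 50 (4 ℕ.* (100 ℕ.* 100)) _) n-large))
  24≤s : 24 ℕ.≤ suc s
  24≤s = ℕ.s≤s⁻¹ (subst (25 ℕ.≤_) S≡ s-large)
  k = double (2 ℕ.+ s)
  cases : ∀ D t → D ℕ.+ (t ℕ.+ t) ≡ 2 ℕ.+ m →
    ℤ.- + ((2 ℕ.+ m) C k) ℤ.≤ + suc m ℤ.* kr (D ℕ.+ t) t k
  cases D t total with ℕₚ.≤-total (D ℕ.* 5) (4 ℕ.* n)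
  ... | inj₁ 5D≤4n = kr-small-gap 100 D t s m n S n≡ S≡ (trans total (sym n≡))
      (gap-linear n S D t (trans total (sym n≡)) 5D≤4n (linear-small n S k-small)) n-large
      (linear-ratio (suc s) m D 24≤s (ratio-linear D m 48≤m (subst (λ n → D ℕ.* 5 ℕ.≤ 4 ℕ.* n) n≡ 5D≤4n)))
  ... | inj₂ 4n≤5D = nonneg⇒bound m ((2 ℕ.+ m) C k)
      (kr-nonneg D t k D>0 (subst (λ S → ∀ j → suc j ℕ.< double S → ∃ λ x → j ℕ.+ x ≡ D ℕ.+ (t ℕ.+ t) × 4 ℕ.* (suc j ℕ.* x) ℕ.≤ D ℕ.* D) S≡
        (room-linear (double S) n D t (trans total (sym n≡)) k-small 4n≤5D)))
    where
    D>0 : 0 ℕ.< D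
    D>0 = ℕₚ.*-cancelʳ-< 5 0 D (ℕₚ.≤-trans (ℕ.s≤s ℕ.z≤n) (subst (λ n → 4 ℕ.* n ℕ.≤ D ℕ.* 5) n≡ 4n≤5D))

-- The multinomial coefficient

C-factorial : ∀ {n k} → k ℕ.≤ n → (n C k) ℕ.* (k ! ℕ.* (n ∸ k) !) ≡ n !
C-factorial {n} {k} k≤n = trans (cong (ℕ._* (k ! ℕ.* (n ∸ k) !)) (nCk≡n!/k![n-k]! k≤n))
  (DM.m/n*n≡m {{ℕₚ._!*_!≢0 k (n ∸ k)}} (k![n∸k]!∣n! k≤n))

C-factorial-+ : ∀ a b → ((a ℕ.+ b) C a) ℕ.* (a ! ℕ.* b !) ≡ (a ℕ.+ b) !
C-factorial-+ a b = subst (λ c → ((a ℕ.+ b) C a) ℕ.* (a ! ℕ.* c !) ≡ (a ℕ.+ b) !) (ℕₚ.m+n∸m≡n a b) (C-factorial (ℕₚ.m≤m+n a b))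

δ-refl : ∀ p → δ p p ≡ 1ℤ
δ-refl zero    = refl
δ-refl (suc p) = δ-refl p

g-beyond : ∀ r a p q → r ℕ.< p → g r a 0 p q ≡ 0ℤ
g-beyond r zero    p q r<p = δδ-off p q r r (λ (p≡r , _) → ℕₚ.<⇒≢ r<p (sym p≡r))
g-beyond r (suc a) p q r<p = cong₂ ℤ._+_ (g-beyond r a (suc p) q (ℕₚ.m<n⇒m<1+n r<p)) (g-beyond r a p (suc q) r<p)

-- The binomial theorem, with i = r - p the exponent of x and the second equation matching the
-- degrees.
g-binomial : ∀ r a p q i → p ℕ.+ i ≡ r → a ℕ.+ (p ℕ.+ q) ≡ r ℕ.+ r → g r a 0 p q ≡ + (a C i)
g-binomial r zero p q zero p≡ eq with trans (sym (ℕₚ.+-identityʳ p)) p≡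
... | refl with ℕₚ.+-cancelˡ-≡ p q p eq
... | refl = cong₂ ℤ._*_ (δ-refl p) (δ-refl p)
g-binomial r zero p q (suc i) p≡ eq =
  δδ-off p q r r (λ (p≡r , _) → ℕₚ.m≢1+m+n p (trans p≡r (trans (sym p≡) (ℕₚ.+-suc p i))))
g-binomial r (suc a) p q zero p≡ eq = trans
  (cong₂ ℤ._+_ (g-beyond r a (suc p) q (ℕ.s≤s (ℕₚ.≤-reflexive (trans (sym p≡) (ℕₚ.+-identityʳ p)))))
    (g-binomial r a p (suc q) zero p≡ (trans (cong (a ℕ.+_) (ℕₚ.+-suc p q)) (trans (ℕₚ.+-suc a (p ℕ.+ q)) eq))))
  refl
g-binomial r (suc a) p q (suc i) p≡ eq = trans
  (cong₂ ℤ._+_ (g-binomial r a (suc p) q i (trans (sym (ℕₚ.+-suc p i)) p≡) (trans (ℕₚ.+-suc a (p ℕ.+ q)) eq))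
    (g-binomial r a p (suc q) (suc i) p≡ (trans (cong (a ℕ.+_) (ℕₚ.+-suc p q)) (trans (ℕₚ.+-suc a (p ℕ.+ q)) eq))))
  (cong +_ (sym (pascal a i)))

κ-binomial : ∀ r → κ r (double r) 0 ≡ + (double r C r)
κ-binomial r = g-binomial r (double r) 0 0 r refl (trans (ℕₚ.+-identityʳ (double r)) (double≡ r))

central-factorial : ∀ r → (double r C r) ℕ.* (r ! ℕ.* r !) ≡ double r !
central-factorial r = subst (λ n → (n C r) ℕ.* (r ! ℕ.* r !) ≡ n !) (sym (double≡ r)) (C-factorial-+ r r)

-- Choose the 2s positions of the odd entries, then halve the even and the odd positions. Factoring
-- n! in this way exhibits the denominator as a factor, so the division is exact.
multinom≡ : ∀ n r s → n ≡ double (r ℕ.+ s) → multinom n r s ≡ (n C double s) ℕ.* ((double r C r) ℕ.* (double s C s))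
multinom≡ n r s n≡ = trans (DM./-congˡ {o = d} {{nz}} (trans (cong _! n≡′) (trans (sym (C-factorial-+ (double s) (double r)))
    (trans (cong₂ (λ x y → ((double s ℕ.+ double r) C double s) ℕ.* (x ℕ.* y)) (sym (central-factorial s)) (sym (central-factorial r)))
      (shuffle ((double s ℕ.+ double r) C double s) (double r C r) (double s C s) (r !) (s !))))))
  (trans (DM.m*n/n≡m (((double s ℕ.+ double r) C double s) ℕ.* ((double r C r) ℕ.* (double s C s))) d {{nz}})
    (cong (λ n → (n C double s) ℕ.* ((double r C r) ℕ.* (double s C s))) (sym n≡′)))
  where
  d = r ! ℕ.* r ! ℕ.* s ! ℕ.* s !
  nz : ℕ.NonZero d
  nz = ℕₚ.m*n≢0 (r ! ℕ.* r ! ℕ.* s !) (s !) {{ℕₚ.m*n≢0 (r ! ℕ.* r !) (s !) {{ℕₚ.m*n≢0 (r !) (r !) {{ℕₚ._!≢0 r}} {{ℕₚ._!≢0 r}}}} {{ℕₚ._!≢0 s}}}} {{ℕₚ._!≢0 s}}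
  n≡′ : n ≡ double s ℕ.+ double r
  n≡′ = trans n≡ (trans (double-+ r s) (ℕₚ.+-comm (double r) (double s)))
  shuffle : ∀ x y z a b → x ℕ.* ((z ℕ.* (b ℕ.* b)) ℕ.* (y ℕ.* (a ℕ.* a))) ≡ x ℕ.* (y ℕ.* z) ℕ.* (a ℕ.* a ℕ.* b ℕ.* b)
  shuffle = solve-∀ℕ

U-multinom : ∀ r s n → n ≡ double (r ℕ.+ s) → U r s n 0 0 0 0 0 ≡ + multinom n r s
U-multinom r s n n≡ = trans (U-top r s n n≡) (trans
  (cong₂ ℤ._*_ (kr-binomial n (double s)) (trans (cong₂ ℤ._*_ (κ-binomial r) (κ-binomial s)) (sym (ℤₚ.pos-* (double r C r) (double s C s)))))
  (trans (sym (ℤₚ.pos-* (n C double s) ((double r C r) ℕ.* (double s C s)))) (cong +_ (sym (multinom≡ n r s n≡)))))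

-- The minimum over all vectors

∈-allVecs : ∀ {n} (v : Vec ℤ₄ n) → v ∈ allVecs n
∈-allVecs []      = here refl
∈-allVecs (𝟘 ∷ v) = ∈-++⁺ˡ (∈-map⁺ (𝟘 ∷_) (∈-allVecs v))
∈-allVecs {suc n} (𝟙 ∷ v) = ∈-++⁺ʳ (L.map (𝟘 ∷_) (allVecs n)) (∈-++⁺ˡ (∈-map⁺ (𝟙 ∷_) (∈-allVecs v)))
∈-allVecs {suc n} (𝟚 ∷ v) = ∈-++⁺ʳ (L.map (𝟘 ∷_) (allVecs n)) (∈-++⁺ʳ (L.map (𝟙 ∷_) (allVecs n)) (∈-++⁺ˡ (∈-map⁺ (𝟚 ∷_) (∈-allVecs v))))
∈-allVecs {suc n} (𝟛 ∷ v) = ∈-++⁺ʳ (L.map (𝟘 ∷_) (allVecs n)) (∈-++⁺ʳ (L.map (𝟙 ∷_) (allVecs n))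
  (∈-++⁺ʳ (L.map (𝟚 ∷_) (allVecs n)) (∈-++⁺ˡ (∈-map⁺ (𝟛 ∷_) (∈-allVecs v)))))

module _ {A : Set} (f : A → ℤ) (z : ℤ) where

  foldr-⊓-≤ : ∀ {x xs} → x ∈ xs → L.foldr (λ y acc → f y ℤ.⊓ acc) z xs ℤ.≤ f x
  foldr-⊓-≤ {xs = y L.∷ ys} (here refl) = ℤₚ.i⊓j≤i (f y) _
  foldr-⊓-≤ {xs = y L.∷ ys} (there x∈)  = ℤₚ.≤-trans (ℤₚ.i⊓j≤j (f y) _) (foldr-⊓-≤ x∈)

  foldr-⊓-≥ : ∀ {b} xs → b ℤ.≤ z → (∀ x → b ℤ.≤ f x) → b ℤ.≤ L.foldr (λ y acc → f y ℤ.⊓ acc) z xs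
  foldr-⊓-≥ L.[]       b≤z h = b≤z
  foldr-⊓-≥ (x L.∷ xs) b≤z h = ℤₚ.⊓-glb (h x) (foldr-⊓-≥ xs b≤z h)

-- The length k is separate because the extremal vector has length 1 + (m + 1), which is only
-- propositionally 2 + m.
lamMin-≤ : ∀ r s {n k} (v : Vec ℤ₄ k) → k ≡ n → lamMin r s n ℤ.≤ eigen r s v
lamMin-≤ r s {n} v refl = foldr-⊓-≤ (eigen r s) (eigen r s (V.replicate n 𝟘)) (∈-allVecs v)

lamMin-≥ : ∀ r s {n b} → (∀ (v : Vec ℤ₄ n) → b ℤ.≤ eigen r s v) → b ℤ.≤ lamMin r s n
lamMin-≥ r s {n} h = foldr-⊓-≥ (eigen r s) (eigen r s (V.replicate n 𝟘)) (allVecs n) (h _) h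

kr-κκ-bound : ∀ r s m p q → 2 ℕ.+ m ≡ double (r ℕ.+ s) → KrawtchoukBound m (double s) → p ℕ.+ q ≡ 2 ℕ.+ m →
  ℤ.- U r s (2 ℕ.+ m) 0 0 0 0 0 ℤ.≤ + suc m ℤ.* (kr p q (double s) ℤ.* κκ r s)
kr-κκ-bound r s m p q n≡ kb p+q = begin
  ℤ.- U r s (2 ℕ.+ m) 0 0 0 0 0
    ≡⟨ cong ℤ.-_ (trans (U-top r s (2 ℕ.+ m) n≡) (cong (ℤ._* κκ r s) (kr-binomial (2 ℕ.+ m) (double s)))) ⟩
  ℤ.- (+ ((2 ℕ.+ m) C double s) ℤ.* κκ r s)
    ≡⟨ ℤₚ.neg-distribˡ-* (+ ((2 ℕ.+ m) C double s)) (κκ r s) ⟩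
  ℤ.- + ((2 ℕ.+ m) C double s) ℤ.* κκ r s
    ≤⟨ ℤₚ.*-monoʳ-≤-nonNeg (κκ r s) {{ℤ.nonNegative (κκ-nonneg r s)}} (kb p q p+q) ⟩
  + suc m ℤ.* kr p q (double s) ℤ.* κκ r s
    ≡⟨ ℤₚ.*-assoc (+ suc m) (kr p q (double s)) (κκ r s) ⟩
  + suc m ℤ.* (kr p q (double s) ℤ.* κκ r s) ∎
  where open ℤₚ.≤-Reasoning

even-summand : ∀ e j k → e ℕ.+ double j ≡ double k → ∃ λ i → e ≡ double i × i ℕ.+ j ≡ k
even-summand e j k eq with parity e
... | inj₁ (i , refl) = i , refl , double-injective (i ℕ.+ j) k (trans (double-+ i j) eq)
... | inj₂ (i , refl) = ⊥-elim (odd≢even (i ℕ.+ j) k (trans (cong suc (double-+ i j)) eq))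

T-lower : ∀ r s m q → r ≡ double q → 2 ℕ.+ m ≡ double (r ℕ.+ s) → KrawtchoukBound m (double s) →
  (v : Vec ℤ₄ (2 ℕ.+ m)) → ℤ.- U r s (2 ℕ.+ m) 0 0 0 0 0 ℤ.≤ + suc m ℤ.* T r s v 0 0 0 0
T-lower r s m q r≡ n≡ kb v with parity (odds v)
... | inj₂ (j , odds≡) = subst (ℤ.- U r s (2 ℕ.+ m) 0 0 0 0 0 ℤ.≤_)
        (sym (trans (cong (ℤ._*_ (+ suc m)) (T-odd r s v 0 0 0 0 j (trans (ℕₚ.+-identityʳ (odds v)) odds≡))) (ℤₚ.*-zeroʳ (+ suc m))))
        (ℤₚ.neg-mono-≤ (U-nonneg r s (2 ℕ.+ m) 0 0))
... | inj₁ (j , odds≡) with even-summand (evens v) j (r ℕ.+ s) (trans (cong (evens v ℕ.+_) (sym odds≡)) (trans (evens+odds v) n≡))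
...   | i , evens≡ , i+j = cases i j evens≡ odds≡ i+j
  where
  signs-total : trues (signs v) ℕ.+ falses (signs v) ≡ 2 ℕ.+ m
  signs-total = trans (trues+falses (signs v)) (length-signs v)
  cases : ∀ i j → evens v ≡ double i → odds v ≡ double j → i ℕ.+ j ≡ r ℕ.+ s →
    ℤ.- U r s (2 ℕ.+ m) 0 0 0 0 0 ℤ.≤ + suc m ℤ.* T r s v 0 0 0 0
  cases i zero _ odds≡ _ = subst (λ x → ℤ.- U r s (2 ℕ.+ m) 0 0 0 0 0 ℤ.≤ + suc m ℤ.* x) (sym (T-even r s v n≡ odds≡))
    (kr-κκ-bound r s m (trues (signs v)) (falses (signs v)) n≡ kb signs-total)
  cases zero (suc j) evens≡ _ _ = subst (λ x → ℤ.- U r s (2 ℕ.+ m) 0 0 0 0 0 ℤ.≤ + suc m ℤ.* x) (sym (T-all-odd r s q v r≡ n≡ evens≡))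
    (kr-κκ-bound r s m (trues (signs v)) (falses (signs v)) n≡ kb signs-total)
  cases (suc i) (suc j) evens≡ odds≡ i+j = begin
    ℤ.- U r s (2 ℕ.+ m) 0 0 0 0 0             ≤⟨ ℤₚ.neg-mono-≤ W≤U ⟩
    ℤ.- (+ suc m ℤ.* W r s (suc i) (suc j))   ≡⟨ ℤₚ.neg-distribʳ-* (+ suc m) (W r s (suc i) (suc j)) ⟩
    + suc m ℤ.* (ℤ.- W r s (suc i) (suc j))   ≤⟨ ℤₚ.*-monoˡ-≤-nonNeg (+ suc m) -W≤T ⟩
    + suc m ℤ.* T r s v 0 0 0 0 ∎
    where
    open ℤₚ.≤-Reasoning
    m≡ : m ≡ double (i ℕ.+ suc j)
    m≡ = ℕₚ.suc-injective (ℕₚ.suc-injective (trans n≡ (cong double (sym i+j))))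
    -W≤T : ℤ.- W r s (suc i) (suc j) ℤ.≤ T r s v 0 0 0 0
    -W≤T = subst (ℤ.- W r s (suc i) (suc j) ℤ.≤_) (ℤₚ.neg-involutive (T r s v 0 0 0 0)) (ℤₚ.neg-mono-≤ (subst₂
      (λ α μ → ℤ.- T r s v 0 0 0 0 ℤ.≤ sgn (suc j) ℤ.* U r s α μ 0 0 0 0) evens≡ odds≡
      (proj₂ (T-bound r s v 0 0 0 0 (suc j) (trans (ℕₚ.+-identityʳ (odds v)) odds≡)))))
    W≤U : + suc m ℤ.* W r s (suc i) (suc j) ℤ.≤ U r s (2 ℕ.+ m) 0 0 0 0 0
    W≤U = subst (λ k → + suc k ℤ.* W r s (suc i) (suc j) ℤ.≤ U r s (2 ℕ.+ k) 0 0 0 0 0) (sym m≡)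
      (subst ((1ℤ ℤ.+ + double (i ℕ.+ suc j)) ℤ.* W r s (suc i) (suc j) ℤ.≤_)
        (trans (ℤₚ.*-identityˡ _) (cong (λ k → U r s (double (suc k)) 0 0 0 0 0) (sym (ℕₚ.+-suc i j))))
        (W-bound r s i j))

-- One application of the recurrence, from no odd coordinate to two, is an equality.
extremal-eigenvalue : ∀ r s m → eigenType r s 0 1 m 1 ℤ.* + suc m ≡ ℤ.- U r s (2 ℕ.+ m) 0 0 0 0 0
extremal-eigenvalue r s m = begin
  eigenType r s 0 1 m 1 ℤ.* + suc m          ≡⟨ ℤₚ.*-comm (eigenType r s 0 1 m 1) (+ suc m) ⟩
  + suc m ℤ.* eigenType r s 0 1 m 1          ≡⟨ cong (ℤ._*_ (+ suc m)) (trans (eigen≡T r s (typeVec 0 1 m 1)) (T-extremal r s m)) ⟩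
  + suc m ℤ.* U r s m 2 0 0 0 0              ≡⟨ U-2+ r s m 0 ⟩
  ℤ.- (1ℤ ℤ.* U r s (2 ℕ.+ m) 0 0 0 0 0)     ≡⟨ cong ℤ.-_ (ℤₚ.*-identityˡ _) ⟩
  ℤ.- U r s (2 ℕ.+ m) 0 0 0 0 0 ∎
  where open ≡-Reasoning

minimum-eigenvalue : ∀ r s n m → 2 ∣ r → n ≡ 2 ℕ.+ m → n ≡ double (r ℕ.+ s) → KrawtchoukBound m (double s) →
  (lamMin r s n ≡ eigenType r s 0 1 (n ∸ 2) 1) × (eigenType r s 0 1 (n ∸ 2) 1 ℤ.* + (n ∸ 1) ≡ ℤ.- + multinom n r s)
minimum-eigenvalue r s n m (divides q r≡) refl n≡ kb =
  ℤₚ.≤-antisym (lamMin-≤ r s (typeVec 0 1 m 1) (cong suc (ℕₚ.+-comm m 1))) (lamMin-≥ r s lower) ,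
  trans (extremal-eigenvalue r s m) (cong ℤ.-_ (U-multinom r s (2 ℕ.+ m) n≡))
  where
  open ℤₚ.≤-Reasoning
  μ = eigenType r s 0 1 m 1
  r≡double : r ≡ double q
  r≡double = trans r≡ (trans (ℕₚ.*-comm q 2) (trans (cong (q ℕ.+_) (ℕₚ.+-identityʳ q)) (sym (double≡ q))))
  lower : (v : Vec ℤ₄ (2 ℕ.+ m)) → μ ℤ.≤ eigen r s v
  lower v = ℤₚ.*-cancelˡ-≤-pos μ (eigen r s v) (+ suc m) (begin
    + suc m ℤ.* μ                     ≡⟨ trans (ℤₚ.*-comm (+ suc m) μ) (extremal-eigenvalue r s m) ⟩
    ℤ.- U r s (2 ℕ.+ m) 0 0 0 0 0     ≤⟨ T-lower r s m q r≡double n≡ kb v ⟩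
    + suc m ℤ.* T r s v 0 0 0 0       ≡⟨ cong (ℤ._*_ (+ suc m)) (sym (eigen≡T r s v)) ⟩
    + suc m ℤ.* eigen r s v ∎)

-- Thresholds for the two regimes

2*≡double : ∀ k → 2 ℕ.* k ≡ double k
2*≡double k = trans (cong (k ℕ.+_) (ℕₚ.+-identityʳ k)) (sym (double≡ k))

-- Write α = ν / (d + 1). Since ν ≥ 1, the equation ν k = s (d + 1) gives the first conclusion, by
-- which s grows with n for fixed α.
ratio-numbers : ∀ α k s → ℚ.0ℚ ℚ.< α → α ℚ.≤ (+ 17 / 100) → α ℚ.* (+ k / 1) ≡ (+ s / 1) →
  k ℕ.≤ s ℕ.* suc (ℚ.denominator-1 α) × 100 ℕ.* s ℕ.≤ 17 ℕ.* k
ratio-numbers α@(mkℚ ν d _) k s α>0 α≤ eq = conclude ν (ℚ.positive α>0) (ℚₚ.drop-*≤* α≤) cross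
  where
  cross : ν ℤ.* + k ≡ + s ℤ.* + suc d
  -- Among unnormalised rationals no gcd is divided out, so the equation becomes a plain cross
  -- multiplication.
  cross with ℚᵘₚ.≃-trans (ℚᵘₚ.≃-trans (ℚᵘₚ.*-congˡ {toℚᵘ α} (ℚᵘₚ.≃-sym (ℚₚ.toℚᵘ-fromℚᵘ (mkℚᵘ (+ k) 0))))
      (ℚᵘₚ.≃-sym (ℚₚ.toℚᵘ-homo-* α (+ k / 1)))) (ℚᵘₚ.≃-trans (ℚₚ.toℚᵘ-cong eq) (ℚₚ.toℚᵘ-fromℚᵘ (mkℚᵘ (+ s) 0)))
  ... | *≡* e = trans (sym (ℤₚ.*-identityʳ (ν ℤ.* + k))) (trans e (cong (λ x → + s ℤ.* + suc x) (ℕₚ.*-identityʳ d)))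
  conclude : ∀ ν → ℤ.Positive ν → ν ℤ.* + 100 ℤ.≤ + 17 ℤ.* + suc d → ν ℤ.* + k ≡ + s ℤ.* + suc d →
    k ℕ.≤ s ℕ.* suc d × 100 ℕ.* s ℕ.≤ 17 ℕ.* k
  conclude (+ suc a) _ h e = subst (k ℕ.≤_) e′ (ℕₚ.m≤n*m k (suc a)) , ℕₚ.*-cancelʳ-≤ (100 ℕ.* s) (17 ℕ.* k) (suc d) (begin
    100 ℕ.* s ℕ.* suc d          ≡⟨ ℕₚ.*-assoc 100 s (suc d) ⟩
    100 ℕ.* (s ℕ.* suc d)        ≡⟨ cong (100 ℕ.*_) (sym e′) ⟩
    100 ℕ.* (suc a ℕ.* k)        ≡⟨ swap 100 (suc a) k ⟩
    suc a ℕ.* 100 ℕ.* k          ≤⟨ ℕₚ.*-monoˡ-≤ k h′ ⟩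
    17 ℕ.* suc d ℕ.* k           ≡⟨ swap′ 17 (suc d) k ⟩
    17 ℕ.* k ℕ.* suc d ∎)
    where
    open ℕₚ.≤-Reasoning
    e′ : suc a ℕ.* k ≡ s ℕ.* suc d
    e′ = ℤₚ.+-injective (trans (ℤₚ.pos-* (suc a) k) (trans e (sym (ℤₚ.pos-* s (suc d)))))
    h′ : suc a ℕ.* 100 ℕ.≤ 17 ℕ.* suc d
    h′ = ℤₚ.drop‿+≤+ (subst₂ ℤ._≤_ (sym (ℤₚ.pos-* (suc a) 100)) (sym (ℤₚ.pos-* 17 (suc d))) h)
    swap : ∀ x y z → x ℕ.* (y ℕ.* z) ≡ y ℕ.* x ℕ.* z
    swap = solve-∀ℕ
    swap′ : ∀ x y z → x ℕ.* y ℕ.* z ≡ x ℕ.* z ℕ.* y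
    swap′ = solve-∀ℕ

2≤⇒≡2+ : ∀ n → 2 ℕ.≤ n → n ≡ 2 ℕ.+ (n ∸ 2)
2≤⇒≡2+ n 2≤n = sym (ℕₚ.m+[n∸m]≡n 2≤n)

bound-fixed : ∀ s n m → 2 ℕ.≤ s → n ≡ 2 ℕ.+ m → 2 ℕ.+ 64 ℕ.* double s ℕ.≤ n → KrawtchoukBound m (double s)
bound-fixed zero          n m () refl h
bound-fixed (suc zero)    n m (ℕ.s≤s ()) refl h
bound-fixed (suc (suc s)) n m _  refl h = krawtchouk-fixed s m (ℕₚ.+-cancelˡ-≤ 2 (64 ℕ.* double (2 ℕ.+ s)) m h)

-- The second lower bound on n says k ≥ 25 (d + 1), and with k ≤ s (d + 1) this yields s ≥ 25.
bound-linear : ∀ d k s n m → n ≡ 2 ℕ.+ m → n ≡ 2 ℕ.* k → 4 ℕ.* (100 ℕ.* 100) ℕ.≤ n → 2 ℕ.* (25 ℕ.* suc d) ℕ.≤ n →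
  k ℕ.≤ s ℕ.* suc d → 100 ℕ.* s ℕ.≤ 17 ℕ.* k → KrawtchoukBound m (double s)
bound-linear d k s n m n≡ n≡2k n-large n-large′ k≤ s-small = split (ℕₚ.m≤n⇒∃[o]m+o≡n (ℕₚ.≤-trans (ℕₚ.≤ᵇ⇒≤ 2 25 _) 25≤s))
  where
  open ℕₚ.≤-Reasoning
  25≤s : 25 ℕ.≤ s
  25≤s = ℕₚ.*-cancelʳ-≤ 25 s (suc d) (ℕₚ.≤-trans (ℕₚ.*-cancelˡ-≤ 2 (subst (2 ℕ.* (25 ℕ.* suc d) ℕ.≤_) n≡2k n-large′)) k≤)
  twice : ∀ s → 100 ℕ.* (s ℕ.+ s) ≡ 2 ℕ.* (100 ℕ.* s)
  twice = solve-∀ℕ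
  swap : ∀ k → 2 ℕ.* (17 ℕ.* k) ≡ 17 ℕ.* (2 ℕ.* k)
  swap = solve-∀ℕ
  k-small : 100 ℕ.* double s ℕ.≤ 17 ℕ.* n
  k-small = begin
    100 ℕ.* double s       ≡⟨ cong (100 ℕ.*_) (double≡ s) ⟩
    100 ℕ.* (s ℕ.+ s)      ≡⟨ twice s ⟩
    2 ℕ.* (100 ℕ.* s)      ≤⟨ ℕₚ.*-monoʳ-≤ 2 s-small ⟩
    2 ℕ.* (17 ℕ.* k)       ≡⟨ swap k ⟩
    17 ℕ.* (2 ℕ.* k)       ≡⟨ cong (17 ℕ.*_) (sym n≡2k) ⟩
    17 ℕ.* n ∎
  split : ∃ (λ s′ → 2 ℕ.+ s′ ≡ s) → KrawtchoukBound m (double s)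
  split (s′ , s≡) = subst (λ s → KrawtchoukBound m (double s)) s≡
    (krawtchouk-linear s′ m n s n≡ (sym s≡) 25≤s k-small n-large)

+-≤⁻ : ∀ a b n → a ℕ.+ b ℕ.≤ n → a ℕ.≤ n × b ℕ.≤ n
+-≤⁻ a b n h = ℕₚ.≤-trans (ℕₚ.m≤m+n a b) h , ℕₚ.≤-trans (ℕₚ.m≤n+m b a) h

theorem5 : ((s : ℕ) → 2 ≤ s → ∃ λ (N : ℕ) → (r : ℕ) → 2 ∣ r → s ≤ r → N ≤ 2 ℕ.* (r ℕ.+ s) →
    (lamMin r s (2 ℕ.* (r ℕ.+ s)) ≡ eigenType r s 0 1 (2 ℕ.* (r ℕ.+ s) ∸ 2) 1)
    × (eigenType r s 0 1 (2 ℕ.* (r ℕ.+ s) ∸ 2) 1 ℤ.* + (2 ℕ.* (r ℕ.+ s) ∸ 1)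
    ≡ ℤ.- + multinom (2 ℕ.* (r ℕ.+ s)) r s))
    ×
    ((α : ℚ) → ℚ.0ℚ ℚ.< α → α ℚ.≤ (+ 17 / 100) → ∃ λ (N : ℕ) → (r s : ℕ) → 2 ∣ r → s ≤ r →
    N ≤ 2 ℕ.* (r ℕ.+ s) → ℚ._*_ α (+ (r ℕ.+ s) / 1) ≡ (+ s / 1) →
    (lamMin r s (2 ℕ.* (r ℕ.+ s)) ≡ eigenType r s 0 1 (2 ℕ.* (r ℕ.+ s) ∸ 2) 1)
    × (eigenType r s 0 1 (2 ℕ.* (r ℕ.+ s) ∸ 2) 1 ℤ.* + (2 ℕ.* (r ℕ.+ s) ∸ 1)
    ≡ ℤ.- + multinom (2 ℕ.* (r ℕ.+ s)) r s))
theorem5 =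
  -- The summand 2 is there because the requirement 64 · 2s ≤ m concerns m = n - 2.
  (λ s 2≤s → 2 ℕ.+ 64 ℕ.* double s , λ r r-even s≤r N≤n →
    let n  = 2 ℕ.* (r ℕ.+ s)
        n≡ = 2≤⇒≡2+ n (ℕₚ.≤-trans (ℕₚ.m≤m+n 2 (64 ℕ.* double s)) N≤n)
    in minimum-eigenvalue r s n (n ∸ 2) r-even n≡ (2*≡double (r ℕ.+ s)) (bound-fixed s n (n ∸ 2) 2≤s n≡ N≤n)) ,
  -- The sum stands in for a maximum: one summand serves the gap estimate, the other, through the
  -- denominator of α, forces s ≥ 25.
  (λ α α>0 α≤ → 4 ℕ.* (100 ℕ.* 100) ℕ.+ 2 ℕ.* (25 ℕ.* suc (ℚ.denominator-1 α)) , λ r s r-even s≤r N≤n s≡ →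
    let n           = 2 ℕ.* (r ℕ.+ s)
        (n-large , n-large′) = +-≤⁻ (4 ℕ.* (100 ℕ.* 100)) (2 ℕ.* (25 ℕ.* suc (ℚ.denominator-1 α))) n N≤n
        n≡          = 2≤⇒≡2+ n (ℕₚ.≤-trans (ℕₚ.≤ᵇ⇒≤ 2 (4 ℕ.* (100 ℕ.* 100)) _) n-large)
        (k≤ , s≤α) = ratio-numbers α (r ℕ.+ s) s α>0 α≤ s≡
    in minimum-eigenvalue r s n (n ∸ 2) r-even n≡ (2*≡double (r ℕ.+ s))
         (bound-linear (ℚ.denominator-1 α) (r ℕ.+ s) s n (n ∸ 2) n≡ refl n-large n-large′ k≤ s≤α))
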